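{- There is an algorithm that, given a tree $T$ on $n$ vertices with edge weights $\omega:E(T)\to\mathbb{R}_{\ge 0}$ and an error tolerance $\varepsilon$, decides in $O(n^2)$ time whether $T$ admits an $\varepsilon$-rounding.
   Context: For a tree $T$ with edge weights $\omega:E(T)\to\mathbb{R}_{\ge0}$, the weight of a simple path $\pi$ under a weight function is the sum of the weights of its edges. An $\varepsilon$-rounding of $T$ is a function $\tilde\omega:E(T)\to\mathbb{N}_0$ such that $|\tilde\omega(\pi)-\omega(\pi)|<\varepsilon$ for every simple path $\pi$ in $T$. In a tree every simple path is the unique simple path between its endpoints, hence a shortest path under any non-negative weights, so the additional requirement that shortest paths be preserved is automatic. Running time is measured in a model in which arithmetic operations and comparisons on real numbers, and the floor function, take constant time. -}

module Defs where

open import Algebra.Bundles using (CommutativeRing)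
import Algebra.Properties.Semiring.Mult as Mult
open import Data.Bool.Base using (Bool; true; false; if_then_else_; not; _∧_)
open import Data.Fin.Base using (Fin; toℕ; fromℕ<)
open import Data.Integer.Base using (ℤ; +_; -[1+_])
open import Data.List.Base using (List; []; _∷_; map; foldr; sum)
open import Data.List.Membership.Propositional using (_∉_)
open import Data.List.Relation.Unary.Unique.Propositional using (Unique)
open import Data.Nat.Base as ℕ using (ℕ; zero; suc; _≡ᵇ_; _<ᵇ_)
import Data.Nat.Properties as ℕₚ
open import Data.Product.Base using (Σ; ∃; _×_; _,_; proj₁; proj₂)
open import Data.Sum.Base using (_⊎_)
open import Level using (0ℓ)
open import Relation.Binary.Core using (Rel)
import Relation.Binary.Construct.StrictToNonStrict as StrictToNonStrict
open import Relation.Binary.PropositionalEquality.Core using (_≡_)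
open import Relation.Binary.Structures using (IsStrictTotalOrder)
open import Relation.Nullary.Decidable.Core using (yes; no; ⌊_⌋)
open import Relation.Nullary.Negation.Core using (¬_)

record OrderedField : Set₁ where
  infix  4 _<_
  infix  8 _⁻¹
  field
    commutativeRing : CommutativeRing 0ℓ 0ℓ
  open CommutativeRing commutativeRing public
  field
    _<_                : Rel Carrier 0ℓ
    isStrictTotalOrder : IsStrictTotalOrder _≈_ _<_
    0<1                : 0# < 1#
    +-monoˡ-<          : ∀ {x y} z → x < y → x + z < y + z
    *-positive         : ∀ {x y} → 0# < x → 0# < y → 0# < x * y

    -- Total, but nothing is specified about the inverse of zero.
    _⁻¹                : Carrier → Carrier
    ⁻¹-cong            : ∀ {x y} → x ≈ y → x ⁻¹ ≈ y ⁻¹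
    ⁻¹-inverseʳ        : ∀ {x} → ¬ (x ≈ 0#) → x * x ⁻¹ ≈ 1#

  open IsStrictTotalOrder isStrictTotalOrder public using (_<?_; compare)
  open StrictToNonStrict _≈_ _<_ public using (_≤_)

  fromℕ : ℕ → Carrier
  fromℕ n = Mult._×_ semiring n 1#

  fromℤ : ℤ → Carrier
  fromℤ (+ n)    = fromℕ n
  fromℤ -[1+ n ] = - fromℕ (suc n)

  ∣_∣ : Carrier → Carrier
  ∣ x ∣ = if ⌊ x <? 0# ⌋ then - x else x

-- ℝ is axiomatised as the Dedekind-complete ordered field. The order is
-- decidable (through IsStrictTotalOrder) because the model of computation
-- compares real numbers in one step. Classically such a structure exists
-- and is unique up to isomorphism.

record Reals : Set₁ where
  field
    orderedField : OrderedField
  open OrderedField orderedField public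
  field
    supremum : (S : Carrier → Set) → ∃ S →
               (∃ λ b → ∀ x → S x → x ≤ b) →
               ∃ λ s → (∀ x → S x → x ≤ s) ×
                       (∀ b → (∀ x → S x → x ≤ b) → s ≤ b)

    floor       : Carrier → ℤ
    floor-lower : ∀ x → fromℤ (floor x) ≤ x
    floor-upper : ∀ x → x < fromℤ (floor x) + 1#

record Graph (n m : ℕ) : Set where
  field
    ends : Fin m → Fin n × Fin n

module _ {n m : ℕ} (G : Graph n m) where
  open Graph G

  Joins : Fin m → Fin n → Fin n → Set
  Joins e u v = ends e ≡ (u , v) ⊎ ends e ≡ (v , u)

  data Walk : Fin n → Fin n → Set where
    stop : ∀ {u} → Walk u u
    step : ∀ {u v w} (e : Fin m) → Joins e u v → Walk v w → Walk u w

module _ {n m : ℕ} {G : Graph n m} where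

  vertices : ∀ {u v} → Walk G u v → List (Fin n)
  vertices {u} stop         = u ∷ []
  vertices {u} (step _ _ π) = u ∷ vertices π

  edges : ∀ {u v} → Walk G u v → List (Fin m)
  edges stop         = []
  edges (step e _ π) = e ∷ edges π

  Simple : ∀ {u v} → Walk G u v → Set
  Simple π = Unique (vertices π)

-- A cycle is a simple path together with a further edge that closes it up;
-- loops and pairs of parallel edges count as cycles.

record Cycle {n m : ℕ} (G : Graph n m) : Set where
  field
    {u v}    : Fin n
    path     : Walk G u v
    isSimple : Simple path
    edge     : Fin m
    closes   : Joins G edge v u
    newEdge  : edge ∉ edges path

record IsTree {n m : ℕ} (G : Graph n m) : Set where
  field
    nonEmpty  : 0 ℕ.< n
    connected : ∀ u v → Walk G u v
    acyclic   : ¬ Cycle G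

module _ (ℝ : Reals) where
  open Reals ℝ

  weight : ∀ {n m} {G : Graph n m} → (Fin m → Carrier) →
           ∀ {u v} → Walk G u v → Carrier
  weight ω π = foldr _+_ 0# (map ω (edges π))

  weightℕ : ∀ {n m} {G : Graph n m} → (Fin m → ℕ) →
            ∀ {u v} → Walk G u v → ℕ
  weightℕ ω π = sum (map ω (edges π))

  IsRounding : ∀ {n m} → Graph n m → (Fin m → Carrier) → Carrier →
               (Fin m → ℕ) → Set
  IsRounding G ω ε ω̃ = ∀ {u v} (π : Walk G u v) → Simple π →
                       ∣ fromℕ (weightℕ ω̃ π) - weight ω π ∣ < ε

  AdmitsRounding : ∀ {n m} → Graph n m → (Fin m → Carrier) → Carrier → Set
  AdmitsRounding G ω ε = ∃ (IsRounding G ω ε)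

-- Programs are structured imperative programs over memory cells holding
-- natural numbers and memory cells holding real numbers. A program names
-- finitely many scalar variables and one-dimensional arrays, both by
-- numerals; array indices are computed natural numbers. The only real
-- constants are (embedded) natural numbers.

Name : Set
Name = ℕ

infixl 7 _`*_ _`*ᴿ_ _`/ᴿ_
infixl 6 _`+_ _`∸_ _`+ᴿ_ _`-ᴿ_
infix  5 _`<_ _`≡_ _`<ᴿ_
infixr 4 _`∧_

data NExp : Set where
  lit            : ℕ → NExp
  var            : Name → NExp
  _at_           : Name → NExp → NExp
  _`+_ _`∸_ _`*_ : NExp → NExp → NExp

data RExp : Set where
  cast                       : NExp → RExp
  varᴿ                       : Name → RExp
  _atᴿ_                      : Name → NExp → RExp
  _`+ᴿ_ _`-ᴿ_ _`*ᴿ_ _`/ᴿ_    : RExp → RExp → RExp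
  `floor                     : RExp → RExp

data BExp : Set where
  _`<_ _`≡_ : NExp → NExp → BExp
  _`<ᴿ_     : RExp → RExp → BExp
  `not      : BExp → BExp
  _`∧_      : BExp → BExp → BExp

infix  3 _:=_ _:=ᴿ_ _[_]:=_ _[_]:=ᴿ_
infixr 2 _⨾_

data Program : Set where
  skip      : Program
  _:=_      : Name → NExp → Program
  _:=ᴿ_     : Name → RExp → Program
  _[_]:=_   : Name → NExp → NExp → Program
  _[_]:=ᴿ_  : Name → NExp → RExp → Program
  _⨾_       : Program → Program → Program
  `if       : BExp → Program → Program → Program
  `while    : BExp → Program → Program

costᴺ : NExp → ℕ
costᴺ (lit _)  = 1
costᴺ (var _)  = 1
costᴺ (_ at i) = suc (costᴺ i)
costᴺ (a `+ b) = suc (costᴺ a ℕ.+ costᴺ b)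
costᴺ (a `∸ b) = suc (costᴺ a ℕ.+ costᴺ b)
costᴺ (a `* b) = suc (costᴺ a ℕ.+ costᴺ b)

costᴿ : RExp → ℕ
costᴿ (cast a)   = suc (costᴺ a)
costᴿ (varᴿ _)   = 1
costᴿ (_ atᴿ i)  = suc (costᴺ i)
costᴿ (x `+ᴿ y)  = suc (costᴿ x ℕ.+ costᴿ y)
costᴿ (x `-ᴿ y)  = suc (costᴿ x ℕ.+ costᴿ y)
costᴿ (x `*ᴿ y)  = suc (costᴿ x ℕ.+ costᴿ y)
costᴿ (x `/ᴿ y)  = suc (costᴿ x ℕ.+ costᴿ y)
costᴿ (`floor x) = suc (costᴿ x)

costᴮ : BExp → ℕ
costᴮ (a `< b)  = suc (costᴺ a ℕ.+ costᴺ b)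
costᴮ (a `≡ b)  = suc (costᴺ a ℕ.+ costᴺ b)
costᴮ (x `<ᴿ y) = suc (costᴿ x ℕ.+ costᴿ y)
costᴮ (`not b)  = suc (costᴮ b)
costᴮ (b `∧ c)  = suc (costᴮ b ℕ.+ costᴮ c)

update : {A : Set} → (ℕ → A) → ℕ → A → ℕ → A
update f i a j = if i ≡ᵇ j then a else f j

padded : {A : Set} {m : ℕ} → A → (Fin m → A) → ℕ → A
padded {m = m} d f i with i ℕₚ.<? m
... | yes i<m = f (fromℕ< i<m)
... | no  _   = d

module _ (ℝ : Reals) where
  open Reals ℝ

  record State : Set where
    constructor state
    field
      nvar : Name → ℕ
      rvar : Name → Carrier
      narr : Name → ℕ → ℕ
      rarr : Name → ℕ → Carrier

module _ {ℝ : Reals} where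
  open Reals ℝ
  open State

  evalᴺ : State ℝ → NExp → ℕ
  evalᴺ σ (lit k)  = k
  evalᴺ σ (var x)  = nvar σ x
  evalᴺ σ (a at i) = narr σ a (evalᴺ σ i)
  evalᴺ σ (a `+ b) = evalᴺ σ a ℕ.+ evalᴺ σ b
  evalᴺ σ (a `∸ b) = evalᴺ σ a ℕ.∸ evalᴺ σ b
  evalᴺ σ (a `* b) = evalᴺ σ a ℕ.* evalᴺ σ b

  evalᴿ : State ℝ → RExp → Carrier
  evalᴿ σ (cast a)   = fromℕ (evalᴺ σ a)
  evalᴿ σ (varᴿ x)   = rvar σ x
  evalᴿ σ (a atᴿ i)  = rarr σ a (evalᴺ σ i)
  evalᴿ σ (x `+ᴿ y)  = evalᴿ σ x + evalᴿ σ y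
  evalᴿ σ (x `-ᴿ y)  = evalᴿ σ x - evalᴿ σ y
  evalᴿ σ (x `*ᴿ y)  = evalᴿ σ x * evalᴿ σ y
  evalᴿ σ (x `/ᴿ y)  = evalᴿ σ x * evalᴿ σ y ⁻¹
  evalᴿ σ (`floor x) = fromℤ (floor (evalᴿ σ x))

  evalᴮ : State ℝ → BExp → Bool
  evalᴮ σ (a `< b)  = evalᴺ σ a <ᵇ evalᴺ σ b
  evalᴮ σ (a `≡ b)  = evalᴺ σ a ≡ᵇ evalᴺ σ b
  evalᴮ σ (x `<ᴿ y) = ⌊ evalᴿ σ x <? evalᴿ σ y ⌋
  evalᴮ σ (`not b)  = not (evalᴮ σ b)
  evalᴮ σ (b `∧ c)  = evalᴮ σ b ∧ evalᴮ σ c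

  infix 1 ⟨_,_⟩⇓⟨_,_⟩

  -- ⟨ P , σ ⟩⇓⟨ t , τ ⟩: started in σ, P halts in τ after t units of time.

  data ⟨_,_⟩⇓⟨_,_⟩ : Program → State ℝ → ℕ → State ℝ → Set where
    ⇓skip   : ∀ {σ} → ⟨ skip , σ ⟩⇓⟨ 1 , σ ⟩
    ⇓:=     : ∀ {σ x a} →
              ⟨ x := a , σ ⟩⇓⟨ suc (costᴺ a) ,
                record σ { nvar = update (nvar σ) x (evalᴺ σ a) } ⟩
    ⇓:=ᴿ    : ∀ {σ x e} →
              ⟨ x :=ᴿ e , σ ⟩⇓⟨ suc (costᴿ e) ,
                record σ { rvar = update (rvar σ) x (evalᴿ σ e) } ⟩
    ⇓[]:=   : ∀ {σ x i a} →
              ⟨ x [ i ]:= a , σ ⟩⇓⟨ suc (costᴺ i ℕ.+ costᴺ a) ,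
                record σ { narr = update (narr σ) x
                  (update (narr σ x) (evalᴺ σ i) (evalᴺ σ a)) } ⟩
    ⇓[]:=ᴿ  : ∀ {σ x i e} →
              ⟨ x [ i ]:=ᴿ e , σ ⟩⇓⟨ suc (costᴺ i ℕ.+ costᴿ e) ,
                record σ { rarr = update (rarr σ) x
                  (update (rarr σ x) (evalᴺ σ i) (evalᴿ σ e)) } ⟩
    ⇓⨾      : ∀ {σ τ υ P Q s t} →
              ⟨ P , σ ⟩⇓⟨ s , τ ⟩ → ⟨ Q , τ ⟩⇓⟨ t , υ ⟩ →
              ⟨ P ⨾ Q , σ ⟩⇓⟨ s ℕ.+ t , υ ⟩
    ⇓then   : ∀ {σ τ b P Q t} → evalᴮ σ b ≡ true →
              ⟨ P , σ ⟩⇓⟨ t , τ ⟩ →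
              ⟨ `if b P Q , σ ⟩⇓⟨ suc (costᴮ b ℕ.+ t) , τ ⟩
    ⇓else   : ∀ {σ τ b P Q t} → evalᴮ σ b ≡ false →
              ⟨ Q , σ ⟩⇓⟨ t , τ ⟩ →
              ⟨ `if b P Q , σ ⟩⇓⟨ suc (costᴮ b ℕ.+ t) , τ ⟩
    ⇓done   : ∀ {σ b P} → evalᴮ σ b ≡ false →
              ⟨ `while b P , σ ⟩⇓⟨ suc (costᴮ b) , σ ⟩
    ⇓again  : ∀ {σ τ υ b P s t} → evalᴮ σ b ≡ true →
              ⟨ P , σ ⟩⇓⟨ s , τ ⟩ → ⟨ `while b P , τ ⟩⇓⟨ t , υ ⟩ →
              ⟨ `while b P , σ ⟩⇓⟨ suc (costᴮ b ℕ.+ (s ℕ.+ t)) , υ ⟩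

  -- The input consists of the numbers of vertices and edges, the two ends
  -- and the weight of every edge, and ε. All other cells hold zero.

  input : ∀ {n m} → Graph n m → (Fin m → Carrier) → Carrier → State ℝ
  input {n} {m} G ω ε = state nv rv na ra
    where
    open Graph G

    nv : Name → ℕ
    nv 0 = n
    nv 1 = m
    nv _ = 0

    rv : Name → Carrier
    rv 0 = ε
    rv _ = 0#

    na : Name → ℕ → ℕ
    na 0 = padded 0 (λ e → toℕ (proj₁ (ends e)))
    na 1 = padded 0 (λ e → toℕ (proj₂ (ends e)))
    na _ = λ _ → 0

    ra : Name → ℕ → Carrier
    ra 0 = padded 0# ω
    ra _ = λ _ → 0#

  output : State ℝ → ℕ
  output σ = nvar σ 0

{-# OPTIONS --safe #-}
module Submission where

-- Root the tree and give each vertex v the height h v ∈ [2, 3) that is minus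
-- its distance from the root modulo 1. A rounding amounts to an integral shift
-- of these heights, and the error of a path with ends u, w and topmost vertex a
-- is (height of u) + (height of w) − 2 (height of a). If 2 ≤ ε no shift is
-- needed. If ε < 2, all vertices below v lie less than 2 away from v, so that
-- only the O(n) integral translates of the numbers h w in a bounded interval
-- can be the greatest height below v. For each vertex v and each such candidate
-- U, keep the greatest L such that the part of the tree below v has a rounding
-- within tolerance with all heights in [L, U].
--
-- The table of a child is merged into that of its parent, of height r, along
-- the edge between them: intervals [L, U] and [L′, U′] are compatible iff
-- U + U′ < ε + 2 r and 2 r < ε + (L + L′). The entry at U only needs, besides the
-- entry before it, the pairs in which U meets the greatest compatible candidate
-- U′ ≤ U, which moves monotonically as U grows. One merge thus takes O(n) time
-- with two pointers, and there are n − 1 merges.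

open import Defs
open import Algebra.Bundles using (CommutativeMonoid)
import Algebra.Properties.CommutativeSemigroup as CommutativeSemigroupProperties
import Algebra.Properties.Monoid.Mult as MonoidMult
open import Data.Bool.Base using (Bool; true; false; if_then_else_; not; _∧_; _∨_; T)
open import Data.Empty using (⊥; ⊥-elim)
open import Data.Fin.Base using (Fin; toℕ; fromℕ<; zero; suc)
import Data.Fin.Properties as Finₚ
open import Data.Integer.Base using (+_; -[1+_])
open import Data.List.Base using (List; []; _∷_; _++_; map; length; lookup)
import Data.List.Membership.DecPropositional as DecMembership
open import Data.List.Membership.Propositional using (_∈_; _∉_)
open import Data.List.Membership.Propositional.Properties using (∈-++⁺ʳ; ∈-lookup)
import Data.List.Membership.Setoid.Properties as SetoidMembershipₚ
open import Data.List.Properties using (length-map)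
open import Data.List.Relation.Unary.All as All using (All; []; _∷_)
import Data.List.Relation.Unary.All.Properties as Allₚ
open import Data.List.Relation.Unary.AllPairs using ([]; _∷_)
open import Data.List.Relation.Unary.Any as Any using (here; there)
open import Data.List.Relation.Unary.Unique.Propositional using (Unique)
import Data.List.Relation.Unary.Unique.Propositional.Properties as Uniqueₚ
open import Data.Nat.Base as ℕ using (ℕ; zero; suc; z≤n; s≤s; _≡ᵇ_; _<ᵇ_; _≤ᵇ_; _⊔_; _∸_; NonZero)
open import Data.Nat.Base using (_*_; _^_) renaming (_≤_ to _≤ᴺ_)
open import Data.Nat.DivMod using (_%_; _/_; m≡m%n+[m/n]*n; [m+kn]%n≡m%n; m%n<n; m<n⇒m%n≡m; m<n⇒m/n≡0; m*n/n≡m; /-monoˡ-≤; +-distrib-/-∣ʳ)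
open import Data.Nat.Divisibility using (divides-refl)
import Data.Nat.Properties as ℕ
open import Data.Nat.Solver using (module +-*-Solver)
open import Data.Product.Base using (Σ; ∃; ∃₂; _×_; _,_; proj₁; proj₂)
open import Data.Sum.Base using (_⊎_; inj₁; inj₂; [_,_]′)
open import Data.Unit.Base using (⊤; tt)
open import Data.Vec.Base as Vec using (Vec; []; _∷_; zipWith; replicate)
open import Data.Vec.N-ary using (N-ary; _$ⁿ_)
open import Relation.Binary.Definitions using (tri<; tri≈; tri>)
open import Relation.Binary.PropositionalEquality.Core using (_≡_; _≢_) renaming (refl to ≡-refl; sym to ≡-sym; trans to ≡-trans; cong to ≡-cong; cong₂ to ≡-cong₂; subst to ≡-subst; subst₂ to ≡-subst₂)
open import Relation.Binary.PropositionalEquality.Properties using () renaming (setoid to ≡-setoid)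
open import Relation.Binary.Structures using (IsStrictTotalOrder)
open import Relation.Nullary.Decidable.Core using (yes; no; ⌊_⌋; Dec; _⊎-dec_)
open import Relation.Nullary.Negation.Core using (¬_)

-- Ordered fields

-- The new errors created by hanging a child's tree below a vertex are sums of two heights, one from
-- each side, so the sides interact only through their extreme heights. A larger lower end never
-- hurts, hence one best `L` for each `U`. The greatest compatible partner suffices for this reason:
-- exchanging a partner for a larger compatible one, not above the current index, leaves the upper
-- end of the union unchanged, and since the tables are monotone it can only raise the lower ends.
-- The constants come from the range of the heights. With `ε` below 2 every height that occurs lies
-- strictly between 0 and 5, so 0 is free to mean "no entry". Five unit periods of the `n` fractions
-- contain all these heights, and a sixth supplies a bound of at least 5. A child moves by an
-- integer between -2 and 2, encoded as `κ < 5`. That rounded weights are natural numbers survives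
-- as the condition `2 ≤ κ + z`. The cost of a program is bounded by its syntax alone, and its
-- correctness is shown for a denotation of the same syntax, so the two arguments stay separate.

∧-true : ∀ {b c} → b ∧ c ≡ true → b ≡ true × c ≡ true
∧-true {true} c≡true = ≡-refl , c≡true

≡true⇒T : ∀ {b} → b ≡ true → T b
≡true⇒T ≡-refl = tt

T⇒≡true : ∀ {b} → T b → b ≡ true
T⇒≡true {true} _ = ≡-refl

-- Linear arithmetic in an ordered field: an inequality is accepted when it is
-- a sum of the listed hypotheses and a non-negative constant.

data Linear (k : ℕ) : Set where
  atom      : Fin k → Linear k
  #_        : ℕ → Linear k
  _:+_ _:-_ : Linear k → Linear k → Linear k

infixl 7 _:+_ _:-_
infix  8 #_

data Comparison (k : ℕ) : Set where
  _:<_ _:≤_ _:≈_ : Linear k → Linear k → Comparison k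

infix 6 _:<_ _:≤_ _:≈_

data Entailment (k : ℕ) : Set where
  _⊢_ : List (Comparison k) → Comparison k → Entailment k

infix 3 _⊢_

Coefficients : ℕ → Set
Coefficients k = Vec ℕ (suc k)

unit : ∀ {k} → Fin k → Vec ℕ k
unit {suc k} zero    = 1 ∷ replicate k 0
unit         (suc i) = 0 ∷ unit i

_⊕_ : ∀ {k} → Vec ℕ k → Vec ℕ k → Vec ℕ k
_⊕_ = zipWith ℕ._+_

-- An expression is the difference of the two vectors, so all coefficients stay natural numbers. The
-- head of each vector is the constant term.
positive negative : ∀ {k} → Linear k → Coefficients k
positive (atom i)     = 0 ∷ unit i
positive {k} (# c)    = c ∷ replicate k 0
positive (a :+ b)     = positive a ⊕ positive b
positive (a :- b)     = positive a ⊕ negative b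
negative {k} (atom _) = replicate (suc k) 0
negative {k} (# _)    = replicate (suc k) 0
negative (a :+ b)     = negative a ⊕ negative b
negative (a :- b)     = negative a ⊕ positive b

equalᵇ : ∀ {k} → Vec ℕ k → Vec ℕ k → Bool
equalᵇ []      []      = true
equalᵇ (a ∷ u) (b ∷ v) = (a ≡ᵇ b) ∧ equalᵇ u v

lhs rhs : ∀ {k} → Comparison k → Linear k
lhs (a :< _) = a
lhs (a :≤ _) = a
lhs (a :≈ _) = a
rhs (_ :< b) = b
rhs (_ :≤ b) = b
rhs (_ :≈ b) = b

strict : ∀ {k} → Comparison k → Bool
strict (_ :< _) = true
strict _        = false

totalˡ totalʳ : ∀ {k} → List (Comparison k) → Linear k
totalˡ []       = # 0
totalˡ (c ∷ cs) = lhs c :+ totalˡ cs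
totalʳ []       = # 0
totalʳ (c ∷ cs) = rhs c :+ totalʳ cs

anyStrict : ∀ {k} → List (Comparison k) → Bool
anyStrict []       = false
anyStrict (c ∷ cs) = strict c ∨ anyStrict cs

allEquations : ∀ {k} → List (Comparison k) → Bool
allEquations []              = true
allEquations ((_ :≈ _) ∷ cs) = allEquations cs
allEquations (_ ∷ _)         = false

dominatedᵇ : ∀ {k} → (ℕ → ℕ → Bool) → Coefficients k → Coefficients k → Bool
dominatedᵇ _∼_ (p ∷ u) (q ∷ v) = (p ∼ q) ∧ equalᵇ u v

-- Negative parts cross over to the other side. The coefficients of the atoms must then agree
-- exactly, which leaves only the constants to compare.
boundedᵇ : ∀ {k} → (ℕ → ℕ → Bool) → Linear k → Linear k → Bool
boundedᵇ _∼_ a b = dominatedᵇ _∼_ (positive a ⊕ negative b) (positive b ⊕ negative a)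

-- The hypotheses add up to `totalˡ hs` below `totalʳ hs`, so it is enough that `a + totalʳ hs` is
-- formally below `b + totalˡ hs`: add and cancel. A hypothesis needed twice is listed twice, and an
-- equation is used from left to right only; hence the repeated entries and the many `sym` in later
-- calls.
checks : ∀ {k} → Entailment k → Bool
checks (hs ⊢ a :≤ b) = boundedᵇ _≤ᵇ_ (a :+ totalʳ hs) (b :+ totalˡ hs)
checks (hs ⊢ a :< b) =
  boundedᵇ (if anyStrict hs then _≤ᵇ_ else _<ᵇ_) (a :+ totalʳ hs) (b :+ totalˡ hs)
checks (hs ⊢ a :≈ b) =
  boundedᵇ _≡ᵇ_ (a :+ totalʳ hs) (b :+ totalˡ hs) ∧ allEquations hs

variables : ∀ k → Vec (Linear k) k
variables k = Vec.tabulate atom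

module OrderedFieldProperties (ℝ : Reals) where
  open Reals ℝ
    using (Carrier; _≈_; _<_; _≤_; _+_; _-_; -_; 0#; 1#; fromℕ; compare; 0<1; +-monoˡ-<; isStrictTotalOrder;
           refl; sym; trans; setoid; +-cong; +-congˡ; +-congʳ; +-comm; +-assoc; +-identityˡ; +-identityʳ; -‿inverseʳ;
           +-commutativeMonoid)
  open IsStrictTotalOrder isStrictTotalOrder using (irrefl; <-respˡ-≈; <-respʳ-≈) renaming (trans to <-trans)
  open CommutativeSemigroupProperties (CommutativeMonoid.commutativeSemigroup +-commutativeMonoid) using (interchange)
  open MonoidMult (CommutativeMonoid.monoid +-commutativeMonoid) using (×-homo-+) renaming (_×_ to _·_)
  open import Relation.Binary.Reasoning.Setoid setoid

  <⇒≤ : ∀ {x y} → x < y → x ≤ y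
  <⇒≤ = inj₁

  ≈⇒≤ : ∀ {x y} → x ≈ y → x ≤ y
  ≈⇒≤ = inj₂

  ≤-refl : ∀ {x} → x ≤ x
  ≤-refl = inj₂ refl

  ≮⇒≥ : ∀ {x y} → ¬ (x < y) → y ≤ x
  ≮⇒≥ {x} {y} x≮y with compare x y
  ... | tri< x<y _ _ = ⊥-elim (x≮y x<y)
  ... | tri≈ _ x≈y _ = inj₂ (sym x≈y)
  ... | tri> _ _ y<x = inj₁ y<x

  ≰⇒> : ∀ {x y} → ¬ (x ≤ y) → y < x
  ≰⇒> {x} {y} x≰y with compare x y
  ... | tri< x<y _ _ = ⊥-elim (x≰y (inj₁ x<y))
  ... | tri≈ _ x≈y _ = ⊥-elim (x≰y (inj₂ x≈y))
  ... | tri> _ _ y<x = y<x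

  _≤?_ : ∀ x y → Dec (x ≤ y)
  x ≤? y with compare x y
  ... | tri< x<y _ _ = yes (inj₁ x<y)
  ... | tri≈ _ x≈y _ = yes (inj₂ x≈y)
  ... | tri> x≮y x≉y _ = no [ x≮y , x≉y ]′

  <⇒≱ : ∀ {x y} → x < y → ¬ (y ≤ x)
  <⇒≱ x<y (inj₁ y<x) = irrefl refl (<-trans x<y y<x)
  <⇒≱ x<y (inj₂ y≈x) = irrefl (sym y≈x) x<y

  <-irrefl : ∀ {x} → ¬ (x < x)
  <-irrefl = irrefl refl

  ≤-antisym : ∀ {x y} → x ≤ y → y ≤ x → x ≈ y
  ≤-antisym (inj₂ x≈y) _          = x≈y
  ≤-antisym (inj₁ x<y) y≤x = ⊥-elim (<⇒≱ x<y y≤x)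

  +-monoʳ-< : ∀ {x y} z → x < y → z + x < z + y
  +-monoʳ-< {x} {y} z x<y = <-respˡ-≈ (+-comm x z) (<-respʳ-≈ (+-comm y z) (+-monoˡ-< z x<y))

  +-monoʳ-≤ : ∀ {x y} z → x ≤ y → z + x ≤ z + y
  +-monoʳ-≤ z (inj₁ x<y) = inj₁ (+-monoʳ-< z x<y)
  +-monoʳ-≤ z (inj₂ x≈y) = inj₂ (+-congˡ x≈y)

  +-mono-< : ∀ {x y u v} → x < y → u < v → x + u < y + v
  +-mono-< {y = y} {u = u} x<y u<v = <-trans (+-monoˡ-< u x<y) (+-monoʳ-< y u<v)

  +-mono-<-≤ : ∀ {x y u v} → x < y → u ≤ v → x + u < y + v
  +-mono-<-≤ x<y (inj₁ u<v) = +-mono-< x<y u<v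
  +-mono-<-≤ {u = u} x<y (inj₂ u≈v) = <-respʳ-≈ (+-congˡ u≈v) (+-monoˡ-< u x<y)

  +-mono-≤-< : ∀ {x y u v} → x ≤ y → u < v → x + u < y + v
  +-mono-≤-< (inj₁ x<y) u<v = +-mono-< x<y u<v
  +-mono-≤-< {x = x} (inj₂ x≈y) u<v = <-respʳ-≈ (+-congʳ x≈y) (+-monoʳ-< x u<v)

  +-mono-≤ : ∀ {x y u v} → x ≤ y → u ≤ v → x + u ≤ y + v
  +-mono-≤ (inj₁ x<y) u≤v        = inj₁ (+-mono-<-≤ x<y u≤v)
  +-mono-≤ x≤y        (inj₁ u<v) = inj₁ (+-mono-≤-< x≤y u<v)
  +-mono-≤ (inj₂ x≈y) (inj₂ u≈v) = inj₂ (+-cong x≈y u≈v)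

  +-cancelʳ-< : ∀ {x y} z → x + z < y + z → x < y
  +-cancelʳ-< {x} {y} z p = <-respˡ-≈ (lemma x) (<-respʳ-≈ (lemma y) (+-monoˡ-< (- z) p))
    where
    lemma : ∀ w → w + z + - z ≈ w
    lemma w = trans (+-assoc w z (- z)) (trans (+-congˡ (-‿inverseʳ z)) (+-identityʳ w))

  +-cancelʳ-≤ : ∀ {x y} z → x + z ≤ y + z → x ≤ y
  +-cancelʳ-≤ {x} {y} z p = ≮⇒≥ (λ y<x → <⇒≱ (+-monoˡ-< z y<x) p)

  fromℕ-+ : ∀ a b → fromℕ (a ℕ.+ b) ≈ fromℕ a + fromℕ b
  fromℕ-+ = ×-homo-+ 1#

  fromℕ-cong : ∀ {a b} → a ≡ b → fromℕ a ≈ fromℕ b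
  fromℕ-cong ≡-refl = refl

  0≤fromℕ : ∀ a → 0# ≤ fromℕ a
  0<fromℕ : ∀ a → 0# < fromℕ (suc a)
  0≤fromℕ zero    = ≤-refl
  0≤fromℕ (suc a) = inj₁ (0<fromℕ a)
  0<fromℕ a = <-respˡ-≈ (+-identityʳ 0#) (+-mono-<-≤ 0<1 (0≤fromℕ a))

  fromℕ-mono-≤ : ∀ {a b} → a ℕ.≤ b → fromℕ a ≤ fromℕ b
  fromℕ-mono-≤ {b = b} z≤n = 0≤fromℕ b
  fromℕ-mono-≤ (s≤s a≤b)   = +-monoʳ-≤ 1# (fromℕ-mono-≤ a≤b)

  fromℕ-mono-< : ∀ {a b} → a ℕ.< b → fromℕ a < fromℕ b
  fromℕ-mono-< {zero}  {suc b} _         = 0<fromℕ b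
  fromℕ-mono-< {suc a} {suc b} (s≤s a<b) = +-monoʳ-< 1# (fromℕ-mono-< a<b)

  fromℕ-cancel-< : ∀ {a b} → fromℕ a < fromℕ b → a ℕ.< b
  fromℕ-cancel-< {a} {b} p with a ℕ.<? b
  ... | yes a<b = a<b
  ... | no  a≮b = ⊥-elim (<⇒≱ p (fromℕ-mono-≤ (ℕ.≮⇒≥ a≮b)))

  ⟦_⟧ : ∀ {k} → Linear k → Vec Carrier k → Carrier
  ⟦ atom i ⟧ ρ = Vec.lookup ρ i
  ⟦ # c    ⟧ ρ = fromℕ c
  ⟦ a :+ b ⟧ ρ = ⟦ a ⟧ ρ + ⟦ b ⟧ ρ
  ⟦ a :- b ⟧ ρ = ⟦ a ⟧ ρ - ⟦ b ⟧ ρ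

  Holds : ∀ {k} → Vec Carrier k → Comparison k → Set
  Holds ρ (a :< b) = ⟦ a ⟧ ρ < ⟦ b ⟧ ρ
  Holds ρ (a :≤ b) = ⟦ a ⟧ ρ ≤ ⟦ b ⟧ ρ
  Holds ρ (a :≈ b) = ⟦ a ⟧ ρ ≈ ⟦ b ⟧ ρ

  -- A single hypothesis stands for itself, without a closing unit, so that callers pass plain
  -- tuples.
  AllHold : ∀ {k} → Vec Carrier k → List (Comparison k) → Set
  AllHold ρ []            = ⊤
  AllHold ρ (c ∷ [])      = Holds ρ c
  AllHold ρ (c ∷ d ∷ cs)  = Holds ρ c × AllHold ρ (d ∷ cs)

  Hypotheses : ∀ {k} → Vec Carrier k → Entailment k → Set
  Hypotheses ρ (hs ⊢ _) = AllHold ρ hs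

  Conclusion : ∀ {k} → Vec Carrier k → Entailment k → Set
  Conclusion ρ (_ ⊢ c) = Holds ρ c

  dot : ∀ {k} → Vec ℕ k → Vec Carrier k → Carrier
  dot []      []      = 0#
  dot (a ∷ u) (x ∷ ρ) = a · x + dot u ρ

  dot-⊕ : ∀ {k} (u v : Vec ℕ k) ρ → dot (u ⊕ v) ρ ≈ dot u ρ + dot v ρ
  dot-⊕ []      []      []      = sym (+-identityʳ 0#)
  dot-⊕ (a ∷ u) (b ∷ v) (x ∷ ρ) =
    trans (+-cong (×-homo-+ x a b) (dot-⊕ u v ρ)) (interchange _ _ _ _)

  dot-0 : ∀ {k} (ρ : Vec Carrier k) → dot (replicate k 0) ρ ≈ 0#
  dot-0 []      = refl
  dot-0 (x ∷ ρ) = trans (+-identityˡ _) (dot-0 ρ)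

  dot-unit : ∀ {k} (i : Fin k) ρ → dot (unit i) ρ ≈ Vec.lookup ρ i
  dot-unit zero    (x ∷ ρ) = trans (+-congˡ (dot-0 ρ)) (trans (+-identityʳ _) (+-identityʳ x))
  dot-unit (suc i) (x ∷ ρ) = trans (+-identityˡ _) (dot-unit i ρ)

  value : ∀ {k} → Coefficients k → Vec Carrier k → Carrier
  value u ρ = dot u (1# ∷ ρ)

  positive-negative : ∀ {k} (a : Linear k) ρ → ⟦ a ⟧ ρ + value (negative a) ρ ≈ value (positive a) ρ
  positive-negative (atom i) ρ = begin
    Vec.lookup ρ i + value (negative (atom i)) ρ  ≈⟨ +-congˡ (dot-0 (1# ∷ ρ)) ⟩
    Vec.lookup ρ i + 0#                           ≈⟨ +-comm _ _ ⟩
    0# + Vec.lookup ρ i                           ≈⟨ +-congˡ (sym (dot-unit i ρ)) ⟩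
    value (positive (atom i)) ρ               ∎
  positive-negative (# c) ρ = +-congˡ (trans (dot-0 (1# ∷ ρ)) (sym (dot-0 ρ)))
  positive-negative (a :+ b) ρ = begin
    (⟦ a ⟧ ρ + ⟦ b ⟧ ρ) + value (negative a ⊕ negative b) ρ
      ≈⟨ +-congˡ (dot-⊕ (negative a) (negative b) _) ⟩
    (⟦ a ⟧ ρ + ⟦ b ⟧ ρ) + (value (negative a) ρ + value (negative b) ρ)
      ≈⟨ interchange _ _ _ _ ⟩
    (⟦ a ⟧ ρ + value (negative a) ρ) + (⟦ b ⟧ ρ + value (negative b) ρ)
      ≈⟨ +-cong (positive-negative a ρ) (positive-negative b ρ) ⟩
    value (positive a) ρ + value (positive b) ρ
      ≈⟨ dot-⊕ (positive a) (positive b) _ ⟨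
    value (positive a ⊕ positive b) ρ ∎
  positive-negative (a :- b) ρ = begin
    (⟦ a ⟧ ρ - ⟦ b ⟧ ρ) + value (negative a ⊕ positive b) ρ
      ≈⟨ +-congˡ (dot-⊕ (negative a) (positive b) _) ⟩
    (⟦ a ⟧ ρ - ⟦ b ⟧ ρ) + (value (negative a) ρ + value (positive b) ρ)
      ≈⟨ interchange _ _ _ _ ⟩
    (⟦ a ⟧ ρ + value (negative a) ρ) + (- ⟦ b ⟧ ρ + value (positive b) ρ)
      ≈⟨ +-cong (positive-negative a ρ) (+-congˡ (sym (positive-negative b ρ))) ⟩
    value (positive a) ρ + (- ⟦ b ⟧ ρ + (⟦ b ⟧ ρ + value (negative b) ρ))
      ≈⟨ +-congˡ (cancel (⟦ b ⟧ ρ) _) ⟩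
    value (positive a) ρ + value (negative b) ρ
      ≈⟨ dot-⊕ (positive a) (negative b) _ ⟨
    value (positive a ⊕ negative b) ρ ∎
    where
    cancel : ∀ x y → - x + (x + y) ≈ y
    cancel x y = trans (sym (+-assoc _ _ _)) (trans (+-congʳ (trans (+-comm _ _) (-‿inverseʳ x))) (+-identityˡ y))

  equalᵇ⇒≡ : ∀ {k} (u v : Vec ℕ k) → equalᵇ u v ≡ true → u ≡ v
  equalᵇ⇒≡ []      []      _ = ≡-refl
  equalᵇ⇒≡ (a ∷ u) (b ∷ v) e =
    ≡-cong₂ _∷_ (ℕ.≡ᵇ⇒≡ a b (≡true⇒T (proj₁ (∧-true {a ≡ᵇ b} e)))) (equalᵇ⇒≡ u v (proj₂ (∧-true {a ≡ᵇ b} e)))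

  Embeds : (ℕ → ℕ → Bool) → (Carrier → Carrier → Set) → Set
  Embeds _∼_ _≲_ = ∀ a b → (a ∼ b) ≡ true → fromℕ a ≲ fromℕ b

  embeds-≤ : Embeds _≤ᵇ_ _≤_
  embeds-≤ a b e = fromℕ-mono-≤ (ℕ.≤ᵇ⇒≤ a b (≡true⇒T e))

  embeds-< : Embeds _<ᵇ_ _<_
  embeds-< a b e = fromℕ-mono-< (ℕ.<ᵇ⇒< a b (≡true⇒T e))

  embeds-≈ : Embeds _≡ᵇ_ _≈_
  embeds-≈ a b e with ℕ.≡ᵇ⇒≡ a b (≡true⇒T e)
  ... | ≡-refl = refl

  module _ (_∼_ : ℕ → ℕ → Bool) (_≲_ : Carrier → Carrier → Set) (embeds : Embeds _∼_ _≲_)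
           (≲-mono : ∀ {x y} z → x ≲ y → (x + z) ≲ (y + z))
           (≲-resp : ∀ {x y u v} → x ≈ y → u ≈ v → x ≲ u → y ≲ v)
           (≲-cancel : ∀ {x y} z → (x + z) ≲ (y + z) → x ≲ y) where

    dominated : ∀ {k} (u v : Coefficients k) ρ → dominatedᵇ _∼_ u v ≡ true → value u ρ ≲ value v ρ
    dominated (p ∷ u) (q ∷ v) ρ e with ∧-true {p ∼ q} e
    ... | p∼q , u≡v with equalᵇ⇒≡ u v u≡v
    ...   | ≡-refl = ≲-mono (dot u ρ) (embeds p q p∼q)

    bounded : ∀ {k} (a b : Linear k) ρ → boundedᵇ _∼_ a b ≡ true → ⟦ a ⟧ ρ ≲ ⟦ b ⟧ ρ
    bounded a b ρ e = ≲-cancel (value (negative a) ρ + value (negative b) ρ)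
      (≲-resp left right (dominated (positive a ⊕ negative b) (positive b ⊕ negative a) ρ e))
      where
      left : value (positive a ⊕ negative b) ρ ≈ ⟦ a ⟧ ρ + (value (negative a) ρ + value (negative b) ρ)
      left = trans (dot-⊕ (positive a) (negative b) _)
                   (trans (+-congʳ (sym (positive-negative a ρ))) (+-assoc _ _ _))
      right : value (positive b ⊕ negative a) ρ ≈ ⟦ b ⟧ ρ + (value (negative a) ρ + value (negative b) ρ)
      right = trans (dot-⊕ (positive b) (negative a) _)
                    (trans (+-congʳ (sym (positive-negative b ρ))) (trans (+-assoc _ _ _) (+-congˡ (+-comm _ _))))

  +-monoˡ-≤ : ∀ {x y} z → x ≤ y → x + z ≤ y + z
  +-monoˡ-≤ z x≤y = +-mono-≤ x≤y ≤-refl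

  +-cancelʳ-≈ : ∀ {x y} z → x + z ≈ y + z → x ≈ y
  +-cancelʳ-≈ z p = ≤-antisym (+-cancelʳ-≤ z (inj₂ p)) (+-cancelʳ-≤ z (inj₂ (sym p)))

  <-resp : ∀ {x y u v} → x ≈ y → u ≈ v → x < u → y < v
  <-resp x≈y u≈v p = <-respˡ-≈ x≈y (<-respʳ-≈ u≈v p)

  ≤-resp : ∀ {x y u v} → x ≈ y → u ≈ v → x ≤ u → y ≤ v
  ≤-resp x≈y u≈v (inj₁ p) = inj₁ (<-resp x≈y u≈v p)
  ≤-resp x≈y u≈v (inj₂ p) = inj₂ (trans (sym x≈y) (trans p u≈v))

  bounded-≤ : ∀ {k} (a b : Linear k) ρ → boundedᵇ _≤ᵇ_ a b ≡ true → ⟦ a ⟧ ρ ≤ ⟦ b ⟧ ρ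
  bounded-≤ = bounded _≤ᵇ_ _≤_ embeds-≤ +-monoˡ-≤ ≤-resp +-cancelʳ-≤

  bounded-< : ∀ {k} (a b : Linear k) ρ → boundedᵇ _<ᵇ_ a b ≡ true → ⟦ a ⟧ ρ < ⟦ b ⟧ ρ
  bounded-< = bounded _<ᵇ_ _<_ embeds-< +-monoˡ-< <-resp +-cancelʳ-<

  bounded-≈ : ∀ {k} (a b : Linear k) ρ → boundedᵇ _≡ᵇ_ a b ≡ true → ⟦ a ⟧ ρ ≈ ⟦ b ⟧ ρ
  bounded-≈ = bounded _≡ᵇ_ _≈_ embeds-≈ (λ _ → +-congʳ) (λ p q r → trans (sym p) (trans r q)) +-cancelʳ-≈

  weaken : ∀ {k} ρ (c : Comparison k) → Holds ρ c → ⟦ lhs c ⟧ ρ ≤ ⟦ rhs c ⟧ ρ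
  weaken ρ (a :< b) = inj₁
  weaken ρ (a :≤ b) p = p
  weaken ρ (a :≈ b) = inj₂

  total-≤ : ∀ {k} ρ (hs : List (Comparison k)) → AllHold ρ hs → ⟦ totalˡ hs ⟧ ρ ≤ ⟦ totalʳ hs ⟧ ρ
  total-≤ ρ []           _        = ≤-refl
  total-≤ ρ (c ∷ [])     p        = +-mono-≤ (weaken ρ c p) ≤-refl
  total-≤ ρ (c ∷ d ∷ hs) (p , ps) = +-mono-≤ (weaken ρ c p) (total-≤ ρ (d ∷ hs) ps)

  total-< : ∀ {k} ρ (hs : List (Comparison k)) → anyStrict hs ≡ true → AllHold ρ hs →
            ⟦ totalˡ hs ⟧ ρ < ⟦ totalʳ hs ⟧ ρ
  total-< ρ ((a :< b) ∷ [])     e p        = +-mono-<-≤ p ≤-refl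
  total-< ρ ((a :< b) ∷ d ∷ hs) e (p , ps) = +-mono-<-≤ p (total-≤ ρ (d ∷ hs) ps)
  total-< ρ ((a :≤ b) ∷ d ∷ hs) e (p , ps) = +-mono-≤-< p (total-< ρ (d ∷ hs) e ps)
  total-< ρ ((a :≈ b) ∷ d ∷ hs) e (p , ps) = +-mono-≤-< (inj₂ p) (total-< ρ (d ∷ hs) e ps)

  total-≈ : ∀ {k} ρ (hs : List (Comparison k)) → allEquations hs ≡ true → AllHold ρ hs →
            ⟦ totalˡ hs ⟧ ρ ≈ ⟦ totalʳ hs ⟧ ρ
  total-≈ ρ []                  e p        = refl
  total-≈ ρ ((a :≈ b) ∷ [])     e p        = +-congʳ p
  total-≈ ρ ((a :≈ b) ∷ d ∷ hs) e (p , ps) = +-cong p (total-≈ ρ (d ∷ hs) e ps)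

  <-≤-trans : ∀ {x y z} → x < y → y ≤ z → x < z
  <-≤-trans x<y (inj₁ y<z) = <-trans x<y y<z
  <-≤-trans x<y (inj₂ y≈z) = <-respʳ-≈ y≈z x<y

  ≤-<-trans : ∀ {x y z} → x ≤ y → y < z → x < z
  ≤-<-trans (inj₁ x<y) y<z = <-trans x<y y<z
  ≤-<-trans (inj₂ x≈y) y<z = <-respˡ-≈ (sym x≈y) y<z

  ≤-trans : ∀ {x y z} → x ≤ y → y ≤ z → x ≤ z
  ≤-trans (inj₁ x<y) y≤z        = inj₁ (<-≤-trans x<y y≤z)
  ≤-trans (inj₂ x≈y) (inj₁ y<z) = inj₁ (<-respˡ-≈ (sym x≈y) y<z)
  ≤-trans (inj₂ x≈y) (inj₂ y≈z) = inj₂ (trans x≈y y≈z)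

  entails : ∀ {k} ρ (s : Entailment k) → checks s ≡ true → Hypotheses ρ s → Conclusion ρ s
  entails ρ (hs ⊢ a :≤ b) e ps = +-cancelʳ-≤ (⟦ totalʳ hs ⟧ ρ)
    (≤-trans (bounded-≤ (a :+ totalʳ hs) (b :+ totalˡ hs) ρ e) (+-monoʳ-≤ _ (total-≤ ρ hs ps)))
  entails ρ (hs ⊢ a :< b) e ps with anyStrict hs in eq
  ... | true = +-cancelʳ-< (⟦ totalʳ hs ⟧ ρ)
    (≤-<-trans (bounded-≤ (a :+ totalʳ hs) (b :+ totalˡ hs) ρ e) (+-monoʳ-< _ (total-< ρ hs eq ps)))
  ... | false = +-cancelʳ-< (⟦ totalʳ hs ⟧ ρ)
    (<-≤-trans (bounded-< (a :+ totalʳ hs) (b :+ totalˡ hs) ρ e) (+-monoʳ-≤ _ (total-≤ ρ hs ps)))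
  entails ρ (hs ⊢ a :≈ b) e ps with ∧-true {boundedᵇ _≡ᵇ_ (a :+ totalʳ hs) (b :+ totalˡ hs)} e
  ... | e₁ , e₂ = +-cancelʳ-≈ (⟦ totalʳ hs ⟧ ρ)
    (trans (bounded-≈ (a :+ totalʳ hs) (b :+ totalˡ hs) ρ e₁) (+-congˡ (total-≈ ρ hs e₂ ps)))

  -- For a concrete entailment that is accepted, the implicit argument reduces to `⊤` and is filled
  -- in silently; a false claim is rejected by the type checker.
  linear : ∀ {k} (ρ : Vec Carrier k) (s : N-ary k (Linear k) (Entailment k)) →
           {_ : T (checks (s $ⁿ variables k))} → Hypotheses ρ (s $ⁿ variables k) → Conclusion ρ (s $ⁿ variables k)
  linear {k} ρ s {e} = entails ρ (s $ⁿ variables k) (T⇒≡true e)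

-- Programs as functions

-- A fragment of the programming language in which every loop runs for a
-- number of iterations fixed by the input size, so that programs denote total
-- functions and their cost is bounded by their syntax.

data Count : Set where
  constant        : ℕ → Count
  multipleOfOrder : ℕ → Count
  edgeCount       : Count

data Code : Set where
  nop   : Code
  set   : Name → NExp → Code
  setᴿ  : Name → RExp → Code
  put   : Name → NExp → NExp → Code
  putᴿ  : Name → NExp → RExp → Code
  _▸_   : Code → Code → Code
  cond  : BExp → Code → Code → Code
  loop  : Name → Count → Code → Code

infixr 2 _▸_

countᴺ : Count → NExp
countᴺ (constant k)        = lit k
countᴺ (multipleOfOrder k) = lit k `* var 0
countᴺ edgeCount           = var 1

increment : Name → NExp
increment x = var x `+ lit 1

compile : Code → Program
compile nop          = skip
compile (set x a)    = x := a
compile (setᴿ x e)   = x :=ᴿ e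
compile (put x i a)  = x [ i ]:= a
compile (putᴿ x i e) = x [ i ]:=ᴿ e
compile (c ▸ d)      = compile c ⨾ compile d
compile (cond b c d) = `if b (compile c) (compile d)
compile (loop x k c) = x := lit 0 ⨾ `while (var x `< countᴺ k) (compile c ⨾ x := increment x)

data Kind : Set where
  ℕ-var ℝ-var ℕ-array ℝ-array : Kind

writes : Kind → Name → Code → Bool
writes _       _ nop          = false
writes ℕ-var   y (set x _)    = x ≡ᵇ y
writes ℝ-var   y (setᴿ x _)   = x ≡ᵇ y
writes ℕ-array y (put x _ _)  = x ≡ᵇ y
writes ℝ-array y (putᴿ x _ _) = x ≡ᵇ y
writes κ       y (c ▸ d)      = writes κ y c ∨ writes κ y d
writes κ       y (cond _ c d) = writes κ y c ∨ writes κ y d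
writes ℕ-var   y (loop x _ c) = (x ≡ᵇ y) ∨ writes ℕ-var y c
writes κ       y (loop x _ c) = writes κ y c
writes _       _ _            = false

Cells : Set
Cells = List (Kind × Name)

keepsAll : Cells → Code → Bool
keepsAll []            c = true
keepsAll ((κ , y) ∷ l) c = not (writes κ y c) ∧ keepsAll l c

keepsSizes : Code → Bool
keepsSizes c = not (writes ℕ-var 0 c) ∧ not (writes ℕ-var 1 c)

-- Loop bounds are read from cells 0 and 1, which must therefore survive until each later part
-- starts. The last part of a sequence is exempt: it may write the answer over the order in cell 0.
wellFormed : Code → Bool
wellFormed (c ▸ d)      = wellFormed c ∧ (wellFormed d ∧ keepsSizes c)
wellFormed (cond _ c d) = wellFormed c ∧ wellFormed d
wellFormed (loop x k c) = wellFormed c ∧ (keepsSizes (loop x k c) ∧ not (writes ℕ-var x c))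
wellFormed _            = true

countDegree countFactor : Count → ℕ
countDegree (constant _)        = 0
countDegree (multipleOfOrder _) = 1
countDegree edgeCount           = 1
countFactor (constant k)        = k
countFactor (multipleOfOrder k) = k
countFactor edgeCount           = 1

degree factor : Code → ℕ
degree (c ▸ d)      = degree c ⊔ degree d
degree (cond _ c d) = degree c ⊔ degree d
degree (loop _ k c) = countDegree k ℕ.+ degree c
degree _            = 0
factor nop          = 1
factor (set _ a)    = suc (costᴺ a)
factor (setᴿ _ e)   = suc (costᴿ e)
factor (put _ i a)  = suc (costᴺ i ℕ.+ costᴺ a)
factor (putᴿ _ i e) = suc (costᴺ i ℕ.+ costᴿ e)
factor (c ▸ d)      = factor c ℕ.+ factor d
factor (cond b c d) = suc (costᴮ b ℕ.+ (factor c ℕ.+ factor d))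
-- 8 pays for clearing the counter (2) and the guard that fails (at most 6); 10 pays for a guard
-- that succeeds (at most 6) and the increment (4).
factor (loop _ k c) = 8 ℕ.+ countFactor k ℕ.* (factor c ℕ.+ 10)

iterate : {A : Set} → ℕ → (A → A) → A → A
iterate zero    f a = a
iterate (suc k) f a = f (iterate k f a)

iterate-suc : {A : Set} (k : ℕ) (f : A → A) (a : A) → iterate k f (f a) ≡ iterate (suc k) f a
iterate-suc zero    f a = ≡-refl
iterate-suc (suc k) f a = ≡-cong f (iterate-suc k f a)

update-hit : {A : Set} (f : ℕ → A) {i j : ℕ} (a : A) → i ≡ j → update f i a j ≡ a
update-hit f {i} a ≡-refl with i ≡ᵇ i in eq
... | true  = ≡-refl
... | false = ⊥-elim (≡-subst T eq (ℕ.≡⇒≡ᵇ i i ≡-refl))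

update-miss : {A : Set} (f : ℕ → A) {i j : ℕ} (a : A) → i ≢ j → update f i a j ≡ f j
update-miss f {i} {j} a i≢j with i ≡ᵇ j in eq
... | true  = ⊥-elim (i≢j (ℕ.≡ᵇ⇒≡ i j (≡-subst T (≡-sym eq) _)))
... | false = ≡-refl

update-missᵇ : {A : Set} (f : ℕ → A) (i j : ℕ) (a : A) → (i ≡ᵇ j) ≡ false → update f i a j ≡ f j
update-missᵇ f i j a e rewrite e = ≡-refl

∨-false : ∀ {b c} → b ∨ c ≡ false → b ≡ false × c ≡ false
∨-false {false} e = ≡-refl , e

not-true : ∀ {b} → not b ≡ true → b ≡ false
not-true {false} _ = ≡-refl

<ᵇ-true : ∀ {i j} → i ℕ.< j → (i <ᵇ j) ≡ true
<ᵇ-true {i} {j} i<j with i <ᵇ j in eq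
... | true  = ≡-refl
... | false = ⊥-elim (≡-subst T eq (ℕ.<⇒<ᵇ i<j))

<ᵇ-false : ∀ {i j} → j ℕ.≤ i → (i <ᵇ j) ≡ false
<ᵇ-false {i} {j} j≤i with i <ᵇ j in eq
... | true  = ⊥-elim (ℕ.<⇒≱ (ℕ.<ᵇ⇒< i j (≡true⇒T eq)) j≤i)
... | false = ≡-refl

-- Denotation, frame rule and cost of the fragment

module Execution {ℝ : Reals} where
  open Reals ℝ using (Carrier)
  open State

  assign : Name → ℕ → State ℝ → State ℝ
  assign x a σ = record σ { nvar = update (nvar σ) x a }

  -- Opaque, so that the states a program passes through do not unfold.
  opaque
    looped : Name → ℕ → (State ℝ → State ℝ) → State ℝ → State ℝ
    looped x k f σ = iterate k (λ τ → assign x (nvar (f τ) x ℕ.+ 1) (f τ)) (assign x 0 σ)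

  exec : Code → State ℝ → State ℝ
  exec nop          σ = σ
  exec (set x a)    σ = record σ { nvar = update (nvar σ) x (evalᴺ σ a) }
  exec (setᴿ x e)   σ = record σ { rvar = update (rvar σ) x (evalᴿ σ e) }
  exec (put x i a)  σ = record σ { narr = update (narr σ) x (update (narr σ x) (evalᴺ σ i) (evalᴺ σ a)) }
  exec (putᴿ x i e) σ = record σ { rarr = update (rarr σ) x (update (rarr σ x) (evalᴺ σ i) (evalᴿ σ e)) }
  exec (c ▸ d)      σ = exec d (exec c σ)
  exec (cond b c d) σ = if evalᴮ σ b then exec c σ else exec d σ
  exec (loop x k c) σ =
    looped x (evalᴺ σ (countᴺ k)) (exec c) σ

  Value : Kind → Set
  Value ℕ-var   = ℕ
  Value ℝ-var   = Carrier
  Value ℕ-array = ℕ → ℕ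
  Value ℝ-array = ℕ → Carrier

  content : (κ : Kind) → State ℝ → Name → Value κ
  content ℕ-var   = nvar
  content ℝ-var   = rvar
  content ℕ-array = narr
  content ℝ-array = rarr

  set-hit : ∀ x a σ → nvar (exec (set x a) σ) x ≡ evalᴺ σ a
  set-hit x a σ = update-hit (nvar σ) (evalᴺ σ a) ≡-refl

  content-set : ∀ κ y x a σ → writes κ y (set x a) ≡ false → content κ (exec (set x a) σ) y ≡ content κ σ y
  content-set ℕ-var   y x a σ e = update-missᵇ (nvar σ) x y (evalᴺ σ a) e
  content-set ℝ-var   y x a σ e = ≡-refl
  content-set ℕ-array y x a σ e = ≡-refl
  content-set ℝ-array y x a σ e = ≡-refl

  loop-writes : ∀ κ y x k c → writes κ y (loop x k c) ≡ false → writes κ y (set x (lit 0)) ≡ false × writes κ y c ≡ false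
  loop-writes ℕ-var   y x k c e = ∨-false e
  loop-writes ℝ-var   y x k c e = ≡-refl , e
  loop-writes ℕ-array y x k c e = ≡-refl , e
  loop-writes ℝ-array y x k c e = ≡-refl , e

  counter-writes : ∀ κ y x a b → writes κ y (set x a) ≡ writes κ y (set x b)
  counter-writes ℕ-var   y x a b = ≡-refl
  counter-writes ℝ-var   y x a b = ≡-refl
  counter-writes ℕ-array y x a b = ≡-refl
  counter-writes ℝ-array y x a b = ≡-refl

  opaque
    unfolding looped

    -- `writes` is syntactic, so for a concrete program the premise is `≡-refl`, and a cell is
    -- carried across a whole program in one application.
    frame : ∀ κ y c σ → writes κ y c ≡ false → content κ (exec c σ) y ≡ content κ σ y
    frame κ       y nop          σ e = ≡-refl
    frame κ       y (set x a)    σ e = content-set κ y x a σ e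
    frame ℕ-var   y (setᴿ x a)   σ e = ≡-refl
    frame ℝ-var   y (setᴿ x a)   σ e = update-missᵇ (rvar σ) x y (evalᴿ σ a) e
    frame ℕ-array y (setᴿ x a)   σ e = ≡-refl
    frame ℝ-array y (setᴿ x a)   σ e = ≡-refl
    frame ℕ-var   y (put x i a)  σ e = ≡-refl
    frame ℝ-var   y (put x i a)  σ e = ≡-refl
    frame ℕ-array y (put x i a)  σ e = update-missᵇ (narr σ) x y _ e
    frame ℝ-array y (put x i a)  σ e = ≡-refl
    frame ℕ-var   y (putᴿ x i a) σ e = ≡-refl
    frame ℝ-var   y (putᴿ x i a) σ e = ≡-refl
    frame ℕ-array y (putᴿ x i a) σ e = ≡-refl
    frame ℝ-array y (putᴿ x i a) σ e = update-missᵇ (rarr σ) x y _ e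
    frame κ       y (c ▸ d)      σ e = frame-▸ κ e
      where
      split : ∀ κ → writes κ y (c ▸ d) ≡ false → writes κ y c ≡ false × writes κ y d ≡ false
      split ℕ-var   = ∨-false
      split ℝ-var   = ∨-false
      split ℕ-array = ∨-false
      split ℝ-array = ∨-false
      frame-▸ : ∀ κ → writes κ y (c ▸ d) ≡ false → content κ (exec (c ▸ d) σ) y ≡ content κ σ y
      frame-▸ κ e = ≡-trans (frame κ y d (exec c σ) (proj₂ (split κ e))) (frame κ y c σ (proj₁ (split κ e)))
    frame κ       y (cond b c d) σ e = frame-cond κ e
      where
      split : ∀ κ → writes κ y (cond b c d) ≡ false → writes κ y c ≡ false × writes κ y d ≡ false
      split ℕ-var   = ∨-false
      split ℝ-var   = ∨-false
      split ℕ-array = ∨-false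
      split ℝ-array = ∨-false
      frame-cond : ∀ κ → writes κ y (cond b c d) ≡ false → content κ (exec (cond b c d) σ) y ≡ content κ σ y
      frame-cond κ e with evalᴮ σ b
      ... | true  = frame κ y c σ (proj₁ (split κ e))
      ... | false = frame κ y d σ (proj₂ (split κ e))
    frame κ       y (loop x k c) σ e = frame-iterate (evalᴺ σ (countᴺ k))
      where
      parts : writes κ y (set x (lit 0)) ≡ false × writes κ y c ≡ false
      parts = loop-writes κ y x k c e
      frame-iterate : ∀ j → content κ (iterate j (λ τ → exec (set x (increment x)) (exec c τ)) (exec (set x (lit 0)) σ)) y
                          ≡ content κ σ y
      frame-iterate zero    = content-set κ y x (lit 0) σ (proj₁ parts)
      frame-iterate (suc j) =
        ≡-trans (content-set κ y x (increment x) _ (≡-trans (counter-writes κ y x _ _) (proj₁ parts)))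
                (≡-trans (frame κ y c _ (proj₂ parts)) (frame-iterate j))

  Agree : Cells → State ℝ → State ℝ → Set
  Agree []            σ τ = ⊤
  Agree ((κ , y) ∷ l) σ τ = content κ σ y ≡ content κ τ y × Agree l σ τ

  frame-all : ∀ l c σ → keepsAll l c ≡ true → Agree l (exec c σ) σ
  frame-all []            c σ _ = tt
  frame-all ((κ , y) ∷ l) c σ e with ∧-true {not (writes κ y c)} e
  ... | e₁ , e₂ = frame κ y c σ (not-true e₁) , frame-all l c σ e₂

  cond-rule : (I : State ℝ → Set) (b : BExp) (c d : Code) (σ : State ℝ) →
              (evalᴮ σ b ≡ true → I (exec c σ)) → (evalᴮ σ b ≡ false → I (exec d σ)) → I (exec (cond b c d) σ)
  cond-rule I b c d σ p q with evalᴮ σ b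
  ... | true  = p ≡-refl
  ... | false = q ≡-refl

  opaque
    unfolding looped

    -- The invariant at `j` is claimed after the counter has been set to `j`, so that resetting and
    -- incrementing belong to the base case and the step.
    loop-rule : (I : ℕ → State ℝ → Set) (x : Name) (k : Count) (c : Code) (σ : State ℝ) →
                writes ℕ-var x c ≡ false →
                I 0 (exec (set x (lit 0)) σ) →
                (∀ j τ → j ℕ.< evalᴺ σ (countᴺ k) → nvar τ x ≡ j → I j τ → I (suc j) (exec (set x (increment x)) (exec c τ))) →
                I (evalᴺ σ (countᴺ k)) (exec (loop x k c) σ)
    loop-rule I x k c σ x∉c base ind = proj₂ (go (evalᴺ σ (countᴺ k)) ℕ.≤-refl)
      where
      turn : State ℝ → State ℝ
      turn τ = exec (set x (increment x)) (exec c τ)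
      go : ∀ j → j ℕ.≤ evalᴺ σ (countᴺ k) →
           (nvar (iterate j turn (exec (set x (lit 0)) σ)) x ≡ j) × I j (iterate j turn (exec (set x (lit 0)) σ))
      go zero    _  = set-hit x (lit 0) σ , base
      go (suc j) j< with go j (ℕ.<⇒≤ j<)
      ... | x≡j , i = ≡-trans (set-hit x (increment x) (exec c (iterate j turn (exec (set x (lit 0)) σ))))
                        (≡-trans (≡-cong (ℕ._+ 1) (≡-trans (frame ℕ-var x c _ x∉c) x≡j)) (ℕ.+-comm j 1))
                    , ind j _ j< x≡j i

  Runs : Code → State ℝ → ℕ → Set
  Runs c σ b = ∃ λ t → (⟨ compile c , σ ⟩⇓⟨ t , exec c σ ⟩) × t ℕ.≤ b

  module Cost (n m : ℕ) .{{_ : ℕ.NonZero n}} (m≤n : m ℕ.≤ n) where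

    Sized : State ℝ → Set
    Sized σ = nvar σ 0 ≡ n × nvar σ 1 ≡ m

    keeps : ∀ c σ → keepsSizes c ≡ true → Sized σ → Sized (exec c σ)
    keeps c σ e (p , q) =
      ≡-trans (frame ℕ-var 0 c σ (not-true (proj₁ (∧-true {not (writes ℕ-var 0 c)} e)))) p ,
      ≡-trans (frame ℕ-var 1 c σ (not-true (proj₂ (∧-true {not (writes ℕ-var 0 c)} e)))) q

    count-bound : ∀ k σ → Sized σ → evalᴺ σ (countᴺ k) ℕ.≤ countFactor k ℕ.* n ℕ.^ countDegree k
    count-bound (constant k)        σ _       = ℕ.≤-reflexive (≡-sym (ℕ.*-identityʳ k))
    count-bound (multipleOfOrder k) σ (p , _) = ℕ.≤-reflexive (≡-cong (k ℕ.*_) (≡-trans p (≡-sym (ℕ.^-identityʳ n))))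
    count-bound edgeCount           σ (_ , q) = begin
      nvar σ 1      ≡⟨ q ⟩
      m             ≤⟨ m≤n ⟩
      n             ≡⟨ ≡-trans (≡-sym (ℕ.^-identityʳ n)) (≡-sym (ℕ.+-identityʳ _)) ⟩
      1 ℕ.* n ℕ.^ 1 ∎
      where open ℕ.≤-Reasoning

    constant-bound : ∀ a d → a ℕ.≤ a ℕ.* n ℕ.^ d
    constant-bound a d = ℕ.m≤m*n a (n ℕ.^ d) {{ℕ.m^n≢0 n d}}

    raise : ∀ a {d d′} → d ℕ.≤ d′ → a ℕ.* n ℕ.^ d ℕ.≤ a ℕ.* n ℕ.^ d′
    raise a d≤d′ = ℕ.*-monoʳ-≤ a (ℕ.^-monoʳ-≤ n d≤d′)

    count-cost : ∀ k → costᴺ (countᴺ k) ℕ.≤ 3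
    count-cost (constant _)        = s≤s z≤n
    count-cost (multipleOfOrder _) = ℕ.≤-refl
    count-cost edgeCount           = s≤s z≤n

    count-sized : ∀ k τ σ → Sized τ → Sized σ → evalᴺ τ (countᴺ k) ≡ evalᴺ σ (countᴺ k)
    count-sized (constant _)        τ σ _ _ = ≡-refl
    count-sized (multipleOfOrder k) τ σ (p , _) (q , _) = ≡-cong (k ℕ.*_) (≡-trans p (≡-sym q))
    count-sized edgeCount           τ σ (_ , p) (_ , q) = ≡-trans p (≡-sym q)

    branch-bound : ∀ b c d {s f} → s ℕ.≤ f ℕ.* n ℕ.^ (degree c ⊔ degree d) → f ℕ.≤ factor c ℕ.+ factor d →
                   suc (costᴮ b ℕ.+ s) ℕ.≤ suc (costᴮ b ℕ.+ (factor c ℕ.+ factor d)) ℕ.* n ℕ.^ (degree c ⊔ degree d)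
    branch-bound b c d {s} {f} s≤ f≤ = begin
      suc (costᴮ b) ℕ.+ s
        ≤⟨ ℕ.+-mono-≤ (constant-bound (suc (costᴮ b)) D) (ℕ.≤-trans s≤ (ℕ.*-monoˡ-≤ (n ℕ.^ D) f≤)) ⟩
      suc (costᴮ b) ℕ.* n ℕ.^ D ℕ.+ (factor c ℕ.+ factor d) ℕ.* n ℕ.^ D
        ≡⟨ ℕ.*-distribʳ-+ (n ℕ.^ D) (suc (costᴮ b)) (factor c ℕ.+ factor d) ⟨
      suc (costᴮ b ℕ.+ (factor c ℕ.+ factor d)) ℕ.* n ℕ.^ D ∎
      where
      open ℕ.≤-Reasoning
      D : ℕ
      D = degree c ⊔ degree d

    opaque
      unfolding looped

      -- `exec` fixes the number `N` of turns on entry, whereas the compiled loop rereads its bound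
      -- before every turn. They agree because the body changes neither the sizes nor the counter.
      -- The induction is on the turns `j` that remain while the counter stands at `i`.
      unroll : ∀ x k c → (∀ τ → Sized τ → Runs c τ (factor c ℕ.* n ℕ.^ degree c)) →
               keepsSizes (loop x k c) ≡ true → writes ℕ-var x c ≡ false →
               ∀ N j i σ → j ℕ.+ i ≡ N → nvar σ x ≡ i → Sized σ → (∀ τ → Sized τ → evalᴺ τ (countᴺ k) ≡ N) →
               ∃ λ t → (⟨ `while (var x `< countᴺ k) (compile c ⨾ x := increment x) , σ ⟩⇓⟨ t ,
                          iterate j (λ τ → exec (set x (increment x)) (exec c τ)) σ ⟩)
                       × t ℕ.≤ 6 ℕ.+ j ℕ.* (factor c ℕ.* n ℕ.^ degree c ℕ.+ 10)
      unroll x k c body e x∉c N zero i σ i≡N x≡i sized count≡N =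
        _ , ⇓done guard , s≤s (s≤s (s≤s (count-cost k)))
        where
        guard : (nvar σ x <ᵇ evalᴺ σ (countᴺ k)) ≡ false
        guard = <ᵇ-false (ℕ.≤-reflexive (≡-trans (count≡N σ sized) (≡-trans (≡-sym i≡N) (≡-sym x≡i))))
      unroll x k c body e x∉c N (suc j) i σ j+i≡N x≡i sized count≡N =
        let s , P , s≤ = body σ sized
            t , W , t≤ = unroll x k c body e x∉c N j (suc i) (turn σ) (≡-trans (ℕ.+-suc j i) j+i≡N) x≡1+i turned count≡N
        -- Execution peels off the first turn, `iterate` the last one.
        in _ , ⇓again guard (⇓⨾ P ⇓:=) (≡-subst (λ υ → ⟨ _ , turn σ ⟩⇓⟨ t , υ ⟩) (iterate-suc j turn σ) W) , total s t s≤ t≤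
        where
        turn : State ℝ → State ℝ
        turn τ = exec (set x (increment x)) (exec c τ)
        guard : (nvar σ x <ᵇ evalᴺ σ (countᴺ k)) ≡ true
        guard = <ᵇ-true (≡-subst₂ ℕ._<_ (≡-sym x≡i) (≡-trans j+i≡N (≡-sym (count≡N σ sized))) (s≤s (ℕ.m≤n+m i j)))
        x≡1+i : nvar (turn σ) x ≡ suc i
        x≡1+i = ≡-trans (set-hit x (increment x) (exec c σ))
                  (≡-trans (≡-cong (ℕ._+ 1) (≡-trans (frame ℕ-var x c σ x∉c) x≡i)) (ℕ.+-comm i 1))
        turned : Sized (turn σ)
        turned = ≡-trans (counter 0 (not-true (proj₁ (∧-true {not (writes ℕ-var 0 (loop x k c))} e)))) (proj₁ sized) ,
                 ≡-trans (counter 1 (not-true (proj₂ (∧-true {not (writes ℕ-var 0 (loop x k c))} e)))) (proj₂ sized)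
          where
          counter : ∀ y → writes ℕ-var y (loop x k c) ≡ false → nvar (turn σ) y ≡ nvar σ y
          counter y f = ≡-trans (content-set ℕ-var y x (increment x) (exec c σ) (proj₁ (∨-false {x ≡ᵇ y} f))) (frame ℕ-var y c σ (proj₂ (∨-false {x ≡ᵇ y} f)))
        total : ∀ s t {B T} → s ℕ.≤ B → t ℕ.≤ 6 ℕ.+ T → suc (suc (suc (costᴺ (countᴺ k))) ℕ.+ ((s ℕ.+ 4) ℕ.+ t)) ℕ.≤ 6 ℕ.+ ((B ℕ.+ 10) ℕ.+ T)
        total s t {B} {T} s≤ t≤ = begin
          3 ℕ.+ costᴺ (countᴺ k) ℕ.+ (s ℕ.+ 4 ℕ.+ t)
            ≤⟨ ℕ.+-mono-≤ (ℕ.+-monoʳ-≤ 3 (count-cost k)) (ℕ.+-mono-≤ (ℕ.+-monoˡ-≤ 4 s≤) t≤) ⟩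
          6 ℕ.+ (B ℕ.+ 4 ℕ.+ (6 ℕ.+ T))
            ≡⟨ solve 2 (λ b u → con 6 [+] (b [+] con 4 [+] (con 6 [+] u)) [=] con 6 [+] ((b [+] con 10) [+] u)) ≡-refl B T ⟩
          6 ℕ.+ ((B ℕ.+ 10) ℕ.+ T) ∎
          where
          open ℕ.≤-Reasoning
          open +-*-Solver using (solve; con) renaming (_:+_ to _[+]_; _:*_ to _[*]_; _:=_ to _[=]_)

    opaque
      unfolding looped

      run : ∀ c σ → wellFormed c ≡ true → Sized σ → Runs c σ (factor c ℕ.* n ℕ.^ degree c)
      run nop          σ _ _ = _ , ⇓skip  , constant-bound 1 0
      run (set x a)    σ _ _ = _ , ⇓:=    , constant-bound _ 0
      run (setᴿ x e)   σ _ _ = _ , ⇓:=ᴿ   , constant-bound _ 0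
      run (put x i a)  σ _ _ = _ , ⇓[]:=  , constant-bound _ 0
      run (putᴿ x i e) σ _ _ = _ , ⇓[]:=ᴿ , constant-bound _ 0
      run (c ▸ d) σ w sized =
        let wc , w′ = ∧-true w
            wd , kc = ∧-true {wellFormed d} w′
            s , P , s≤ = run c σ wc sized
            t , Q , t≤ = run d (exec c σ) wd (keeps c σ kc sized)
        in _ , ⇓⨾ P Q , (begin
             s ℕ.+ t
               ≤⟨ ℕ.+-mono-≤ (ℕ.≤-trans s≤ (raise (factor c) (ℕ.m≤m⊔n (degree c) (degree d))))
                              (ℕ.≤-trans t≤ (raise (factor d) (ℕ.m≤n⊔m (degree c) (degree d)))) ⟩
             factor c ℕ.* n ℕ.^ (degree c ⊔ degree d) ℕ.+ factor d ℕ.* n ℕ.^ (degree c ⊔ degree d)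
               ≡⟨ ℕ.*-distribʳ-+ (n ℕ.^ (degree c ⊔ degree d)) (factor c) (factor d) ⟨
             (factor c ℕ.+ factor d) ℕ.* n ℕ.^ (degree c ⊔ degree d) ∎)
        where open ℕ.≤-Reasoning
      run (cond b c d) σ w sized with evalᴮ σ b in eq
      ... | true =
        let s , P , s≤ = run c σ (proj₁ (∧-true w)) sized
        in _ , ⇓then eq P , branch-bound b c d (ℕ.≤-trans s≤ (raise (factor c) (ℕ.m≤m⊔n (degree c) (degree d)))) (ℕ.m≤m+n (factor c) (factor d))
      ... | false =
        let s , P , s≤ = run d σ (proj₂ (∧-true {wellFormed c} w)) sized
        in _ , ⇓else eq P , branch-bound b c d (ℕ.≤-trans s≤ (raise (factor d) (ℕ.m≤n⊔m (degree c) (degree d)))) (ℕ.m≤n+m (factor d) (factor c))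
      run (loop x k c) σ w sized =
        let wc , w′ = ∧-true w
            kl , x∉c = ∧-true {keepsSizes (loop x k c)} w′
            start : Sized (exec (set x (lit 0)) σ)
            start = ≡-trans (content-set ℕ-var 0 x (lit 0) σ (proj₁ (∨-false {x ≡ᵇ 0} (not-true (proj₁ (∧-true {not (writes ℕ-var 0 (loop x k c))} kl)))))) (proj₁ sized) ,
                    ≡-trans (content-set ℕ-var 1 x (lit 0) σ (proj₁ (∨-false {x ≡ᵇ 1} (not-true (proj₂ (∧-true {not (writes ℕ-var 0 (loop x k c))} kl)))))) (proj₂ sized)
            t , W , t≤ = unroll x k c (λ τ sz → run c τ wc sz) kl (not-true x∉c) (evalᴺ σ (countᴺ k)) (evalᴺ σ (countᴺ k)) 0
                           (exec (set x (lit 0)) σ) (ℕ.+-identityʳ _) (set-hit x (lit 0) σ) start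
                           (λ τ sz → count-sized k τ σ sz sized)
        in _ , ⇓⨾ ⇓:= W , (begin
             2 ℕ.+ t
               ≤⟨ ℕ.+-monoʳ-≤ 2 t≤ ⟩
             8 ℕ.+ evalᴺ σ (countᴺ k) ℕ.* (F ℕ.* n ℕ.^ d ℕ.+ 10)
               ≤⟨ ℕ.+-monoʳ-≤ 8 (ℕ.*-mono-≤ (count-bound k σ sized) (ℕ.+-monoʳ-≤ (F ℕ.* n ℕ.^ d) (constant-bound 10 d))) ⟩
             8 ℕ.+ (K ℕ.* n ℕ.^ dk) ℕ.* (F ℕ.* n ℕ.^ d ℕ.+ 10 ℕ.* n ℕ.^ d)
               ≤⟨ ℕ.+-monoˡ-≤ _ (constant-bound 8 (dk ℕ.+ d)) ⟩
             8 ℕ.* n ℕ.^ (dk ℕ.+ d) ℕ.+ (K ℕ.* n ℕ.^ dk) ℕ.* (F ℕ.* n ℕ.^ d ℕ.+ 10 ℕ.* n ℕ.^ d)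
               ≡⟨ ≡-cong (λ p → 8 ℕ.* p ℕ.+ (K ℕ.* n ℕ.^ dk) ℕ.* (F ℕ.* n ℕ.^ d ℕ.+ 10 ℕ.* n ℕ.^ d)) (ℕ.^-distribˡ-+-* n dk d) ⟩
             8 ℕ.* (n ℕ.^ dk ℕ.* n ℕ.^ d) ℕ.+ (K ℕ.* n ℕ.^ dk) ℕ.* (F ℕ.* n ℕ.^ d ℕ.+ 10 ℕ.* n ℕ.^ d)
               ≡⟨ solve 4 (λ k f p q → con 8 [*] (p [*] q) [+] (k [*] p) [*] (f [*] q [+] con 10 [*] q)
                                       [=] (con 8 [+] k [*] (f [+] con 10)) [*] (p [*] q)) ≡-refl K F (n ℕ.^ dk) (n ℕ.^ d) ⟩
             (8 ℕ.+ K ℕ.* (F ℕ.+ 10)) ℕ.* (n ℕ.^ dk ℕ.* n ℕ.^ d)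
               ≡⟨ ≡-cong ((8 ℕ.+ K ℕ.* (F ℕ.+ 10)) ℕ.*_) (ℕ.^-distribˡ-+-* n dk d) ⟨
             (8 ℕ.+ K ℕ.* (F ℕ.+ 10)) ℕ.* n ℕ.^ (dk ℕ.+ d) ∎)
        where
        open ℕ.≤-Reasoning
        open +-*-Solver using (solve; con) renaming (_:+_ to _[+]_; _:*_ to _[*]_; _:=_ to _[=]_)
        K F d dk : ℕ
        K = countFactor k
        F = factor c
        d = degree c
        dk = countDegree k

-- Walks and trees

unique-++⁻ : {A : Set} (xs : List A) {ys : List A} → Unique (xs ++ ys) →
             Unique xs × Unique ys × (∀ {a} → a ∈ xs → a ∈ ys → ⊥)
unique-++⁻ []       u        = [] , u , λ ()
unique-++⁻ (x ∷ xs) (p ∷ u) with unique-++⁻ xs u | Allₚ.++⁻ xs p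
... | uxs , uys , disjoint | pxs , pys = pxs ∷ uxs , uys , λ where
  (here ≡-refl) a∈ys → All.lookup pys a∈ys ≡-refl
  (there a∈xs)  a∈ys → disjoint a∈xs a∈ys

module Walks {n m : ℕ} {G : Graph n m} where

  joins-sym : ∀ {e u v} → Joins G e u v → Joins G e v u
  joins-sym (inj₁ p) = inj₂ p
  joins-sym (inj₂ p) = inj₁ p

  joins-unique : ∀ {e u v a b} → Joins G e u v → Joins G e a b → (u ≡ a × v ≡ b) ⊎ (u ≡ b × v ≡ a)
  joins-unique (inj₁ p) (inj₁ q) with ≡-trans (≡-sym p) q
  ... | ≡-refl = inj₁ (≡-refl , ≡-refl)
  joins-unique (inj₁ p) (inj₂ q) with ≡-trans (≡-sym p) q
  ... | ≡-refl = inj₂ (≡-refl , ≡-refl)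
  joins-unique (inj₂ p) (inj₁ q) with ≡-trans (≡-sym p) q
  ... | ≡-refl = inj₂ (≡-refl , ≡-refl)
  joins-unique (inj₂ p) (inj₂ q) with ≡-trans (≡-sym p) q
  ... | ≡-refl = inj₁ (≡-refl , ≡-refl)

  connect : ∀ {u a b w e} → Walk G u a → Joins G e a b → Walk G b w → Walk G u w
  connect {e = e} stop         J ρ = step e J ρ
  connect         (step f K π) J ρ = step f K (connect π J ρ)

  vertices-connect : ∀ {u a b w e} (π : Walk G u a) (J : Joins G e a b) (ρ : Walk G b w) →
                     vertices (connect π J ρ) ≡ vertices π ++ vertices ρ
  vertices-connect stop         J ρ = ≡-refl
  vertices-connect (step f K π) J ρ = ≡-cong (_ ∷_) (vertices-connect π J ρ)

  edges-connect : ∀ {u a b w e} (π : Walk G u a) (J : Joins G e a b) (ρ : Walk G b w) →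
                  edges (connect π J ρ) ≡ edges π ++ e ∷ edges ρ
  edges-connect stop         J ρ = ≡-refl
  edges-connect (step f K π) J ρ = ≡-cong (f ∷_) (edges-connect π J ρ)

  source∈ : ∀ {u w} (π : Walk G u w) → u ∈ vertices π
  source∈ stop         = here ≡-refl
  source∈ (step _ _ _) = here ≡-refl

  target∈ : ∀ {u w} (π : Walk G u w) → w ∈ vertices π
  target∈ stop         = here ≡-refl
  target∈ (step _ _ π) = there (target∈ π)

  simple-connect : ∀ {u a b w e} (π : Walk G u a) (J : Joins G e a b) (ρ : Walk G b w) → Simple π → Simple ρ →
                   (∀ {x} → x ∈ vertices π → x ∈ vertices ρ → ⊥) → Simple (connect π J ρ)
  simple-connect π J ρ sπ sρ disjoint =
    ≡-subst Unique (≡-sym (vertices-connect π J ρ)) (Uniqueₚ.++⁺ sπ sρ (λ (p , q) → disjoint p q))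

  simple-closed : ∀ {u w} (π : Walk G u w) → Simple π → u ≡ w → edges π ≡ []
  simple-closed stop         _       _      = ≡-refl
  simple-closed (step e J π) (p ∷ _) ≡-refl = ⊥-elim (All.lookup p (target∈ π) ≡-refl)

  module _ (V₁ V₂ : Fin n → Set) (E₁ E₂ : Fin m → Set) (disjoint : ∀ {x} → V₁ x → V₂ x → ⊥)
           (ends₁ : ∀ {e u w} → E₁ e → Joins G e u w → V₁ w)
           (ends₂ : ∀ {e u w} → E₂ e → Joins G e u w → V₂ u)
           {e : Fin m} {a b : Fin n} (bridge : Joins G e a b) (b∈ : V₂ b) where

    Crossing : ∀ {u w} → Walk G u w → Set
    Crossing {u} {w} π = ∃₂ λ (π₁ : Walk G u a) (π₂ : Walk G b w) → ∃ λ (J : Joins G e a b) →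
      π ≡ connect π₁ J π₂ × All E₁ (edges π₁) × All (λ f → E₁ f ⊎ f ≡ e ⊎ E₂ f) (edges π₂)

    -- Up to the first use of the bridge every edge stays on the starting side, and the bridge can
    -- then be entered only at `a`, since `b` lies on the other side. Nothing is said yet about
    -- whether the rest of the walk returns.
    cross-once : ∀ {u w} (π : Walk G u w) → V₁ u → All (λ f → E₁ f ⊎ f ≡ e ⊎ E₂ f) (edges π) →
                 (All E₁ (edges π) × V₁ w) ⊎ Crossing π
    cross-once stop         u∈ _ = inj₁ ([] , u∈)
    cross-once (step f J π) u∈ (inj₁ f∈ ∷ ps) with cross-once π (ends₁ f∈ J) ps
    ... | inj₁ (all , w∈)                = inj₁ (f∈ ∷ all , w∈)
    ... | inj₂ (π₁ , π₂ , K , ≡-refl , p , q) = inj₂ (step f J π₁ , π₂ , K , ≡-refl , f∈ ∷ p , q)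
    cross-once (step f J π) u∈ (inj₂ (inj₁ ≡-refl) ∷ ps) with joins-unique {e = f} J bridge
    ... | inj₁ (≡-refl , ≡-refl) = inj₂ (stop , π , J , ≡-refl , [] , ps)
    ... | inj₂ (≡-refl , _)      = ⊥-elim (disjoint u∈ b∈)
    cross-once (step f J π) u∈ (inj₂ (inj₂ f∈) ∷ ps) = ⊥-elim (disjoint u∈ (ends₂ f∈ J))

  module _ (V₁ V₂ : Fin n → Set) (E₁ E₂ : Fin m → Set) (disjoint : ∀ {x} → V₁ x → V₂ x → ⊥)
           (ends₁ : ∀ {e u w} → E₁ e → Joins G e u w → V₁ u × V₁ w)
           (ends₂ : ∀ {e u w} → E₂ e → Joins G e u w → V₂ u × V₂ w)
           {e : Fin m} {a b : Fin n} (bridge : Joins G e a b) (a∈ : V₁ a) (b∈ : V₂ b) where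

    -- A second use of the bridge would lead back to `a`, where the first part already ended, and a
    -- simple walk visits `a` only once. To see this, `cross-once` is applied to the second part
    -- with the sides exchanged.
    cross-simple : ∀ {u w} (π : Walk G u w) → V₁ u → All (λ f → E₁ f ⊎ f ≡ e ⊎ E₂ f) (edges π) → Simple π →
      (All E₁ (edges π) × V₁ w) ⊎
      (∃₂ λ (π₁ : Walk G u a) (π₂ : Walk G b w) → ∃ λ (J : Joins G e a b) → π ≡ connect π₁ J π₂ ×
         All E₁ (edges π₁) × All E₂ (edges π₂) × V₂ w × Simple π₁ × Simple π₂)
    cross-simple π u∈ ps simple
      with cross-once V₁ V₂ E₁ E₂ disjoint (λ p J → proj₂ (ends₁ p J)) (λ p J → proj₁ (ends₂ p J)) bridge b∈ π u∈ ps
    ... | inj₁ r = inj₁ r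
    ... | inj₂ (π₁ , π₂ , J , ≡-refl , p , q)
      with unique-++⁻ (vertices π₁) (≡-subst Unique (vertices-connect π₁ J π₂) simple)
         | cross-once V₂ V₁ E₂ E₁ (λ x y → disjoint y x) (λ p J → proj₂ (ends₂ p J)) (λ p J → proj₁ (ends₁ p J))
             (joins-sym {e = e} bridge) a∈ π₂ b∈ (All.map swap q)
      where
      swap : ∀ {f} → E₁ f ⊎ f ≡ e ⊎ E₂ f → E₂ f ⊎ f ≡ e ⊎ E₁ f
      swap (inj₁ x)        = inj₂ (inj₂ x)
      swap (inj₂ (inj₁ x)) = inj₂ (inj₁ x)
      swap (inj₂ (inj₂ x)) = inj₁ x
    ... | s₁ , s₂ , _ | inj₁ (all , w∈) = inj₂ (π₁ , π₂ , J , ≡-refl , p , all , w∈ , s₁ , s₂)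
    ... | _ , _ , once | inj₂ (ρ₁ , ρ₂ , K , ≡-refl , _) =
      ⊥-elim (once (target∈ π₁)
        (≡-subst (a ∈_) (≡-sym (vertices-connect ρ₁ K ρ₂)) (∈-++⁺ʳ (vertices ρ₁) (source∈ ρ₂))))

-- Rooted trees, shifted heights and the errors of paths

module GraftedTrees (ℝ : Reals) {n m : ℕ} (G : Graph n m)
                    (ω : Fin m → Reals.Carrier ℝ) (h : Fin n → Reals.Carrier ℝ) where
  open Reals ℝ using (Carrier; _≈_; _<_; _≤_; _+_; _-_; -_; 0#; fromℕ; compare; refl; sym; trans; +-congˡ; +-congʳ; +-assoc)
  open OrderedFieldProperties ℝ
  open Walks {G = G}

  -- A rooted tree is built by hanging one rooted tree below the root of
  -- another. The number z is the weight that an edge gets when both of its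
  -- ends keep their heights.

  data Tree : Fin n → Set where
    single : ∀ v → Tree v
    graft  : ∀ {v c} → Tree v → (e : Fin m) → Joins G e v c → (z : ℕ) → h c + ω e ≈ h v + fromℕ z → Tree c → Tree v

  Vertex : ∀ {v} → Tree v → Fin n → Set
  Vertex (single v)          u = u ≡ v
  Vertex (graft t _ _ _ _ s) u = Vertex t u ⊎ Vertex s u

  Edge : ∀ {v} → Tree v → Fin m → Set
  Edge (single v)          f = ⊥
  Edge (graft t e _ _ _ s) f = Edge t f ⊎ f ≡ e ⊎ Edge s f

  Proper : ∀ {v} → Tree v → Set
  Proper (single v)          = ⊤
  Proper (graft t _ _ _ _ s) = Proper t × Proper s × (∀ {u} → Vertex t u → Vertex s u → ⊥)

  root∈ : ∀ {v} (t : Tree v) → Vertex t v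
  root∈ (single v)          = ≡-refl
  root∈ (graft t _ _ _ _ _) = inj₁ (root∈ t)

  edge? : ∀ {v} (t : Tree v) f → Dec (Edge t f)
  edge? (single v)          f = no λ ()
  edge? (graft t e _ _ _ s) f = edge? t f ⊎-dec ((f Finₚ.≟ e) ⊎-dec edge? s f)

  edge-ends : ∀ {v} (t : Tree v) {f u w} → Edge t f → Joins G f u w → Vertex t u × Vertex t w
  edge-ends (graft t e J z _ s) (inj₁ f∈) K =
    let p , q = edge-ends t f∈ K in inj₁ p , inj₁ q
  edge-ends (graft t e J z _ s) {f} (inj₂ (inj₁ ≡-refl)) K with joins-unique {e = f} K J
  ... | inj₁ (≡-refl , ≡-refl) = inj₁ (root∈ t) , inj₂ (root∈ s)
  ... | inj₂ (≡-refl , ≡-refl) = inj₂ (root∈ s) , inj₁ (root∈ t)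
  edge-ends (graft t e J z _ s) (inj₂ (inj₂ f∈)) K =
    let p , q = edge-ends s f∈ K in inj₂ p , inj₂ q

  module _ (ε : Carrier) where

    -- Moving the child by ω̃ e − z relative to its height turns ω̃ into a rounding
    -- whose errors are differences of heights: all heights below the root lie
    -- in [L, U]. The two strict inequalities bound the errors of the paths that
    -- use e; both sides are moved so that no subtraction occurs.

    data Feasible (ω̃ : Fin m → ℕ) : ∀ {v} → Tree v → Carrier → Carrier → Set where
      single : ∀ {v L U} → L ≤ h v → h v ≤ U → Feasible ω̃ (single v) L U
      graft  : ∀ {v c t e J z slope s L U L₁ U₁ L₂ U₂} →
               Feasible ω̃ {v} t L₁ U₁ → Feasible ω̃ {c} s L₂ U₂ →
               U₁ + (U₂ + fromℕ (ω̃ e)) < ε + (h v + (h v + fromℕ z)) →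
               h v + (h v + fromℕ z) < ε + (L₁ + (L₂ + fromℕ (ω̃ e))) →
               U₁ ≤ U → U₂ + fromℕ (ω̃ e) ≤ U + fromℕ z →
               L ≤ L₁ → L + fromℕ z ≤ L₂ + fromℕ (ω̃ e) →
               Feasible ω̃ (graft t e J z slope s) L U

    feasible-root : ∀ {ω̃ v L U} {t : Tree v} → Feasible ω̃ t L U → L ≤ h v × h v ≤ U
    feasible-root (single p q)              = p , q
    feasible-root (graft t _ _ _ p _ q _) =
      let p′ , q′ = feasible-root t in ≤-trans q p′ , ≤-trans q′ p

    feasible-weaken : ∀ {ω̃ v L L′ U U′} {t : Tree v} → L′ ≤ L → U ≤ U′ → Feasible ω̃ t L U → Feasible ω̃ t L′ U′
    feasible-weaken l u (single p q)            = single (≤-trans l p) (≤-trans q u)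
    feasible-weaken l u (graft t s a b p p′ q q′) =
      graft t s a b (≤-trans p u) (≤-trans p′ (+-monoˡ-≤ _ u)) (≤-trans l q) (≤-trans (+-monoˡ-≤ _ l) q′)

    feasible-agree : ∀ {ω̃ ω̃′ v L U} {t : Tree v} → (∀ f → Edge t f → ω̃ f ≡ ω̃′ f) → Feasible ω̃ t L U → Feasible ω̃′ t L U
    feasible-agree eq (single p q) = single p q
    feasible-agree {t = graft _ e _ _ _ _} eq (graft t s a b p p′ q q′) with eq e (inj₂ (inj₁ ≡-refl))
    ... | ω̃e≡ω̃′e rewrite ω̃e≡ω̃′e =
      graft (feasible-agree (λ f f∈ → eq f (inj₁ f∈)) t) (feasible-agree (λ f f∈ → eq f (inj₂ (inj₂ f∈))) s) a b p p′ q q′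

    -- Feasibility looks only at the edges of its own tree. The edges of `t`, the edges of `s` and
    -- `e` are kept apart by the disjointness of the vertex sets, so the two assignments and any
    -- value at `e` can be pasted together.
    feasible-merge : ∀ {v c L₁ U₁ L₂ U₂ ω̃₁ ω̃₂} {t : Tree v} {s : Tree c} (e : Fin m) → Joins G e v c →
                     (∀ {u} → Vertex t u → Vertex s u → ⊥) → Feasible ω̃₁ t L₁ U₁ → Feasible ω̃₂ s L₂ U₂ → (k : ℕ) →
                     ∃ λ ω̃ → Feasible ω̃ t L₁ U₁ × Feasible ω̃ s L₂ U₂ × ω̃ e ≡ k
    feasible-merge {v} {c} {ω̃₁ = ω̃₁} {ω̃₂} {t} {s} e J disjoint ft fs k =
      ω̃ , feasible-agree on-t ft , feasible-agree on-s fs , on-e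
      where
      ω̃ : Fin m → ℕ
      ω̃ f with edge? t f | f Finₚ.≟ e
      ... | yes _ | _     = ω̃₁ f
      ... | no  _ | yes _ = k
      ... | no  _ | no  _ = ω̃₂ f
      e∉t : ¬ Edge t e
      e∉t e∈ = disjoint (proj₂ (edge-ends t e∈ J)) (root∈ s)
      e∉s : ¬ Edge s e
      e∉s e∈ = disjoint (root∈ t) (proj₁ (edge-ends s e∈ J))
      t∩s : ∀ {f} → Edge t f → ¬ Edge s f
      t∩s {f} p q = disjoint (proj₁ (edge-ends t p (inj₁ ≡-refl))) (proj₁ (edge-ends s q (inj₁ ≡-refl)))
      on-t : ∀ f → Edge t f → ω̃₁ f ≡ ω̃ f
      on-t f f∈ with edge? t f
      ... | yes _  = ≡-refl
      ... | no f∉ = ⊥-elim (f∉ f∈)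
      on-s : ∀ f → Edge s f → ω̃₂ f ≡ ω̃ f
      on-s f f∈ with edge? t f | f Finₚ.≟ e
      ... | yes f∈t | _          = ⊥-elim (t∩s f∈t f∈)
      ... | no  _   | yes ≡-refl = ⊥-elim (e∉s f∈)
      ... | no  _   | no _       = ≡-refl
      on-e : ω̃ e ≡ k
      on-e with edge? t e | e Finₚ.≟ e
      ... | yes e∈ | _      = ⊥-elim (e∉t e∈)
      ... | no _   | yes _  = ≡-refl
      ... | no _   | no e≢e = ⊥-elim (e≢e ≡-refl)

    module _ (ω̃ : Fin m → ℕ) where

      rounded exact : ∀ {u w} → Walk G u w → Carrier
      rounded π = fromℕ (weightℕ ℝ ω̃ π)
      exact   π = weight ℝ ω π

      rounded-connect : ∀ {u a b w e} (π : Walk G u a) (J : Joins G e a b) (ρ : Walk G b w) →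
                        rounded (connect π J ρ) ≈ rounded π + (fromℕ (ω̃ e) + rounded ρ)
      rounded-connect {e = e} stop J ρ = trans (fromℕ-+ (ω̃ e) _)
        (linear (fromℕ (ω̃ e) ∷ rounded ρ ∷ []) (λ a b → [] ⊢ a :+ b :≈ # 0 :+ (a :+ b)) tt)
      rounded-connect {e = e} (step f K π) J ρ = trans (fromℕ-+ (ω̃ f) _)
        (trans (+-congˡ (rounded-connect π J ρ))
          (trans (sym (+-assoc _ _ _)) (+-congʳ (sym (fromℕ-+ (ω̃ f) _)))))

      exact-connect : ∀ {u a b w e} (π : Walk G u a) (J : Joins G e a b) (ρ : Walk G b w) →
                      exact (connect π J ρ) ≈ exact π + (ω e + exact ρ)
      exact-connect {e = e} stop J ρ =
        linear (ω e ∷ exact ρ ∷ []) (λ a b → [] ⊢ a :+ b :≈ # 0 :+ (a :+ b)) tt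
      exact-connect {e = e} (step f K π) J ρ = trans (+-congˡ (exact-connect π J ρ)) (sym (+-assoc _ _ _))

      WithinTolerance : ∀ {u w} → Walk G u w → Set
      WithinTolerance π = rounded π < exact π + ε × exact π < rounded π + ε

      closed-rounded : ∀ {u w} (π : Walk G u w) → Simple π → u ≡ w → rounded π ≡ 0# × exact π ≡ 0#
      closed-rounded π simple u≡w with edges π | simple-closed π simple u≡w
      ... | _ | ≡-refl = ≡-refl , ≡-refl

      -- For a path between a root of height `y` and another vertex, `y + rounded π − exact π` is
      -- the shifted height of that vertex. The subtraction is moved to the outer terms.
      Between : Carrier → Carrier → Carrier → ∀ {u w} → Walk G u w → Set
      Between L y U π = L + exact π ≤ y + rounded π × y + rounded π ≤ U + exact π

      -- Seen from `v`, the error of the whole path is the sum of the shifted heights of its ends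
      -- minus `2 h v`, where the child's side has moved by `ω̃ e − z`. The alternatives are the two
      -- directions in which `e` can be traversed.
      across : ∀ {v c a b x y L₁ U₁ L₂ U₂ e z} (π : Walk G x a) (J : Joins G e a b) (ρ : Walk G b y) →
               h c + ω e ≈ h v + z →
               U₁ + (U₂ + fromℕ (ω̃ e)) < ε + (h v + (h v + z)) →
               h v + (h v + z) < ε + (L₁ + (L₂ + fromℕ (ω̃ e))) →
               (Between L₁ (h v) U₁ π × Between L₂ (h c) U₂ ρ) ⊎ (Between L₁ (h v) U₁ ρ × Between L₂ (h c) U₂ π) →
               WithinTolerance (connect π J ρ)
      across {v} {c} {L₁ = L₁} {U₁} {L₂} {U₂} {e} {z} π J ρ slope upper lower between =
        [ (λ (p , q) → core p q (rounded-connect π J ρ) (exact-connect π J ρ))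
        , (λ (p , q) → core p q
            (trans (rounded-connect π J ρ) (swap (rounded π) (rounded ρ) (fromℕ (ω̃ e))))
            (trans (exact-connect π J ρ) (swap (exact π) (exact ρ) (ω e)))) ]′ between
        where
        swap : ∀ a b k → a + (k + b) ≈ b + (k + a)
        swap a b k = linear (a ∷ b ∷ k ∷ []) (λ a b k → [] ⊢ a :+ (k :+ b) :≈ b :+ (k :+ a)) tt
        core : ∀ {R X r₁ r₂ x₁ x₂} → L₁ + x₁ ≤ h v + r₁ × h v + r₁ ≤ U₁ + x₁ → L₂ + x₂ ≤ h c + r₂ × h c + r₂ ≤ U₂ + x₂ →
               R ≈ r₁ + (fromℕ (ω̃ e) + r₂) → X ≈ x₁ + (ω e + x₂) → R < X + ε × X < R + ε
        core {R} {X} {r₁} {r₂} {x₁} {x₂} (p₁ , q₁) (p₂ , q₂) r x =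
          linear (R ∷ X ∷ r₁ ∷ r₂ ∷ x₁ ∷ x₂ ∷ fromℕ (ω̃ e) ∷ ω e ∷ h v ∷ h c ∷ z ∷ ε ∷ U₁ ∷ U₂ ∷ [])
            (λ R X r₁ r₂ x₁ x₂ k w hv hc z ε U₁ U₂ →
              R :≈ r₁ :+ (k :+ r₂) ∷ x₁ :+ (w :+ x₂) :≈ X ∷ hv :+ r₁ :≤ U₁ :+ x₁ ∷ hc :+ r₂ :≤ U₂ :+ x₂ ∷
              U₁ :+ (U₂ :+ k) :< ε :+ (hv :+ (hv :+ z)) ∷ hv :+ z :≈ hc :+ w ∷ [] ⊢ R :< X :+ ε)
            (r , sym x , q₁ , q₂ , upper , sym slope) ,
          linear (R ∷ X ∷ r₁ ∷ r₂ ∷ x₁ ∷ x₂ ∷ fromℕ (ω̃ e) ∷ ω e ∷ h v ∷ h c ∷ z ∷ ε ∷ L₁ ∷ L₂ ∷ [])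
            (λ R X r₁ r₂ x₁ x₂ k w hv hc z ε L₁ L₂ →
              X :≈ x₁ :+ (w :+ x₂) ∷ r₁ :+ (k :+ r₂) :≈ R ∷ L₁ :+ x₁ :≤ hv :+ r₁ ∷ L₂ :+ x₂ :≤ hc :+ r₂ ∷
              hv :+ (hv :+ z) :< ε :+ (L₁ :+ (L₂ :+ k)) ∷ hc :+ w :≈ hv :+ z ∷ [] ⊢ X :< R :+ ε)
            (x , sym r , p₁ , p₂ , lower , slope)

      -- By the slope equation, passing from the child's frame to the parent's is a shift by
      -- `k − z`, and the last two bounds of a graft are bounds on exactly this shift of `L₂` and
      -- `U₂`.
      below : ∀ {v c R X r x k w z L U L₂ U₂} → h c + w ≈ h v + z → U₂ + k ≤ U + z → L + z ≤ L₂ + k →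
              R ≈ k + r → X ≈ w + x → L₂ + x ≤ h c + r × h c + r ≤ U₂ + x → L + X ≤ h v + R × h v + R ≤ U + X
      below {v} {c} {R} {X} {r} {x} {k} {w} {z} {L} {U} {L₂} {U₂} slope u l R≈ X≈ (p , q) =
        linear (h v ∷ h c ∷ R ∷ X ∷ r ∷ x ∷ k ∷ w ∷ z ∷ L ∷ L₂ ∷ [])
          (λ hv hc R X r x k w z L L₂ → hc :+ w :≈ hv :+ z ∷ L :+ z :≤ L₂ :+ k ∷ k :+ r :≈ R ∷ X :≈ w :+ x ∷
            L₂ :+ x :≤ hc :+ r ∷ [] ⊢ L :+ X :≤ hv :+ R) (slope , l , sym R≈ , X≈ , p) ,
        linear (h v ∷ h c ∷ R ∷ X ∷ r ∷ x ∷ k ∷ w ∷ z ∷ U ∷ U₂ ∷ [])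
          (λ hv hc R X r x k w z U U₂ → hv :+ z :≈ hc :+ w ∷ U₂ :+ k :≤ U :+ z ∷ R :≈ k :+ r ∷ w :+ x :≈ X ∷
            hc :+ r :≤ U₂ :+ x ∷ [] ⊢ hv :+ R :≤ U :+ X) (sym slope , u , R≈ , sym X≈ , q)

      between-widen : ∀ {L L′ y U U′ u w} {π : Walk G u w} → L′ ≤ L → U ≤ U′ → Between L y U π → Between L′ y U′ π
      between-widen l u (p , q) = ≤-trans (+-monoˡ-≤ _ l) p , ≤-trans q (+-monoˡ-≤ _ u)

      -- The second component carries the induction: a path through the connecting edge is cut into
      -- halves that each end at a root, and the heights of their outer ends are what `across`
      -- needs.
      feasible-sound : 0# < ε → ∀ {v L U} {t : Tree v} → Proper t → Feasible ω̃ t L U →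
        ∀ {u w} (π : Walk G u w) → Vertex t u → All (Edge t) (edges π) → Simple π →
        WithinTolerance π × (u ≡ v ⊎ w ≡ v → Between L (h v) U π)
      feasible-sound 0<ε _ (single l u) stop ≡-refl _ _ =
        (0<0+ε , 0<0+ε) , λ _ → +-monoˡ-≤ 0# l , +-monoˡ-≤ 0# u
        where
        0<0+ε : 0# < 0# + ε
        0<0+ε = linear (ε ∷ []) (λ e → # 0 :< e ∷ [] ⊢ # 0 :< # 0 :+ e) 0<ε
      feasible-sound 0<ε _ (single l u) (step _ _ _) _ (() ∷ _) _
      feasible-sound 0<ε {t = graft t e J z slope s} (pt , ps , disjoint) (graft ft fs upper lower u u′ l l′) π (inj₁ u∈) es simple
        with cross-simple (Vertex t) (Vertex s) (Edge t) (Edge s) disjoint (edge-ends t) (edge-ends s) J (root∈ t) (root∈ s) π u∈ es simple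
      ... | inj₁ (es′ , w∈) =
        let tolerance , between = feasible-sound 0<ε pt ft π u∈ es′ simple
        in tolerance , λ end → between-widen {π = π} l u (between end)
      ... | inj₂ (π₁ , π₂ , K , ≡-refl , es₁ , es₂ , w∈ , s₁ , s₂) =
        let _ , b₁ = feasible-sound 0<ε pt ft π₁ u∈ es₁ s₁
            _ , b₂ = feasible-sound 0<ε ps fs π₂ (root∈ s) es₂ s₂
        in across π₁ K π₂ slope upper lower (inj₁ (b₁ (inj₂ ≡-refl) , b₂ (inj₁ ≡-refl))) ,
           λ where
             -- The half inside `t` is a closed simple walk, hence empty, so only the edge and the
             -- half inside `s` contribute.
             (inj₁ u≡v) → let R₁ , X₁ = closed-rounded π₁ s₁ u≡v in
               below slope u′ l′
                 (trans (rounded-connect π₁ K π₂) (drop R₁)) (trans (exact-connect π₁ K π₂) (drop X₁)) (b₂ (inj₁ ≡-refl))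
             (inj₂ ≡-refl) → ⊥-elim (disjoint (root∈ t) w∈)
        where
        drop : ∀ {a b} → a ≡ 0# → a + b ≈ b
        drop {b = b} ≡-refl = linear (b ∷ []) (λ b → [] ⊢ # 0 :+ b :≈ b) tt
      feasible-sound 0<ε {t = graft t e J z slope s} (pt , ps , disjoint) (graft ft fs upper lower u u′ l l′) π (inj₂ u∈) es simple
        with cross-simple (Vertex s) (Vertex t) (Edge s) (Edge t) (λ p q → disjoint q p) (edge-ends s) (edge-ends t)
               (joins-sym {e = e} J) (root∈ s) (root∈ t) π u∈ (All.map swap es) simple
        where
        swap : ∀ {f} → Edge t f ⊎ f ≡ e ⊎ Edge s f → Edge s f ⊎ f ≡ e ⊎ Edge t f
        swap (inj₁ x)        = inj₂ (inj₂ x)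
        swap (inj₂ (inj₁ x)) = inj₂ (inj₁ x)
        swap (inj₂ (inj₂ x)) = inj₁ x
      ... | inj₁ (es′ , w∈) =
        proj₁ (feasible-sound 0<ε ps fs π u∈ es′ simple) , λ where
          (inj₁ ≡-refl) → ⊥-elim (disjoint (root∈ t) u∈)
          (inj₂ ≡-refl) → ⊥-elim (disjoint (root∈ t) w∈)
      ... | inj₂ (π₁ , π₂ , K , ≡-refl , es₁ , es₂ , w∈ , s₁ , s₂) =
        let _ , b₁ = feasible-sound 0<ε ps fs π₁ u∈ es₁ s₁
            _ , b₂ = feasible-sound 0<ε pt ft π₂ (root∈ t) es₂ s₂
        in across π₁ K π₂ slope upper lower (inj₂ (b₂ (inj₁ ≡-refl) , b₁ (inj₂ ≡-refl))) ,
           λ where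
             (inj₁ ≡-refl) → ⊥-elim (disjoint (root∈ t) u∈)
             (inj₂ w≡v) → let R₂ , X₂ = closed-rounded π₂ s₂ (≡-sym w≡v) in
               below slope u′ l′
                 (trans (rounded-connect π₁ K π₂) (flip R₂)) (trans (exact-connect π₁ K π₂) (flip X₂)) (b₁ (inj₂ ≡-refl))
        where
        flip : ∀ {a b c} → c ≡ 0# → a + (b + c) ≈ b + a
        flip {a} {b} ≡-refl = linear (a ∷ b ∷ []) (λ a b → [] ⊢ a :+ (b :+ # 0) :≈ b :+ a) tt

      -- Walks to and from the root are both kept, so that two extreme vertices can be joined
      -- through `e` without reversing a walk.
      Reaches : ∀ {v} → Tree v → Carrier → Set
      Reaches {v} t y = ∃ λ x → (Σ (Walk G v x) Attains) × (Σ (Walk G x v) Attains)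
        where
        Attains : ∀ {u w} → Walk G u w → Set
        Attains π = All (Vertex t) (vertices π) × Simple π × h v + rounded π ≈ y + exact π

      -- Soundness read backwards: the least and the greatest height below the
      -- root are attained by paths, so that the tolerance on paths gives both
      -- strict inequalities.
      extremes : (∀ {u w} (π : Walk G u w) → Simple π → WithinTolerance π) → ∀ {v} (t : Tree v) → Proper t →
                 ∃₂ λ L U → Feasible ω̃ t L U × Reaches t L × Reaches t U
      extremes R (single v) _ = h v , h v , single ≤-refl ≤-refl , trivial , trivial
        where
        trivial : Reaches (single v) (h v)
        trivial = v , (stop , ≡-refl ∷ [] , [] ∷ [] , refl) , (stop , ≡-refl ∷ [] , [] ∷ [] , refl)
      extremes R (graft {v} {c} t e J z slope s) (pt , ps , disjoint)
        with extremes R t pt | extremes R s ps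
      ... | L₁ , U₁ , ft , rL₁ , rU₁ | L₂ , U₂ , fs , rL₂ , rU₂ =
        let U , u , u′ , rU = upper-end in
        let L , l , l′ , rL = lower-end in
        L , U , graft ft fs (proj₁ (joint rU₁ rU₂)) (proj₂ (joint rL₁ rL₂)) u u′ l l′ , rL , rU
        where
        K : Carrier
        K = fromℕ (ω̃ e)
        joint : ∀ {y₁ y₂} → Reaches t y₁ → Reaches s y₂ →
                y₁ + (y₂ + K) < ε + (h v + (h v + fromℕ z)) × h v + (h v + fromℕ z) < ε + (y₁ + (y₂ + K))
        joint {y₁} {y₂} (_ , _ , (π , vπ , sπ , aπ)) (_ , (ρ , vρ , sρ , aρ) , _)
          with R (connect π J ρ) (simple-connect π J ρ sπ sρ (λ p q → disjoint (All.lookup vπ p) (All.lookup vρ q)))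
        ... | p , q =
          linear (Rc ∷ Xc ∷ rounded π ∷ rounded ρ ∷ exact π ∷ exact ρ ∷ K ∷ ω e ∷ h v ∷ h c ∷ fromℕ z ∷ ε ∷ y₁ ∷ y₂ ∷ [])
            (λ R X r₁ r₂ x₁ x₂ k w hv hc z ε y₁ y₂ →
              R :< X :+ ε ∷ r₁ :+ (k :+ r₂) :≈ R ∷ X :≈ x₁ :+ (w :+ x₂) ∷ y₁ :+ x₁ :≈ hv :+ r₁ ∷ y₂ :+ x₂ :≈ hc :+ r₂ ∷
              hc :+ w :≈ hv :+ z ∷ [] ⊢ y₁ :+ (y₂ :+ k) :< ε :+ (hv :+ (hv :+ z)))
            (p , sym (rounded-connect π J ρ) , exact-connect π J ρ , sym aπ , sym aρ , slope) ,
          linear (Rc ∷ Xc ∷ rounded π ∷ rounded ρ ∷ exact π ∷ exact ρ ∷ K ∷ ω e ∷ h v ∷ h c ∷ fromℕ z ∷ ε ∷ y₁ ∷ y₂ ∷ [])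
            (λ R X r₁ r₂ x₁ x₂ k w hv hc z ε y₁ y₂ →
              X :< R :+ ε ∷ R :≈ r₁ :+ (k :+ r₂) ∷ x₁ :+ (w :+ x₂) :≈ X ∷ hv :+ r₁ :≈ y₁ :+ x₁ ∷ hc :+ r₂ :≈ y₂ :+ x₂ ∷
              hv :+ z :≈ hc :+ w ∷ [] ⊢ hv :+ (hv :+ z) :< ε :+ (y₁ :+ (y₂ :+ k)))
            (q , rounded-connect π J ρ , sym (exact-connect π J ρ) , aπ , aρ , sym slope)
          where
          Rc Xc : Carrier
          Rc = rounded (connect π J ρ)
          Xc = exact (connect π J ρ)
        near : ∀ {y} → Reaches t y → Reaches (graft t e J z slope s) y
        near (x , (π , vπ , r) , (ρ , vρ , r′)) = x , (π , All.map inj₁ vπ , r) , (ρ , All.map inj₁ vρ , r′)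
        flip : ∀ a b → a + (b + 0#) ≈ b + a
        flip a b = linear (a ∷ b ∷ []) (λ a b → [] ⊢ a :+ (b :+ # 0) :≈ b :+ a) tt
        moved : ∀ {y r x R X} → h c + r ≈ y + x → R ≈ K + r → X ≈ ω e + x → h v + R ≈ y + K - fromℕ z + X
        moved {y} {r} {x} {R} {X} eq R≈ X≈ =
          linear (h v ∷ h c ∷ y ∷ r ∷ x ∷ R ∷ X ∷ K ∷ ω e ∷ fromℕ z ∷ [])
            (λ hv hc y r x R X k w z → hc :+ r :≈ y :+ x ∷ R :≈ k :+ r ∷ w :+ x :≈ X ∷ hv :+ z :≈ hc :+ w ∷ []
              ⊢ hv :+ R :≈ y :+ k :- z :+ X) (eq , R≈ , sym X≈ , sym slope)
        far : ∀ {y} → Reaches s y → Reaches (graft t e J z slope s) (y + K - fromℕ z)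
        far {y} (x , (π , vπ , sπ , aπ) , (ρ , vρ , sρ , aρ)) = x ,
          (step e J π , inj₁ (root∈ t) ∷ All.map inj₂ vπ , All.map (λ { q ≡-refl → disjoint (root∈ t) q }) vπ ∷ sπ ,
           moved aπ (fromℕ-+ (ω̃ e) _) refl) ,
          (connect ρ (joins-sym {e = e} J) stop ,
           ≡-subst (All _) (≡-sym (vertices-connect ρ (joins-sym {e = e} J) stop)) (Allₚ.++⁺ (All.map inj₂ vρ) (inj₁ (root∈ t) ∷ [])) ,
           simple-connect ρ (joins-sym {e = e} J) stop sρ ([] ∷ [])
             (λ { p (here ≡-refl) → disjoint (root∈ t) (All.lookup vρ p) }) ,
           moved aρ (trans (rounded-connect ρ (joins-sym {e = e} J) stop) (flip (rounded ρ) K))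
                    (trans (exact-connect ρ (joins-sym {e = e} J) stop) (flip (exact ρ) (ω e))))
        restore : ∀ y → y + K ≈ y + K - fromℕ z + fromℕ z
        restore y = linear (y ∷ K ∷ fromℕ z ∷ []) (λ y k z → [] ⊢ y :+ k :≈ y :+ k :- z :+ z) tt
        -- `U₂ + K − z` is the child's greatest height in the parent's frame. Whichever of it and
        -- `U₁` is greater is attained on the side it comes from.
        upper-end : ∃ λ U → U₁ ≤ U × U₂ + K ≤ U + fromℕ z × Reaches (graft t e J z slope s) U
        upper-end with compare (U₁ + fromℕ z) (U₂ + K)
        ... | tri< p _ _ = U₂ + K - fromℕ z ,
          linear (U₁ ∷ fromℕ z ∷ U₂ ∷ K ∷ []) (λ u z y k → u :+ z :< y :+ k ∷ [] ⊢ u :≤ y :+ k :- z) p ,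
          ≈⇒≤ (restore U₂) , far rU₂
        ... | tri≈ _ p _ = U₁ , ≤-refl , ≈⇒≤ (sym p) , near rU₁
        ... | tri> _ _ p = U₁ , ≤-refl , <⇒≤ p , near rU₁
        lower-end : ∃ λ L → L ≤ L₁ × L + fromℕ z ≤ L₂ + K × Reaches (graft t e J z slope s) L
        lower-end with compare (L₁ + fromℕ z) (L₂ + K)
        ... | tri< p _ _ = L₁ , ≤-refl , <⇒≤ p , near rL₁
        ... | tri≈ _ p _ = L₁ , ≤-refl , ≈⇒≤ p , near rL₁
        ... | tri> _ _ p = L₂ + K - fromℕ z ,
          linear (L₁ ∷ fromℕ z ∷ L₂ ∷ K ∷ []) (λ l z y k → y :+ k :< l :+ z ∷ [] ⊢ y :+ k :- z :≤ l) p ,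
          ≈⇒≤ (sym (restore L₂)) , far rL₂

-- Tables of feasible height intervals

module Specifications (ℝ : Reals) (N : ℕ) (x : ℕ → Reals.Carrier ℝ) (lowered : ℕ → ℕ → ℕ) (ε : Reals.Carrier ℝ) where
  open Reals ℝ using (Carrier; _≈_; _<_; _≤_; _+_; 0#; fromℕ)

  -- y is the best lower bound for a child with table F below candidate b,
  -- over all ways of raising it by κ − 2 with κ < k.
  record LiftedCell (k z : ℕ) (F : ℕ → Carrier) (b : ℕ) (y : Carrier) : Set where
    constructor liftedCell
    field
      nonneg   : 0# ≤ y
      sound    : 0# < y → ∃ λ κ → κ ℕ.< 5 × 0# < F (lowered b κ) × 2 ℕ.≤ κ ℕ.+ z ×
                 y + fromℕ 2 ≈ F (lowered b κ) + fromℕ κ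
      complete : ∀ {κ} → κ ℕ.< k → 0# < F (lowered b κ) → 2 ℕ.≤ κ ℕ.+ z → F (lowered b κ) + fromℕ κ ≤ y + fromℕ 2

  IsLifted : (z : ℕ) (F H : ℕ → Carrier) → Set
  IsLifted z F H = ∀ {b} → b ℕ.< N → LiftedCell 5 z F b (H b)

  Compatible : Carrier → (K H : ℕ → Carrier) → ℕ → ℕ → Set
  Compatible r K H i j = x i + x j < ε + (r + r) × r + r < ε + (K i + H j)

  -- The union of intervals with upper ends `x i` and `x j` ends at the candidate of larger index,
  -- so indices below `A` describe the unions bounded by the candidate at `A − 1`. The value is the
  -- maximum of `min (K i) (H j)` over compatible pairs of positive entries, or 0 if there are none;
  -- quantifying over `L` avoids the minimum.
  record IsBest (r : Carrier) (K H : ℕ → Carrier) (A : ℕ) (y : Carrier) : Set where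
    constructor isBest
    field
      nonneg   : 0# ≤ y
      sound    : 0# < y → ∃₂ λ i j → i ℕ.< A × j ℕ.< A × Compatible r K H i j × y ≤ K i × y ≤ H j
      complete : ∀ {i j L} → i ℕ.< A → j ℕ.< A → Compatible r K H i j → 0# < K i → 0# < H j → L ≤ K i → L ≤ H j → L ≤ y

  IsMerged : Carrier → (K H F : ℕ → Carrier) → Set
  IsMerged r K H F = ∀ {A} → A ℕ.< N → IsBest r K H (suc A) (F A)

module Tables (ℝ : Reals) {n m : ℕ} (G : Graph n m)
              (ω : Fin m → Reals.Carrier ℝ) (h : Fin n → Reals.Carrier ℝ)
              (2≤h : ∀ v → Reals._≤_ ℝ (Reals.fromℕ ℝ 2) (h v)) (h<3 : ∀ v → Reals._<_ ℝ (h v) (Reals.fromℕ ℝ 3))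
              (ε : Reals.Carrier ℝ) where
  open Reals ℝ using (Carrier; _≈_; _<_; _≤_; _+_; _-_; -_; 0#; fromℕ; compare; refl; sym; trans; +-cong; +-assoc)
  open OrderedFieldProperties ℝ
  open GraftedTrees ℝ G ω h

  -- These are the numbers congruent to some height modulo 1; natural numbers added on both sides
  -- take the place of an integer.
  Height : Carrier → Set
  Height y = ∃ λ w → ∃₂ λ a b → y + fromℕ a ≈ h w + fromℕ b

  height : ∀ v → Height (h v)
  height v = v , 0 , 0 , refl

  height-shift : ∀ {y} k z → Height y → Height (y + fromℕ k - fromℕ z)
  height-shift {y} k z (w , a , b , eq) = w , a ℕ.+ z , b ℕ.+ k ,
    linear (y ∷ fromℕ k ∷ fromℕ z ∷ fromℕ a ∷ fromℕ b ∷ h w ∷ fromℕ (a ℕ.+ z) ∷ fromℕ (b ℕ.+ k) ∷ [])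
      (λ y k z a b h az bk → y :+ a :≈ h :+ b ∷ az :≈ a :+ z ∷ b :+ k :≈ bk ∷ [] ⊢ y :+ k :- z :+ az :≈ h :+ bk)
      (eq , fromℕ-+ a z , sym (fromℕ-+ b k))

  -- Such an interval can be found in the table: its upper end is congruent to a height and close to
  -- the root, hence a candidate, and `low-near` makes its lower end positive once `ε` is below 2.
  record Tight (ω̃ : Fin m → ℕ) {v} (t : Tree v) (L U : Carrier) : Set where
    constructor tight
    field
      {low high} : Carrier
      feasible : Feasible ε ω̃ t low high
      low≥     : L ≤ low
      high≤    : high ≤ U
      low-near  : h v < low + ε
      high-near : high < h v + ε
      isHeight : Height high

  -- At every graft the bounds shrink to the extreme heights of both sides. The root belongs to `t`,
  -- so the strict inequalities of the graft, with `h v` in place of `U₁` or `L₁`, keep the child's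
  -- extremes within `ε` of `h v`.
  tighten : 0# < ε → ∀ {ω̃ v L U} {t : Tree v} → Feasible ε ω̃ t L U → Tight ω̃ t L U
  tighten 0<ε {v = v} (single l u) = tight (single ≤-refl ≤-refl) l u
    (linear (h v ∷ ε ∷ []) (λ h ε → # 0 :< ε ∷ [] ⊢ h :< h :+ ε) 0<ε)
    (linear (h v ∷ ε ∷ []) (λ h ε → # 0 :< ε ∷ [] ⊢ h :< h :+ ε) 0<ε) (height v)
  tighten 0<ε {ω̃} {v} {L} {U} {t = graft t e J z slope s} (graft {L₁ = M₁} {V₁} {M₂} {V₂} ft fs upper lower u u′ l l′)
    with tighten 0<ε ft | tighten 0<ε fs
  ... | tight {L₁} {U₁} ft′ l₁ u₁ a₁ b₁ g₁ | tight {L₂} {U₂} fs′ l₂ u₂ a₂ b₂ g₂ =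
    let U′ , p , p′ , q , b , g = upper-end
        L′ , r , r′ , w , a = lower-end
    in tight (graft ft′ fs′ upper′ lower′ p p′ r r′) w q a b g
    where
    K Z : Carrier
    K = fromℕ (ω̃ e)
    Z = fromℕ z
    upper′ : U₁ + (U₂ + K) < ε + (h v + (h v + Z))
    upper′ = ≤-<-trans (+-mono-≤ u₁ (+-monoˡ-≤ K u₂)) upper
    lower′ : h v + (h v + Z) < ε + (L₁ + (L₂ + K))
    lower′ = <-≤-trans lower (+-monoʳ-≤ ε (+-mono-≤ l₁ (+-monoˡ-≤ K l₂)))
    restore : ∀ y → y + K ≈ y + K - Z + Z
    restore y = linear (y ∷ K ∷ Z ∷ []) (λ y k z → [] ⊢ y :+ k :≈ y :+ k :- z :+ z) tt
    upper-end : ∃ λ U′ → U₁ ≤ U′ × U₂ + K ≤ U′ + Z × U′ ≤ U × U′ < h v + ε × Height U′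
    upper-end with compare (U₁ + Z) (U₂ + K)
    ... | tri< p _ _ = U₂ + K - Z ,
      linear (U₁ ∷ Z ∷ U₂ ∷ K ∷ []) (λ u z y k → u :+ z :< y :+ k ∷ [] ⊢ u :≤ y :+ k :- z) p ,
      ≈⇒≤ (restore U₂) ,
      linear (U₂ ∷ V₂ ∷ K ∷ Z ∷ U ∷ []) (λ u v k z U → v :+ k :≤ U :+ z ∷ u :≤ v ∷ [] ⊢ u :+ k :- z :≤ U) (u′ , u₂) ,
      linear (U₁ ∷ U₂ ∷ K ∷ Z ∷ ε ∷ h v ∷ [])
        (λ u₁ u₂ k z ε h → u₁ :+ (u₂ :+ k) :< ε :+ (h :+ (h :+ z)) ∷ h :≤ u₁ ∷ [] ⊢ u₂ :+ k :- z :< h :+ ε)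
        (upper′ , proj₂ (feasible-root ε ft′)) ,
      height-shift (ω̃ e) z g₂
    ... | tri≈ _ p _ = U₁ , ≤-refl , ≈⇒≤ (sym p) , ≤-trans u₁ u , b₁ , g₁
    ... | tri> _ _ p = U₁ , ≤-refl , <⇒≤ p , ≤-trans u₁ u , b₁ , g₁
    lower-end : ∃ λ L′ → L′ ≤ L₁ × L′ + Z ≤ L₂ + K × L ≤ L′ × h v < L′ + ε
    lower-end with compare (L₁ + Z) (L₂ + K)
    ... | tri< p _ _ = L₁ , ≤-refl , <⇒≤ p , ≤-trans l l₁ , a₁
    ... | tri≈ _ p _ = L₁ , ≤-refl , ≈⇒≤ p , ≤-trans l l₁ , a₁
    ... | tri> _ _ p = L₂ + K - Z ,
      linear (L₁ ∷ Z ∷ L₂ ∷ K ∷ []) (λ l z y k → y :+ k :< l :+ z ∷ [] ⊢ y :+ k :- z :≤ l) p ,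
      ≈⇒≤ (sym (restore L₂)) ,
      linear (L₂ ∷ M₂ ∷ K ∷ Z ∷ L ∷ []) (λ u v k z L → L :+ z :≤ v :+ k ∷ v :≤ u ∷ [] ⊢ L :≤ u :+ k :- z) (l′ , l₂) ,
      linear (L₁ ∷ L₂ ∷ K ∷ Z ∷ ε ∷ h v ∷ [])
        (λ l₁ l₂ k z ε h → h :+ (h :+ z) :< ε :+ (l₁ :+ (l₂ :+ k)) ∷ l₁ :≤ h ∷ [] ⊢ h :< l₂ :+ k :- z :+ ε)
        (lower′ , proj₁ (feasible-root ε ft′))

  -- With tolerance at least 2 every edge may keep the heights of its ends,
  -- because all heights then lie in [2, 3).
  rigid : fromℕ 2 ≤ ε → ∀ {v} (t : Tree v) → Proper t →
          ∃ λ ω̃ → ∃₂ λ L U → Feasible ε ω̃ t L U × fromℕ 2 ≤ L × U < fromℕ 3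
  rigid 2≤ε (single v) _ = (λ _ → 0) , h v , h v , single ≤-refl ≤-refl , 2≤h v , h<3 v
  rigid 2≤ε (graft {v} t e J z slope s) (pt , ps , disjoint) with rigid 2≤ε t pt | rigid 2≤ε s ps
  ... | _ , L₁ , U₁ , ft , l₁ , u₁ | _ , L₂ , U₂ , fs , l₂ , u₂ with feasible-merge ε e J disjoint ft fs z
  ...   | ω̃ , ft′ , fs′ , eq with compare U₁ U₂ | compare L₁ L₂
  ...     | U? | L? =
    ω̃ , _ , _ ,
    graft ft′ fs′
      (≡-subst (λ k → U₁ + (U₂ + fromℕ k) < ε + (h v + (h v + fromℕ z))) (≡-sym eq)
        (linear (U₁ ∷ U₂ ∷ fromℕ z ∷ ε ∷ h v ∷ [])
          (λ u₁ u₂ z ε h → u₁ :< # 3 ∷ u₂ :< # 3 ∷ # 2 :≤ ε ∷ # 2 :≤ h ∷ # 2 :≤ h ∷ []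
            ⊢ u₁ :+ (u₂ :+ z) :< ε :+ (h :+ (h :+ z))) (u₁ , u₂ , 2≤ε , 2≤h v , 2≤h v)))
      (≡-subst (λ k → h v + (h v + fromℕ z) < ε + (L₁ + (L₂ + fromℕ k))) (≡-sym eq)
        (linear (L₁ ∷ L₂ ∷ fromℕ z ∷ ε ∷ h v ∷ [])
          (λ l₁ l₂ z ε h → h :< # 3 ∷ h :< # 3 ∷ # 2 :≤ ε ∷ # 2 :≤ l₁ ∷ # 2 :≤ l₂ ∷ []
            ⊢ h :+ (h :+ z) :< ε :+ (l₁ :+ (l₂ :+ z))) (h<3 v , h<3 v , 2≤ε , l₁ , l₂)))
      (proj₁ (proj₂ upper)) (shift-≤ (proj₁ (proj₂ (proj₂ upper)))) (proj₁ (proj₂ lower)) (shift-≥ (proj₁ (proj₂ (proj₂ lower)))) ,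
    proj₂ (proj₂ (proj₂ lower)) , proj₂ (proj₂ (proj₂ upper))
    where
    shift-≤ : ∀ {x y} → x ≤ y → x + fromℕ (ω̃ e) ≤ y + fromℕ z
    shift-≤ p rewrite eq = +-monoˡ-≤ _ p
    shift-≥ : ∀ {x y} → x ≤ y → x + fromℕ z ≤ y + fromℕ (ω̃ e)
    shift-≥ p rewrite eq = +-monoˡ-≤ _ p
    upper : ∃ λ U → U₁ ≤ U × U₂ ≤ U × U < fromℕ 3
    upper with compare U₁ U₂
    ... | tri< p _ _ = U₂ , <⇒≤ p , ≤-refl , u₂
    ... | tri≈ _ p _ = U₁ , ≤-refl , ≈⇒≤ (sym p) , u₁
    ... | tri> _ _ p = U₁ , ≤-refl , <⇒≤ p , u₁
    lower : ∃ λ L → L ≤ L₁ × L ≤ L₂ × fromℕ 2 ≤ L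
    lower with compare L₁ L₂
    ... | tri< p _ _ = L₁ , ≤-refl , <⇒≤ p , l₁
    ... | tri≈ _ p _ = L₁ , ≤-refl , ≈⇒≤ p , l₁
    ... | tri> _ _ p = L₂ , <⇒≤ p , ≤-refl , l₂

  -- The candidates for an upper bound on heights are x 0 ≤ … ≤ x (N ∸ 1).
  -- Raising a child by κ − 2 moves its candidate `lowered b κ` to candidate b.

  record Grid (N : ℕ) (x : ℕ → Carrier) (lowered : ℕ → ℕ → ℕ) : Set where
    field
      mono             : ∀ {a b} → a ℕ.≤ b → b ℕ.< N → x a ≤ x b
      last             : ℕ
      last<            : last ℕ.< N
      top              : fromℕ 5 ≤ x last
      locate           : ∀ {y} → Height y → 0# ≤ y → y < fromℕ 5 → ∃ λ a → a ℕ.< N × x a ≈ y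
      lowered<         : ∀ b κ → lowered b κ ℕ.< N
      lowered-mono     : ∀ {a b} κ → a ℕ.≤ b → lowered a κ ℕ.≤ lowered b κ
      lowered-sound    : ∀ {b} κ → b ℕ.< N → x (lowered b κ) + fromℕ κ ≤ x b + fromℕ 2 ⊎ x (lowered b κ) < fromℕ 2
      lowered-complete : ∀ {b} κ {y} → b ℕ.< N → fromℕ 2 ≤ y → y < fromℕ 5 → y + fromℕ κ ≤ x b + fromℕ 2 →
                         y ≤ x (lowered b κ)

  module _ {N : ℕ} {x : ℕ → Carrier} {lowered : ℕ → ℕ → ℕ} (grid : Grid N x lowered) where
    open Grid grid
    open Specifications ℝ N x lowered ε

    -- F a is the greatest lower bound on heights that is compatible with the
    -- upper bound x a, and 0 if there is none.
    record IsTable {v} (t : Tree v) (F : ℕ → Carrier) : Set where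
      field
        nonneg   : ∀ {a} → a ℕ.< N → 0# ≤ F a
        sound    : ∀ {a} → a ℕ.< N → 0# < F a → ∃ λ ω̃ → Feasible ε ω̃ t (F a) (x a)
        complete : ∀ {a ω̃ L} → a ℕ.< N → Feasible ε ω̃ t L (x a) → L ≤ F a

    table-mono : ∀ {v F a b} {t : Tree v} → IsTable t F → a ℕ.≤ b → b ℕ.< N → F a ≤ F b
    table-mono {F = F} {a} tb a≤b b<N with compare 0# (F a)
    ... | tri< p _ _ = let ω̃ , f = IsTable.sound tb (ℕ.≤-<-trans a≤b b<N) p in
      IsTable.complete tb b<N (feasible-weaken ε ≤-refl (mono a≤b b<N) f)
    ... | tri≈ _ p _ = ≤-trans (≈⇒≤ (sym p)) (IsTable.nonneg tb b<N)
    ... | tri> _ _ p = ≤-trans (<⇒≤ p) (IsTable.nonneg tb b<N)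

    lifted-mono : ∀ {v z F H a b} {t : Tree v} → IsTable t F → IsLifted z F H → a ℕ.≤ b → b ℕ.< N → H a ≤ H b
    lifted-mono {F = F} {H} {a} {b} tb lf a≤b b<N with compare 0# (H a)
    ... | tri< p _ _ with LiftedCell.sound (lf (ℕ.≤-<-trans a≤b b<N)) p
    ...   | κ , κ<5 , 0<F , 2≤κ+z , eq =
      let F≤F = table-mono tb (lowered-mono κ a≤b) (lowered< b κ) in
      linear (H a ∷ H b ∷ F (lowered a κ) ∷ F (lowered b κ) ∷ fromℕ κ ∷ [])
        (λ A B f g k → A :+ # 2 :≈ f :+ k ∷ f :≤ g ∷ g :+ k :≤ B :+ # 2 ∷ [] ⊢ A :≤ B)
        (eq , F≤F , LiftedCell.complete (lf b<N) κ<5 (<-≤-trans 0<F F≤F) 2≤κ+z)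
    lifted-mono tb lf a≤b b<N | tri≈ _ p _ = ≤-trans (≈⇒≤ (sym p)) (LiftedCell.nonneg (lf b<N))
    lifted-mono tb lf a≤b b<N | tri> _ _ p = ≤-trans (<⇒≤ p) (LiftedCell.nonneg (lf b<N))

    single-table : ∀ {v F} → (∀ {a} → a ℕ.< N → (x a < h v × F a ≡ 0#) ⊎ (h v ≤ x a × F a ≡ h v)) → IsTable (single v) F
    single-table {v} {F} spec = record { nonneg = nonneg ; sound = sound ; complete = complete }
      where
      0<h : 0# < h v
      0<h = linear (h v ∷ []) (λ h → # 2 :≤ h ∷ [] ⊢ # 0 :< h) (2≤h v)
      nonneg : ∀ {a} → a ℕ.< N → 0# ≤ F a
      nonneg a<N with spec a<N
      ... | inj₁ (_ , eq) rewrite eq = ≤-refl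
      ... | inj₂ (_ , eq) rewrite eq = <⇒≤ 0<h
      sound : ∀ {a} → a ℕ.< N → 0# < F a → ∃ λ ω̃ → Feasible ε ω̃ (single v) (F a) (x a)
      sound a<N p with spec a<N
      ... | inj₁ (_ , eq) rewrite eq = ⊥-elim (<-irrefl p)
      ... | inj₂ (q , eq) rewrite eq = (λ _ → 0) , single ≤-refl q
      complete : ∀ {a ω̃ L} → a ℕ.< N → Feasible ε ω̃ (single v) L (x a) → L ≤ F a
      complete a<N (single l u) with spec a<N
      ... | inj₁ (q , _)            = ⊥-elim (<⇒≱ q u)
      ... | inj₂ (_ , eq) rewrite eq = l

    locate-below : ∀ {y A} → Height y → 0# ≤ y → y < fromℕ 5 → A ℕ.< N → y ≤ x A → ∃ λ a → a ℕ.< suc A × x a ≈ y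
    locate-below {y} {A} g 0≤y y<5 A<N y≤ with locate g 0≤y y<5
    ... | a , a<N , eq with a ℕ.≤? A
    ...   | yes a≤A = a , s≤s a≤A , eq
    -- Candidates may coincide: here `x A ≤ x a ≈ y ≤ x A`, so `A` itself serves.
    ...   | no a≰A = A , ℕ.≤-refl , ≤-antisym (≤-trans (mono (ℕ.<⇒≤ (ℕ.≰⇒> a≰A)) a<N) (≈⇒≤ eq)) y≤

    module _ (0<ε : 0# < ε) (ε<2 : ε < fromℕ 2) where

      -- Applied to the two roots alone, the inequalities of the graft put `h c + ω̃ e − z` less
      -- than 2 away from `h v`. As `h v` and `h c` differ by less than 1, the shift is smaller than
      -- 3 in absolute value; adding 2 turns the five possible shifts into natural numbers.
      shift-bounds : ∀ {ω̃ v c e z L₁ U₁ L₂ U₂} {t : Tree v} {s : Tree c} → Feasible ε ω̃ t L₁ U₁ → Feasible ε ω̃ s L₂ U₂ →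
                     U₁ + (U₂ + fromℕ (ω̃ e)) < ε + (h v + (h v + fromℕ z)) →
                     h v + (h v + fromℕ z) < ε + (L₁ + (L₂ + fromℕ (ω̃ e))) →
                     ∃ λ κ → κ ℕ.< 5 × κ ℕ.+ z ≡ ω̃ e ℕ.+ 2
      shift-bounds {ω̃} {v} {c} {e} {z} {L₁} {U₁} {L₂} {U₂} ft fs upper lower =
        (k ℕ.+ 2) ∸ z , ℕ.m<n+o⇒m∸n<o (k ℕ.+ 2) z k+2<z+5 , ℕ.m∸n+n≡m z≤k+2
        where
        k : ℕ
        k = ω̃ e
        z≤k+2 : z ℕ.≤ k ℕ.+ 2
        z≤k+2 = ℕ.+-cancelʳ-≤ 1 z (k ℕ.+ 2) (≡-subst₂ ℕ._≤_ (ℕ.+-comm 1 z) (≡-sym (ℕ.+-assoc k 2 1)) (fromℕ-cancel-< {z} {k ℕ.+ 3}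
          (linear (fromℕ z ∷ fromℕ k ∷ fromℕ (k ℕ.+ 3) ∷ h v ∷ h c ∷ ε ∷ L₁ ∷ L₂ ∷ [])
            (λ z k k+3 hv hc ε l₁ l₂ → k :+ # 3 :≈ k+3 ∷ # 2 :≤ hv ∷ hc :< # 3 ∷ ε :< # 2 ∷ l₁ :≤ hv ∷ l₂ :≤ hc ∷
              hv :+ (hv :+ z) :< ε :+ (l₁ :+ (l₂ :+ k)) ∷ [] ⊢ z :< k+3)
            (sym (fromℕ-+ k 3) , 2≤h v , h<3 c , ε<2 , proj₁ (feasible-root ε ft) , proj₁ (feasible-root ε fs) , lower))))
        k+2<z+5 : k ℕ.+ 2 ℕ.< z ℕ.+ 5
        k+2<z+5 = fromℕ-cancel-<
          (linear (fromℕ z ∷ fromℕ k ∷ fromℕ (k ℕ.+ 2) ∷ fromℕ (z ℕ.+ 5) ∷ h v ∷ h c ∷ ε ∷ U₁ ∷ U₂ ∷ [])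
            (λ z k k+2 z+5 hv hc ε u₁ u₂ → k+2 :≈ k :+ # 2 ∷ z :+ # 5 :≈ z+5 ∷ hv :< # 3 ∷ # 2 :≤ hc ∷ ε :< # 2 ∷
              hv :≤ u₁ ∷ hc :≤ u₂ ∷ u₁ :+ (u₂ :+ k) :< ε :+ (hv :+ (hv :+ z)) ∷ [] ⊢ k+2 :< z+5)
            (fromℕ-+ k 2 , sym (fromℕ-+ z 5) , h<3 v , 2≤h c , ε<2 , proj₂ (feasible-root ε ft) , proj₂ (feasible-root ε fs) , upper))

      module _ {v c e z} {t : Tree v} {s : Tree c} (J : Joins G e v c) (slope : h c + ω e ≈ h v + fromℕ z)
               (disjoint : ∀ {u} → Vertex t u → Vertex s u → ⊥)
               {K F H F′ : ℕ → Carrier} (tableᵗ : IsTable t K) (tableˢ : IsTable s F) (lifted : IsLifted z F H)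
               (merged : IsMerged (h v) K H F′) where

        private
          r : Carrier
          r = h v

        graft-sound : ∀ {A} → A ℕ.< N → 0# < F′ A → ∃ λ ω̃ → Feasible ε ω̃ (graft t e J z slope s) (F′ A) (x A)
        graft-sound {A} A<N 0<y with IsBest.sound (merged A<N) 0<y
        ... | i , j , s≤s i≤A , s≤s j≤A , (fits , lower) , y≤K , y≤H
          with IsTable.sound tableᵗ (ℕ.≤-<-trans i≤A A<N) (<-≤-trans 0<y y≤K)
             | LiftedCell.sound (lifted (ℕ.≤-<-trans j≤A A<N)) (<-≤-trans 0<y y≤H)
        ...   | ω̃₁ , ft | κ , κ<5 , 0<F , 2≤κ+z , eq with IsTable.sound tableˢ (lowered< j κ) 0<F
        -- A shift of `κ − 2` is the weight `κ + z − 2` on the edge, and `2≤κ+z` makes the truncated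
        -- subtraction exact.
        ...     | ω̃₂ , fs with feasible-merge ε e J disjoint ft fs (κ ℕ.+ z ∸ 2)
        ...       | ω̃ , ft′ , fs′ , ω̃e≡k with lowered-sound κ (ℕ.≤-<-trans j≤A A<N)
        -- A candidate below 2 would have to bound the child's own height, which is at least 2.
        ...         | inj₂ x<2 = ⊥-elim (<⇒≱ x<2 (≤-trans (2≤h c) (proj₂ (feasible-root ε fs))))
        ...         | inj₁ xκ≤ =
          ω̃ , graft ft′ fs′
            (linear (x i ∷ x j ∷ x (lowered j κ) ∷ k ∷ fromℕ κ ∷ fromℕ z ∷ ε ∷ r ∷ [])
              (λ xi xj xl k κ z ε r → xi :+ xj :< ε :+ (r :+ r) ∷ xl :+ κ :≤ xj :+ # 2 ∷ k :+ # 2 :≈ κ :+ z ∷ []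
                ⊢ xi :+ (xl :+ k) :< ε :+ (r :+ (r :+ z))) (fits , xκ≤ , k+2≈κ+z))
            (linear (K i ∷ H j ∷ F (lowered j κ) ∷ k ∷ fromℕ κ ∷ fromℕ z ∷ ε ∷ r ∷ [])
              (λ Ki Hj Fl k κ z ε r → r :+ r :< ε :+ (Ki :+ Hj) ∷ Hj :+ # 2 :≈ Fl :+ κ ∷ κ :+ z :≈ k :+ # 2 ∷ []
                ⊢ r :+ (r :+ z) :< ε :+ (Ki :+ (Fl :+ k))) (lower , eq , sym k+2≈κ+z))
            (mono i≤A A<N)
            (linear (x A ∷ x j ∷ x (lowered j κ) ∷ k ∷ fromℕ κ ∷ fromℕ z ∷ [])
              (λ xA xj xl k κ z → xl :+ κ :≤ xj :+ # 2 ∷ k :+ # 2 :≈ κ :+ z ∷ xj :≤ xA ∷ [] ⊢ xl :+ k :≤ xA :+ z)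
              (xκ≤ , k+2≈κ+z , mono j≤A A<N))
            y≤K
            (linear (F′ A ∷ H j ∷ F (lowered j κ) ∷ k ∷ fromℕ κ ∷ fromℕ z ∷ [])
              (λ y Hj Fl k κ z → y :≤ Hj ∷ Hj :+ # 2 :≈ Fl :+ κ ∷ κ :+ z :≈ k :+ # 2 ∷ [] ⊢ y :+ z :≤ Fl :+ k)
              (y≤H , eq , sym k+2≈κ+z))
          where
          k : Carrier
          k = fromℕ (ω̃ e)
          k+2≈κ+z : k + fromℕ 2 ≈ fromℕ κ + fromℕ z
          k+2≈κ+z = trans (sym (fromℕ-+ (ω̃ e) 2))
            (trans (≡-subst (λ q → fromℕ (ω̃ e ℕ.+ 2) ≈ fromℕ q) (≡-trans (≡-cong (ℕ._+ 2) ω̃e≡k) (ℕ.m∸n+n≡m 2≤κ+z)) refl) (fromℕ-+ κ z))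

        -- The witnesses are the index of the upper end of `t` and that of the child's upper end
        -- seen from `v`. Both are located because tight ends are congruent to heights and lie in
        -- [0, 5); the entries at these indices then dominate the given lower ends.
        tight-complete : ∀ {A ω̃ L M₁ M₂ V₁ V₂} → A ℕ.< N → Tight ω̃ t M₁ V₁ → Tight ω̃ s M₂ V₂ →
                         V₁ + (V₂ + fromℕ (ω̃ e)) < ε + (h v + (h v + fromℕ z)) →
                         h v + (h v + fromℕ z) < ε + (M₁ + (M₂ + fromℕ (ω̃ e))) →
                         V₁ ≤ x A → V₂ + fromℕ (ω̃ e) ≤ x A + fromℕ z →
                         L ≤ M₁ → L + fromℕ z ≤ M₂ + fromℕ (ω̃ e) → L ≤ F′ A
        tight-complete {A} {ω̃} {L} {M₁} {M₂} {V₁} {V₂} A<N (tight {L₁} {U₁} ft′ l₁ u₁ a₁ b₁ g₁) (tight {L₂} {U₂} fs′ l₂ u₂ a₂ b₂ g₂)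
                       upper lower u u′ l l′ =
          shifted (shift-bounds {ω̃} {e = e} {z} ft′ fs′ upper′ lower′)
          where
          k : Carrier
          k = fromℕ (ω̃ e)
          upper′ : U₁ + (U₂ + k) < ε + (r + (r + fromℕ z))
          upper′ = ≤-<-trans (+-mono-≤ u₁ (+-monoˡ-≤ _ u₂)) upper
          lower′ : r + (r + fromℕ z) < ε + (L₁ + (L₂ + k))
          lower′ = <-≤-trans lower (+-monoʳ-≤ ε (+-mono-≤ l₁ (+-monoˡ-≤ _ l₂)))
          -- 3 from the height and 2 from `ε`: this is the range in which the grid must locate
          -- heights.
          <5 : ∀ w {y} → y < h w + ε → y < fromℕ 5
          <5 w {y} p = linear (y ∷ h w ∷ ε ∷ []) (λ y h ε → y :< h :+ ε ∷ h :< # 3 ∷ ε :< # 2 ∷ [] ⊢ y :< # 5) (p , h<3 w , ε<2)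
          0≤r : 0# ≤ r
          0≤r = linear (r ∷ []) (λ r → # 2 :≤ r ∷ [] ⊢ # 0 :≤ r) (2≤h v)
          ChildEnd : Carrier → Set
          ChildEnd M = U₂ + k ≤ M + fromℕ z × r ≤ M × M ≤ x A × M < fromℕ 5 × Height M × U₁ + M < ε + (r + r)
          -- An upper end below the root's height may fail to be a candidate, and is raised to that height.
          child-end : ∃ ChildEnd
          child-end with (U₂ + k) ≤? (r + fromℕ z)
          ... | no p = U₂ + k - fromℕ z ,
            linear (U₂ ∷ k ∷ fromℕ z ∷ []) (λ y k z → [] ⊢ y :+ k :≤ y :+ k :- z :+ z) tt ,
            linear (U₂ ∷ k ∷ fromℕ z ∷ r ∷ []) (λ y k z r → r :+ z :< y :+ k ∷ [] ⊢ r :≤ y :+ k :- z) (≰⇒> p) ,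
            linear (U₂ ∷ k ∷ fromℕ z ∷ V₂ ∷ x A ∷ []) (λ u k z v X → v :+ k :≤ X :+ z ∷ u :≤ v ∷ [] ⊢ u :+ k :- z :≤ X) (u′ , u₂) ,
            <5 v (linear (U₁ ∷ U₂ ∷ k ∷ fromℕ z ∷ ε ∷ r ∷ [])
              (λ u₁ u₂ k z ε h → u₁ :+ (u₂ :+ k) :< ε :+ (h :+ (h :+ z)) ∷ h :≤ u₁ ∷ [] ⊢ u₂ :+ k :- z :< h :+ ε)
              (upper′ , proj₂ (feasible-root ε ft′))) ,
            height-shift (ω̃ e) z g₂ ,
            linear (U₁ ∷ U₂ ∷ k ∷ fromℕ z ∷ ε ∷ r ∷ [])
              (λ u₁ u₂ k z ε h → u₁ :+ (u₂ :+ k) :< ε :+ (h :+ (h :+ z)) ∷ [] ⊢ u₁ :+ (u₂ :+ k :- z) :< ε :+ (h :+ h)) upper′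
          ... | yes p = r , p , ≤-refl , ≤-trans (proj₂ (feasible-root ε ft′)) (≤-trans u₁ u) ,
            <5 v (linear (r ∷ ε ∷ []) (λ r ε → # 0 :< ε ∷ [] ⊢ r :< r :+ ε) 0<ε) , height v ,
            linear (U₁ ∷ r ∷ ε ∷ []) (λ u r ε → u :< r :+ ε ∷ [] ⊢ u :+ r :< ε :+ (r :+ r)) b₁
          finish : ∀ {κ M i j} → κ ℕ.< 5 → κ ℕ.+ z ≡ ω̃ e ℕ.+ 2 → ChildEnd M → i ℕ.< suc A → x i ≈ U₁ → j ℕ.< suc A → x j ≈ M → L ≤ F′ A
          finish {κ} {M} {i} {j} κ<5 κ+z≡k+2 (Y≤M , r≤M , M≤ , M<5 , gM , fits) i<A xi≈ j<A xj≈ =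
            IsBest.complete (merged A<N) i<A j<A
              (<-resp (+-cong (sym xi≈) (sym xj≈)) refl fits ,
               linear (r ∷ fromℕ z ∷ k ∷ ε ∷ L₁ ∷ L₂ ∷ K i ∷ H j ∷ [])
                 (λ r z k ε l₁ l₂ K H → r :+ (r :+ z) :< ε :+ (l₁ :+ (l₂ :+ k)) ∷ l₁ :≤ K ∷ l₂ :+ k :≤ H :+ z ∷ []
                   ⊢ r :+ r :< ε :+ (K :+ H)) (lower′ , L₁≤K , L₂≤H))
              -- A lower end exceeds `h v − ε`, which is positive, so a genuine entry is never
              -- mistaken for the default 0.
              (linear (L₁ ∷ K i ∷ r ∷ ε ∷ [])
                (λ l f h ε → l :≤ f ∷ h :< l :+ ε ∷ # 2 :≤ h ∷ ε :< # 2 ∷ [] ⊢ # 0 :< f) (L₁≤K , a₁ , 2≤h v , ε<2))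
              (linear (r ∷ fromℕ z ∷ k ∷ ε ∷ L₁ ∷ L₂ ∷ H j ∷ [])
                (λ r z k ε l₁ l₂ H → r :+ (r :+ z) :< ε :+ (l₁ :+ (l₂ :+ k)) ∷ l₁ :≤ r ∷ l₂ :+ k :≤ H :+ z ∷
                  # 2 :≤ r ∷ ε :< # 2 ∷ [] ⊢ # 0 :< H)
                (lower′ , proj₁ (feasible-root ε ft′) , L₂≤H , 2≤h v , ε<2))
              (≤-trans l (≤-trans l₁ L₁≤K))
              (linear (L ∷ M₂ ∷ L₂ ∷ k ∷ fromℕ z ∷ H j ∷ [])
                (λ L m l k z H → L :+ z :≤ m :+ k ∷ m :≤ l ∷ l :+ k :≤ H :+ z ∷ [] ⊢ L :≤ H) (l′ , l₂ , L₂≤H))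
            where
            κ+z≈k+2 : fromℕ κ + fromℕ z ≈ k + fromℕ 2
            κ+z≈k+2 = trans (sym (fromℕ-+ κ z))
              (trans (≡-subst (λ q → fromℕ (κ ℕ.+ z) ≈ fromℕ q) κ+z≡k+2 refl) (fromℕ-+ (ω̃ e) 2))
            L₁≤K : L₁ ≤ K i
            L₁≤K = IsTable.complete tableᵗ (ℕ.<-≤-trans i<A A<N) (feasible-weaken ε ≤-refl (≈⇒≤ (sym xi≈)) ft′)
            j<N : j ℕ.< N
            j<N = ℕ.<-≤-trans j<A A<N
            U₂≤x : U₂ ≤ x (lowered j κ)
            U₂≤x = lowered-complete κ j<N (≤-trans (2≤h c) (proj₂ (feasible-root ε fs′))) (<5 c b₂)
              (linear (U₂ ∷ fromℕ κ ∷ fromℕ z ∷ k ∷ M ∷ x j ∷ [])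
                (λ u κ z k M xj → κ :+ z :≈ k :+ # 2 ∷ u :+ k :≤ M :+ z ∷ M :≈ xj ∷ [] ⊢ u :+ κ :≤ xj :+ # 2)
                (κ+z≈k+2 , Y≤M , sym xj≈))
            L₂≤F : L₂ ≤ F (lowered j κ)
            L₂≤F = IsTable.complete tableˢ (lowered< j κ) (feasible-weaken ε ≤-refl U₂≤x fs′)
            0<F : 0# < F (lowered j κ)
            0<F = linear (L₂ ∷ F (lowered j κ) ∷ h c ∷ ε ∷ [])
              (λ l f h ε → l :≤ f ∷ h :< l :+ ε ∷ # 2 :≤ h ∷ ε :< # 2 ∷ [] ⊢ # 0 :< f) (L₂≤F , a₂ , 2≤h c , ε<2)
            F≤H : F (lowered j κ) + fromℕ κ ≤ H j + fromℕ 2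
            F≤H = LiftedCell.complete (lifted j<N) κ<5 0<F
              (ℕ.≤-trans (ℕ.m≤n+m 2 (ω̃ e)) (ℕ.≤-reflexive (≡-sym κ+z≡k+2)))
            L₂≤H : L₂ + k ≤ H j + fromℕ z
            L₂≤H = linear (L₂ ∷ F (lowered j κ) ∷ H j ∷ fromℕ κ ∷ fromℕ z ∷ k ∷ [])
              (λ l f H κ z k → l :≤ f ∷ f :+ κ :≤ H :+ # 2 ∷ k :+ # 2 :≈ κ :+ z ∷ [] ⊢ l :+ k :≤ H :+ z)
              (L₂≤F , F≤H , sym κ+z≈k+2)
          located : ∀ {κ M i} → κ ℕ.< 5 → κ ℕ.+ z ≡ ω̃ e ℕ.+ 2 → ChildEnd M → i ℕ.< suc A → x i ≈ U₁ →
                    (∃ λ j → j ℕ.< suc A × x j ≈ M) → L ≤ F′ A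
          located κ<5 κ+z≡k+2 end i<A xi≈ (j , j<A , xj≈) = finish κ<5 κ+z≡k+2 end i<A xi≈ j<A xj≈
          conclude : ∀ {κ} → κ ℕ.< 5 → κ ℕ.+ z ≡ ω̃ e ℕ.+ 2 → ∃ ChildEnd → (∃ λ i → i ℕ.< suc A × x i ≈ U₁) → L ≤ F′ A
          conclude κ<5 κ+z≡k+2 (M , end@(_ , r≤M , M≤ , M<5 , gM , _)) (i , i<A , xi≈) =
            located κ<5 κ+z≡k+2 end i<A xi≈ (locate-below gM (≤-trans 0≤r r≤M) M<5 A<N M≤)
          shifted : (∃ λ κ → κ ℕ.< 5 × κ ℕ.+ z ≡ ω̃ e ℕ.+ 2) → L ≤ F′ A
          shifted (κ , κ<5 , κ+z≡k+2) = conclude κ<5 κ+z≡k+2 child-end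
            (locate-below g₁ (≤-trans 0≤r (proj₂ (feasible-root ε ft′))) (<5 v b₁) A<N (≤-trans u₁ u))

        graft-complete : ∀ {A ω̃ L} → A ℕ.< N → Feasible ε ω̃ (graft t e J z slope s) L (x A) → L ≤ F′ A
        graft-complete A<N (graft ft fs upper lower u u′ l l′) =
          tight-complete A<N (tighten 0<ε ft) (tighten 0<ε fs) upper lower u u′ l l′

        graft-table : IsTable (graft t e J z slope s) F′
        graft-table = record { nonneg = λ A<N → IsBest.nonneg (merged A<N) ; sound = graft-sound ; complete = graft-complete }

      -- Tightening brings the upper bound below 5, hence below `x last`, and the lower bound above
      -- 0, so the last entry alone settles feasibility.
      table-decides : ∀ {v F ω̃ L U} {t : Tree v} → IsTable t F → Feasible ε ω̃ t L U → 0# < F last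
      table-decides {v} {F} tb f with tighten 0<ε f
      ... | tight {L} {U} f′ _ _ a b _ =
        linear (L ∷ F last ∷ h v ∷ ε ∷ [])
          (λ l f h ε → l :≤ f ∷ h :< l :+ ε ∷ # 2 :≤ h ∷ ε :< # 2 ∷ [] ⊢ # 0 :< f)
          (IsTable.complete tb last< (feasible-weaken ε ≤-refl
             (linear (U ∷ h v ∷ ε ∷ x last ∷ []) (λ U h ε X → U :< h :+ ε ∷ h :< # 3 ∷ ε :< # 2 ∷ # 5 :≤ X ∷ [] ⊢ U :≤ X)
               (b , h<3 v , ε<2 , top)) f′) ,
           a , 2≤h v , ε<2)

-- Growing a spanning tree

unique-lookup : {A : Set} {xs : List A} → Unique xs → ∀ {i j} → lookup xs i ≡ lookup xs j → i ≡ j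
unique-lookup (p ∷ u) {zero}  {zero}  _  = ≡-refl
unique-lookup (p ∷ u) {zero}  {suc j} eq = ⊥-elim (All.lookup p (∈-lookup j) eq)
unique-lookup (p ∷ u) {suc i} {zero}  eq = ⊥-elim (All.lookup p (∈-lookup i) (≡-sym eq))
unique-lookup (p ∷ u) {suc i} {suc j} eq = ≡-cong suc (unique-lookup u eq)

unique-length : ∀ {k} {xs : List (Fin k)} → Unique xs → length xs ℕ.≤ k
unique-length u = Finₚ.injective⇒≤ (unique-lookup u)

covering-length : ∀ {k} {xs : List (Fin k)} → (∀ i → i ∈ xs) → k ℕ.≤ length xs
covering-length all =
  Finₚ.injective⇒≤ (λ {i} {j} → SetoidMembershipₚ.index-injective (≡-setoid _) (all i) (all j))

_∈?_ : ∀ {k} (i : Fin k) (xs : List (Fin k)) → Dec (i ∈ xs)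
_∈?_ = DecMembership._∈?_ Finₚ._≟_

module Exploration {n m : ℕ} {G : Graph n m} (root : Fin n) where
  open Walks {G = G}

  record Step : Set where
    constructor stepping
    field
      edge         : Fin m
      parent child : Fin n
      joins        : Joins G edge parent child

  open Step public

  reached : List Step → List (Fin n)
  reached []      = root ∷ []
  reached (s ∷ g) = child s ∷ reached g

  used : List Step → List (Fin m)
  used = map edge

  -- The newest step stands at the head. Its child is the parent of no other step, so undoing steps
  -- from the head always removes a leaf.
  data Valid : List Step → Set where
    []  : Valid []
    _∷_ : ∀ {s g} → parent s ∈ reached g × child s ∉ reached g → Valid g → Valid (s ∷ g)

  reached-unique : ∀ {g} → Valid g → Unique (reached g)
  reached-unique []             = [] ∷ []
  reached-unique ((_ , c∉) ∷ v) = Allₚ.¬Any⇒All¬ _ c∉ ∷ reached-unique v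

  length-reached : ∀ g → length (reached g) ≡ suc (length g)
  length-reached []      = ≡-refl
  length-reached (s ∷ g) = ≡-cong suc (length-reached g)

  used-reached : ∀ {g e u w} → Valid g → e ∈ used g → Joins G e u w → w ∈ reached g
  used-reached {s ∷ g} ((p∈ , _) ∷ v) (here ≡-refl) J with joins-unique {e = edge s} J (joins s)
  ... | inj₁ (≡-refl , ≡-refl) = here ≡-refl
  ... | inj₂ (≡-refl , ≡-refl) = there p∈
  used-reached (_ ∷ v) (there e∈) J = there (used-reached v e∈ J)

  used-unique : ∀ {g} → Valid g → Unique (used g)
  used-unique [] = []
  used-unique {s ∷ g} ((_ , c∉) ∷ v) = Allₚ.¬Any⇒All¬ _ (λ e∈ → c∉ (used-reached v e∈ (joins s))) ∷ used-unique v

  reached-bound : ∀ {g} → Valid g → suc (length g) ℕ.≤ n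
  reached-bound {g} v = ≡-subst (ℕ._≤ n) (length-reached g) (unique-length (reached-unique v))

  used-bound : ∀ {g} → Valid g → length g ℕ.≤ m
  used-bound {g} v = ≡-subst (ℕ._≤ m) (length-map edge g) (unique-length (used-unique v))

  step-reached : ∀ {g s} → Valid g → s ∈ g → parent s ∈ reached g × child s ∈ reached g
  step-reached ((p∈ , _) ∷ v) (here ≡-refl) = there p∈ , here ≡-refl
  step-reached (_ ∷ v)        (there s∈)    = let p , q = step-reached v s∈ in there p , there q

  SimplePath : List Step → Fin n → Fin n → Set
  SimplePath g u w = ∃ λ (π : Walk G u w) → Simple π × All (_∈ reached g) (vertices π) × All (_∈ used g) (edges π)

  path : ∀ {g u w} → Valid g → u ∈ reached g → w ∈ reached g → SimplePath g u w
  path {[]} [] (here ≡-refl) (here ≡-refl) = stop , [] ∷ [] , here ≡-refl ∷ [] , []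
  path {s ∷ g} ((p∈ , c∉) ∷ v) (here ≡-refl) (here ≡-refl) = stop , [] ∷ [] , here ≡-refl ∷ [] , []
  path {s ∷ g} ((p∈ , c∉) ∷ v) (here ≡-refl) (there w∈) with path v p∈ w∈
  ... | π , simple , vs , es =
    step (edge s) (joins-sym {e = edge s} (joins s)) π , All.map (λ { x∈ ≡-refl → c∉ x∈ }) vs ∷ simple ,
    here ≡-refl ∷ All.map there vs , here ≡-refl ∷ All.map there es
  path {s ∷ g} ((p∈ , c∉) ∷ v) (there u∈) (here ≡-refl) with path v u∈ p∈
  ... | π , simple , vs , es =
    connect π (joins s) stop ,
    simple-connect π (joins s) stop simple ([] ∷ []) (λ { x∈ (here ≡-refl) → c∉ (All.lookup vs x∈) }) ,
    ≡-subst (All _) (≡-sym (vertices-connect π (joins s) stop)) (Allₚ.++⁺ (All.map there vs) (here ≡-refl ∷ [])) ,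
    ≡-subst (All _) (≡-sym (edges-connect π (joins s) stop)) (Allₚ.++⁺ (All.map there es) (here ≡-refl ∷ []))
  path {s ∷ g} (_ ∷ v) (there u∈) (there w∈) with path v u∈ w∈
  ... | π , simple , vs , es = π , simple , All.map there vs , All.map there es

  Closed : List Step → Set
  Closed g = ∀ e {u w} → Joins G e u w → u ∈ reached g → w ∉ reached g → ⊥

  module _ (tree : IsTree G) where

    -- Otherwise the edge would close the explored path between its ends to a cycle.
    joined-used : ∀ {g e u w} → Valid g → Joins G e u w → u ∈ reached g → w ∈ reached g → e ∈ used g
    joined-used {g} {e} v J u∈ w∈ with e ∈? used g | path v u∈ w∈
    ... | yes e∈ | _ = e∈
    ... | no e∉ | π , simple , _ , es = ⊥-elim (IsTree.acyclic tree (record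
      { path = π ; isSimple = simple ; edge = e ; closes = joins-sym {e = e} J ; newEdge = λ e∈ → e∉ (All.lookup es e∈) }))

    walk-reached : ∀ {g} → Closed g → ∀ {u w} → Walk G u w → u ∈ reached g → w ∈ reached g
    walk-reached closed stop u∈ = u∈
    walk-reached {g} closed (step {v = x} e J π) u∈ with x ∈? reached g
    ... | yes x∈ = walk-reached closed π x∈
    ... | no x∉  = ⊥-elim (closed e J u∈ x∉)

    root∈ : ∀ g → root ∈ reached g
    root∈ []      = here ≡-refl
    root∈ (s ∷ g) = there (root∈ g)

    closed-reached : ∀ {g} → Closed g → ∀ v → v ∈ reached g
    closed-reached {g} closed v = walk-reached closed (IsTree.connected tree root v) (root∈ g)

    all-used : ∀ {g} → Valid g → (∀ v → v ∈ reached g) → ∀ e → e ∈ used g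
    all-used v all e = joined-used v (inj₁ ≡-refl) (all _) (all _)

    -- By connectedness a closed exploration reaches every vertex, and by acyclicity it uses every
    -- edge. Read backwards, an exploration with fewer than `m` steps can be continued.
    closed-length : ∀ {g} → Valid g → Closed g → m ℕ.≤ length g
    closed-length {g} v closed =
      ≡-subst (m ℕ.≤_) (length-map edge g) (covering-length (all-used v (closed-reached closed)))

    -- An edge leaving after `m` steps would give a valid exploration with more than `m` distinct
    -- edges.
    complete-closed : ∀ {g} → Valid g → m ℕ.≤ length g → Closed g
    complete-closed v m≤ e J u∈ w∉ = ℕ.<⇒≱ (ℕ.s≤s m≤) (used-bound (_∷_ {s = stepping e _ _ J} (u∈ , w∉) v))

-- Pruning the tree

module Forests (ℝ : Reals) {n m : ℕ} {G : Graph n m} (root : Fin n)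
               (ω : Fin m → Reals.Carrier ℝ) (h : Fin n → Reals.Carrier ℝ) where
  open Reals ℝ using (_≈_; _+_; fromℕ)
  open Exploration {G = G} root
  open GraftedTrees ℝ G ω h

  Slope : Step → ℕ → Set
  Slope s z = h (child s) + ω (edge s) ≈ h (parent s) + fromℕ z

  Forest : Set
  Forest = ∀ v → Tree v

  plant : Forest → ∀ s z → Slope s z → Forest
  plant T s z slope v with v Finₚ.≟ parent s
  ... | yes ≡-refl = graft (T v) (edge s) (joins s) z slope (T (child s))
  ... | no  _      = T v

  plant-parent : ∀ T s z slope → plant T s z slope (parent s) ≡ graft (T (parent s)) (edge s) (joins s) z slope (T (child s))
  plant-parent T s z slope with parent s Finₚ.≟ parent s
  ... | yes ≡-refl = ≡-refl
  ... | no  p≢p    = ⊥-elim (p≢p ≡-refl)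

  plant-other : ∀ T s z slope {v} → v ≢ parent s → plant T s z slope v ≡ T v
  plant-other T s z slope {v} v≢p with v Finₚ.≟ parent s
  ... | yes v≡p = ⊥-elim (v≢p v≡p)
  ... | no  _   = ≡-refl

  -- The trees hanging from the vertices explored so far, once the steps taken
  -- after that have been undone.
  record Spans (g : List Step) (T : Forest) : Set where
    field
      proper   : ∀ {v} → v ∈ reached g → Proper (T v)
      disjoint : ∀ {v w x} → v ∈ reached g → w ∈ reached g → v ≢ w → Vertex (T v) x → Vertex (T w) x → ⊥
      covers   : ∀ x → ∃ λ v → v ∈ reached g × Vertex (T v) x
      accounts : ∀ e → e ∈ used g ⊎ ∃ λ v → v ∈ reached g × Edge (T v) e

  spans-single : ∀ {g} → (∀ v → v ∈ reached g) → (∀ e → e ∈ used g) → Spans g single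
  spans-single all all′ = record
    { proper   = λ _ → tt
    ; disjoint = λ { _ _ v≢w ≡-refl ≡-refl → v≢w ≡-refl }
    ; covers   = λ x → x , all x , ≡-refl
    ; accounts = λ e → inj₁ (all′ e)
    }

  -- The child drops out of `reached` in the same move that hangs its tree below the parent, so its
  -- vertices and edges are still counted exactly once.
  spans-plant : ∀ {s g T} → Valid (s ∷ g) → Spans (s ∷ g) T → ∀ z slope → Spans g (plant T s z slope)
  spans-plant {s} {g} {T} ((p∈ , c∉) ∷ valid) F z slope = record
    { proper = proper′ ; disjoint = disjoint′ ; covers = covers′ ; accounts = accounts′ }
    where
    open Spans F
    T′ : Forest
    T′ = plant T s z slope
    p≢c : parent s ≢ child s
    p≢c eq = c∉ (≡-subst (_∈ reached g) eq p∈)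
    proper′ : ∀ {v} → v ∈ reached g → Proper (T′ v)
    proper′ {v} v∈ with v Finₚ.≟ parent s
    ... | yes ≡-refl = proper (there v∈) , proper (here ≡-refl) , disjoint (there v∈) (here ≡-refl) p≢c
    ... | no  _      = proper (there v∈)
    source : ∀ {v x} → Vertex (T′ v) x → Vertex (T v) x ⊎ (v ≡ parent s × Vertex (T (child s)) x)
    source {v} x∈ with v Finₚ.≟ parent s
    source (inj₁ x∈) | yes ≡-refl = inj₁ x∈
    source (inj₂ x∈) | yes ≡-refl = inj₂ (≡-refl , x∈)
    source x∈        | no  _      = inj₁ x∈
    ≢child : ∀ {v} → v ∈ reached g → v ≢ child s
    ≢child v∈ ≡-refl = c∉ v∈
    disjoint′ : ∀ {v w x} → v ∈ reached g → w ∈ reached g → v ≢ w → Vertex (T′ v) x → Vertex (T′ w) x → ⊥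
    disjoint′ v∈ w∈ v≢w x∈v x∈w with source x∈v | source x∈w
    ... | inj₁ a            | inj₁ b            = disjoint (there v∈) (there w∈) v≢w a b
    ... | inj₁ a            | inj₂ (_ , b)      = disjoint (there v∈) (here ≡-refl) (≢child v∈) a b
    ... | inj₂ (_ , a)      | inj₁ b            = disjoint (here ≡-refl) (there w∈) (λ eq → ≢child w∈ (≡-sym eq)) a b
    ... | inj₂ (≡-refl , _) | inj₂ (≡-refl , _) = v≢w ≡-refl
    kept : (P : ∀ {v} → Tree v → Set) → (∀ {v c t e J z slope} {u : Tree c} → P {v} t → P (graft t e J z slope u)) → ∀ {v} → P (T v) → P (T′ v)
    kept P lift {v} p with v Finₚ.≟ parent s
    ... | yes ≡-refl = lift p
    ... | no  _      = p
    moved : (P : ∀ {v} → Tree v → Set) → P (graft (T (parent s)) (edge s) (joins s) z slope (T (child s))) → P (T′ (parent s))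
    moved P p = ≡-subst P (≡-sym (plant-parent T s z slope)) p
    covers′ : ∀ x → ∃ λ v → v ∈ reached g × Vertex (T′ v) x
    covers′ x with covers x
    ... | v , there v∈ , x∈          = v , v∈ , kept (λ t → Vertex t x) inj₁ x∈
    ... | _ , here ≡-refl , x∈       = parent s , p∈ , moved (λ t → Vertex t x) (inj₂ x∈)
    accounts′ : ∀ e → e ∈ used g ⊎ ∃ λ v → v ∈ reached g × Edge (T′ v) e
    accounts′ e with accounts e
    ... | inj₁ (here ≡-refl)            = inj₂ (parent s , p∈ , moved (λ t → Edge t e) (inj₂ (inj₁ ≡-refl)))
    ... | inj₁ (there e∈)               = inj₁ e∈
    ... | inj₂ (v , there v∈ , e∈)      = inj₂ (v , v∈ , kept (λ t → Edge t e) inj₁ e∈)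
    ... | inj₂ (_ , here ≡-refl , e∈)   = inj₂ (parent s , p∈ , moved (λ t → Edge t e) (inj₂ (inj₂ e∈)))

-- The exploration program

-- ℕ variables: 0 order, 1 number of edges, 2 round, 3 edge index or table index,
-- 4 parent, 5 child, 6 edge, 7 shift, 8 and 9 the two pointers, 10 iteration, 11 candidate.
-- ℝ variables: 0 ε, 1 height of the parent, 2 slope, 3 entry of the child's table, 4 best value.
-- ℕ arrays: 0 and 1 ends of edges, 2 explored vertices, 3 parents, 4 children, 5 edges by round.
-- ℝ arrays: 0 weights, 1 candidates, 2 heights, 3 tables, 4 copy of the parent's table, 5 lifted table.

leaves : Name → Name → BExp
leaves a b = (2 at (a at var 3)) `≡ lit 1 `∧ (2 at (b at var 3)) `≡ lit 0

record-ends : Name → Name → Code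
record-ends a b = set 4 (a at var 3) ▸ set 5 (b at var 3) ▸ set 6 (var 3)

-- Every round scans all the edges and does not stop at a success, so the number of turns depends on
-- the size alone, and no adjacency lists are required within quadratic time. Marks in array 2 are 0
-- or 1. The fraction kept in array 1 becomes a candidate; adding 2 to it gives the height.
scanBody scan extend round explore : Code
scanBody =
  cond (leaves 0 1) (record-ends 0 1) (cond (leaves 1 0) (record-ends 1 0) nop)
scan  = loop 3 edgeCount scanBody
round = scan ▸ extend
extend =
  put 3 (var 2) (var 4) ▸ put 4 (var 2) (var 5) ▸ put 5 (var 2) (var 6) ▸
  put 2 (var 5) (lit 1) ▸
  setᴿ 1 ((2 atᴿ var 4) `-ᴿ (0 atᴿ var 6)) ▸
  putᴿ 1 (var 5) (varᴿ 1 `-ᴿ `floor (varᴿ 1)) ▸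
  putᴿ 2 (var 5) ((1 atᴿ var 5) `+ᴿ cast (lit 2))
explore = put 2 (lit 0) (lit 1) ▸ putᴿ 2 (lit 0) (cast (lit 2)) ▸ loop 2 edgeCount round

inputCells exploredCells : Cells
inputCells    = (ℕ-var , 0) ∷ (ℕ-var , 1) ∷ (ℝ-var , 0) ∷ (ℕ-array , 0) ∷ (ℕ-array , 1) ∷ (ℝ-array , 0) ∷ []
exploredCells = (ℕ-array , 2) ∷ (ℕ-array , 3) ∷ (ℕ-array , 4) ∷ (ℕ-array , 5) ∷ (ℝ-array , 1) ∷ (ℝ-array , 2) ∷ []

≡ᵇ-true : ∀ {i j} → (i ≡ᵇ j) ≡ true → i ≡ j
≡ᵇ-true {i} {j} e = ℕ.≡ᵇ⇒≡ i j (≡true⇒T e)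

module Programs (ℝ : Reals) {n m : ℕ} (G : Graph n m) (ω : Fin m → Reals.Carrier ℝ) (ε : Reals.Carrier ℝ) where
  open Reals ℝ using (Carrier; _≈_; _<_; _≤_; _+_; _-_; -_; 0#; 1#; fromℕ; fromℤ; floor; floor-lower; floor-upper; refl; sym; trans; +-identityʳ)
  open OrderedFieldProperties ℝ
  open Execution {ℝ}
  open State
  open Graph G

  record Input (σ : State ℝ) : Set where
    field
      order    : nvar σ 0 ≡ n
      size     : nvar σ 1 ≡ m
      bound    : rvar σ 0 ≡ ε
      source   : ∀ e → narr σ 0 (toℕ e) ≡ toℕ (proj₁ (ends e))
      target   : ∀ e → narr σ 1 (toℕ e) ≡ toℕ (proj₂ (ends e))
      weights  : ∀ e → rarr σ 0 (toℕ e) ≡ ω e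

  input-kept : ∀ c {σ} → keepsAll inputCells c ≡ true → Input σ → Input (exec c σ)
  input-kept c {σ} k i with frame-all inputCells c σ k
  ... | n≡ , m≡ , ε≡ , A≡ , B≡ , ω≡ , _ = record
    { order   = ≡-trans n≡ order
    ; size    = ≡-trans m≡ size
    ; bound   = ≡-trans ε≡ bound
    ; source  = λ e → ≡-trans (≡-cong (λ f → f (toℕ e)) A≡) (source e)
    ; target  = λ e → ≡-trans (≡-cong (λ f → f (toℕ e)) B≡) (target e)
    ; weights = λ e → ≡-trans (≡-cong (λ f → f (toℕ e)) ω≡) (weights e)
    }
    where open Input i

  padded-toℕ : ∀ {A : Set} {k} (d : A) (f : Fin k → A) i → padded d f (toℕ i) ≡ f i
  padded-toℕ {k = k} d f i with toℕ i ℕ.<? k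
  ... | yes p = ≡-cong f (Finₚ.fromℕ<-toℕ i p)
  ... | no ¬p = ⊥-elim (¬p (Finₚ.toℕ<n i))

  input-initial : Input (input {ℝ} G ω ε)
  input-initial = record
    { order = ≡-refl ; size = ≡-refl ; bound = ≡-refl
    ; source = padded-toℕ 0 _ ; target = padded-toℕ 0 _ ; weights = padded-toℕ 0# ω }

  one : fromℕ 1 ≈ 1#
  one = +-identityʳ 1#

  module Exploring (tree : IsTree G) (root : Fin n) (root≡0 : toℕ root ≡ 0) (0≤ω : ∀ e → 0# ≤ ω e) where
    open Exploration {G = G} root

    Marks : (ℕ → ℕ) → List Step → Set
    Marks f g = ∀ v → (v ∈ reached g × f (toℕ v) ≡ 1) ⊎ (v ∉ reached g × f (toℕ v) ≡ 0)

    marked : ∀ f g {v} → Marks f g → f (toℕ v) ≡ 1 → v ∈ reached g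
    marked f g {v} marks eq with marks v
    ... | inj₁ (v∈ , _) = v∈
    ... | inj₂ (_ , eq′) with ≡-trans (≡-sym eq) eq′
    ...   | ()

    unmarked : ∀ f g {v} → Marks f g → f (toℕ v) ≡ 0 → v ∉ reached g
    unmarked f g {v} marks eq with marks v
    ... | inj₂ (v∉ , _) = v∉
    ... | inj₁ (_ , eq′) with ≡-trans (≡-sym eq) eq′
    ...   | ()

    crossing-test : ∀ f g {u w} → Marks f g → u ∈ reached g → w ∉ reached g →
                    ((f (toℕ u) ≡ᵇ 1) ∧ (f (toℕ w) ≡ᵇ 0)) ≡ true
    crossing-test f g {u} {w} marks u∈ w∉ with marks u | marks w
    ... | inj₂ (u∉ , _) | _             = ⊥-elim (u∉ u∈)
    ... | inj₁ _        | inj₁ (w∈ , _) = ⊥-elim (w∉ w∈)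
    ... | inj₁ (_ , p)  | inj₂ (_ , q) rewrite p | q = ≡-refl

    module _ (g : List Step) (valid : Valid g) (unfinished : length g ℕ.< m) where

      Crosses : Fin m → Set
      Crosses e = ∃₂ λ u w → Joins G e u w × u ∈ reached g × w ∉ reached g

      Found : State ℝ → Set
      Found σ = ∃ λ s → parent s ∈ reached g × child s ∉ reached g ×
                nvar σ 4 ≡ toℕ (parent s) × nvar σ 5 ≡ toℕ (child s) × nvar σ 6 ≡ toℕ (edge s)

      -- A later crossing edge may overwrite an earlier one; any of them extends the tree.
      record Scanned (j : ℕ) (σ : State ℝ) : Set where
        constructor scanned
        field
          isInput : Input σ
          marks   : Marks (narr σ 2) g
          result  : Found σ ⊎ (∀ e → toℕ e ℕ.< j → ¬ Crosses e)

      scan-step : ∀ j τ → j ℕ.< m → nvar τ 3 ≡ j → Scanned j τ →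
                  Scanned (suc j) (exec (set 3 (increment 3)) (exec scanBody τ))
      scan-step j τ j<m 3≡j (scanned i marks result) =
        scanned (input-kept (set 3 (increment 3)) ≡-refl (input-kept scanBody ≡-refl i))
                (≡-subst (λ f → Marks f g) (≡-sym (frame ℕ-array 2 (scanBody ▸ set 3 (increment 3)) τ ≡-refl)) marks)
                outcome
        where
        open Input i
        e : Fin m
        e = fromℕ< j<m
        3≡e : nvar τ 3 ≡ toℕ e
        3≡e = ≡-trans 3≡j (≡-sym (Finₚ.toℕ-fromℕ< j<m))
        u w : Fin n
        u = proj₁ (ends e)
        w = proj₂ (ends e)
        A≡u : narr τ 0 (nvar τ 3) ≡ toℕ u
        A≡u = ≡-trans (≡-cong (narr τ 0) 3≡e) (source e)
        B≡w : narr τ 1 (nvar τ 3) ≡ toℕ w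
        B≡w = ≡-trans (≡-cong (narr τ 1) 3≡e) (target e)
        Goal : State ℝ → Set
        Goal σ = Found (exec (set 3 (increment 3)) σ) ⊎ (∀ e → toℕ e ℕ.< suc j → ¬ Crosses e)
        split-test : ∀ {a b} → ((narr τ 2 a ≡ᵇ 1) ∧ (narr τ 2 b ≡ᵇ 0)) ≡ true → narr τ 2 a ≡ 1 × narr τ 2 b ≡ 0
        split-test {a} {b} p = let q , r = ∧-true {narr τ 2 a ≡ᵇ 1} p in ≡ᵇ-true q , ≡ᵇ-true r
        outcome : Goal (exec scanBody τ)
        outcome = cond-rule Goal (leaves 0 1) (record-ends 0 1) (cond (leaves 1 0) (record-ends 1 0) nop) τ
          (λ p → let q , r = split-test p in
            inj₁ (stepping e u w (inj₁ ≡-refl) ,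
                  marked (narr τ 2) g marks (≡-trans (≡-cong (narr τ 2) (≡-sym A≡u)) q) ,
                  unmarked (narr τ 2) g marks (≡-trans (≡-cong (narr τ 2) (≡-sym B≡w)) r) , A≡u , B≡w , 3≡e))
          (λ p → cond-rule Goal (leaves 1 0) (record-ends 1 0) nop τ
            (λ p → let q , r = split-test p in
              inj₁ (stepping e w u (inj₂ ≡-refl) ,
                    marked (narr τ 2) g marks (≡-trans (≡-cong (narr τ 2) (≡-sym B≡w)) q) ,
                    unmarked (narr τ 2) g marks (≡-trans (≡-cong (narr τ 2) (≡-sym A≡u)) r) , B≡w , A≡u , 3≡e))
            (λ p′ → unchanged p p′ result))
          where
          no-crossing : (test-u : ((narr τ 2 (narr τ 0 (nvar τ 3)) ≡ᵇ 1) ∧ (narr τ 2 (narr τ 1 (nvar τ 3)) ≡ᵇ 0)) ≡ false) →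
                        (test-w : ((narr τ 2 (narr τ 1 (nvar τ 3)) ≡ᵇ 1) ∧ (narr τ 2 (narr τ 0 (nvar τ 3)) ≡ᵇ 0)) ≡ false) → ¬ Crosses e
          no-crossing tu tw (_ , _ , inj₁ ≡-refl , a∈ , b∉) rewrite A≡u | B≡w with ≡-trans (≡-sym tu) (crossing-test (narr τ 2) g marks a∈ b∉)
          ... | ()
          no-crossing tu tw (_ , _ , inj₂ ≡-refl , a∈ , b∉) rewrite A≡u | B≡w with ≡-trans (≡-sym tw) (crossing-test (narr τ 2) g marks a∈ b∉)
          ... | ()
          unchanged : _ → _ → Found τ ⊎ (∀ e → toℕ e ℕ.< j → ¬ Crosses e) → Goal τ
          unchanged p p′ (inj₁ found) = inj₁ found
          unchanged p p′ (inj₂ none)  = inj₂ λ e′ e′≤j → [ none e′ , (λ eq → ≡-subst (λ f → ¬ Crosses f)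
            (Finₚ.toℕ-injective (≡-trans (Finₚ.toℕ-fromℕ< j<m) (≡-sym eq))) (no-crossing p p′)) ]′ (ℕ.m≤n⇒m<n∨m≡n (ℕ.≤-pred e′≤j))

      -- A scan without result shows that no edge leaves the explored part, which by `closed-length`
      -- contradicts the number of steps made.
      scan-finds : ∀ {σ} → Input σ → Marks (narr σ 2) g → Found (exec scan σ)
      scan-finds {σ} i marks = conclude (loop-rule Scanned 3 edgeCount scanBody σ ≡-refl
          (scanned (input-kept (set 3 (lit 0)) ≡-refl i) marks (inj₂ λ _ ()))
          (λ j τ j< → scan-step j τ (≡-subst (j ℕ.<_) (Input.size i) j<)))
        where
        conclude : Scanned (nvar σ 1) (exec scan σ) → Found (exec scan σ)
        conclude (scanned _ _ (inj₁ found)) = found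
        conclude (scanned _ _ (inj₂ none))  = ⊥-elim (ℕ.<⇒≱ unfinished (closed-length tree valid
          (λ e J u∈ w∉ → none e (≡-subst (toℕ e ℕ.<_) (≡-sym (Input.size i)) (Finₚ.toℕ<n e)) (_ , _ , J , u∈ , w∉))))

    Recorded : (Step → ℕ) → (ℕ → ℕ) → List Step → Set
    Recorded q f []      = ⊤
    Recorded q f (s ∷ g) = f (length g) ≡ q s × Recorded q f g

    recorded-update : ∀ q f g {i a} → length g ℕ.≤ i → Recorded q f g → Recorded q (update f i a) g
    recorded-update q f []      _   _        = tt
    recorded-update q f (s ∷ g) {i} g<i (eq , r) =
      ≡-trans (update-miss f {i} _ (λ { ≡-refl → ℕ.<-irrefl ≡-refl g<i })) eq , recorded-update q f g (ℕ.<⇒≤ g<i) r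

    HeightOf : (x h : ℕ → Carrier) → Fin n → Set
    HeightOf x h v = 0# ≤ x (toℕ v) × x (toℕ v) < fromℕ 1 × h (toℕ v) ≈ x (toℕ v) + fromℕ 2

    SlopeOf : (ℕ → Carrier) → Step → Set
    SlopeOf h s = ∃ λ z → h (toℕ (child s)) + ω (edge s) ≈ h (toℕ (parent s)) + fromℕ z

    record Explored (g : List Step) (f P C E : ℕ → ℕ) (x h : ℕ → Carrier) : Set where
      constructor explored
      field
        valid    : Valid g
        marks    : Marks f g
        parents  : Recorded (λ s → toℕ (parent s)) P g
        children : Recorded (λ s → toℕ (child s)) C g
        edges′   : Recorded (λ s → toℕ (edge s)) E g
        heights  : ∀ {v} → v ∈ reached g → HeightOf x h v
        slopes   : All (SlopeOf h) g

    explored-resp : ∀ {g f f′ P P′ C C′ E E′ x x′ h h′} → f ≡ f′ → P ≡ P′ → C ≡ C′ → E ≡ E′ → x ≡ x′ → h ≡ h′ →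
                    Explored g f P C E x h → Explored g f′ P′ C′ E′ x′ h′
    explored-resp ≡-refl ≡-refl ≡-refl ≡-refl ≡-refl ≡-refl e = e

    fraction : Carrier → Carrier
    fraction y = y - fromℤ (floor y)

    fraction-nonneg : ∀ y → 0# ≤ fraction y
    fraction-nonneg y = linear (y ∷ fromℤ (floor y) ∷ []) (λ y f → f :≤ y ∷ [] ⊢ # 0 :≤ y :- f) (floor-lower y)

    fraction<1 : ∀ y → fraction y < fromℕ 1
    fraction<1 y = linear (y ∷ fromℤ (floor y) ∷ 1# ∷ []) (λ y f o → y :< f :+ o ∷ o :≈ # 1 ∷ [] ⊢ y :- f :< # 1)
      (floor-upper y , sym one)

    -- With `y` the parent's height minus the weight, the child's height is `y − floor y + 2`, so
    -- the slope is `2 − floor y`. This is a natural number because `y` is below 3.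
    floor-complement : ∀ y → y < fromℕ 3 → ∃ λ z → fromℕ z + fromℤ (floor y) ≈ fromℕ 2
    floor-complement y y<3 = go (floor y) (≤-<-trans (floor-lower y) y<3)
      where
      go : ∀ i → fromℤ i < fromℕ 3 → ∃ λ z → fromℕ z + fromℤ i ≈ fromℕ 2
      go (+ k) k<3 = 2 ∸ k , trans (sym (fromℕ-+ (2 ∸ k) k))
        (fromℕ-cong {2 ∸ k ℕ.+ k} {2} (ℕ.m∸n+n≡m {2} {k} (ℕ.≤-pred (fromℕ-cancel-< {k} {3} k<3))))
      go -[1+ k ] _ = suc k ℕ.+ 2 ,
        linear (fromℕ (suc k ℕ.+ 2) ∷ fromℕ (suc k) ∷ (- fromℕ (suc k)) ∷ [])
          (λ a b c → a :≈ b :+ # 2 ∷ b :+ c :≈ # 0 ∷ [] ⊢ a :+ c :≈ # 2)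
          (fromℕ-+ (suc k) 2 , Reals.-‿inverseʳ ℝ (fromℕ (suc k)))

    height<3 : ∀ {x h v} → HeightOf x h v → h (toℕ v) < fromℕ 3
    height<3 {x} {h} {v} (_ , x<1 , h≈) = linear (x (toℕ v) ∷ h (toℕ v) ∷ [])
      (λ x h → x :< # 1 ∷ h :≈ x :+ # 2 ∷ [] ⊢ h :< # 3) (x<1 , h≈)

    height≥2 : ∀ {x h v} → HeightOf x h v → fromℕ 2 ≤ h (toℕ v)
    height≥2 {x} {h} {v} (0≤x , _ , h≈) = linear (x (toℕ v) ∷ h (toℕ v) ∷ [])
      (λ x h → # 0 :≤ x ∷ x :+ # 2 :≈ h ∷ [] ⊢ # 2 :≤ h) (0≤x , sym h≈)

    explore-step : ∀ {g f P C E x h} (s : Step) → parent s ∈ reached g → child s ∉ reached g → Explored g f P C E x h →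
      let c = toℕ (child s) ; x′ = update x c (fraction (h (toℕ (parent s)) - ω (edge s))) in
      Explored (s ∷ g) (update f c 1) (update P (length g) (toℕ (parent s))) (update C (length g) c)
        (update E (length g) (toℕ (edge s))) x′ (update h c (x′ c + fromℕ 2))
    explore-step {g} {f} {P} {C} {E} {x} {h} s p∈ c∉ (explored valid marks parents children edges′ heights slopes) = explored
      ((p∈ , c∉) ∷ valid)
      marks′
      (update-hit P _ ≡-refl , recorded-update _ P g ℕ.≤-refl parents)
      (update-hit C _ ≡-refl , recorded-update _ C g ℕ.≤-refl children)
      (update-hit E _ ≡-refl , recorded-update _ E g ℕ.≤-refl edges′)
      (λ { (here ≡-refl) → height-new ; (there v∈) → height-old v∈ })
      (slope-new ∷ All.tabulate (λ {s′} s′∈ → slope-old s′∈ (All.lookup slopes s′∈)))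
      where
      c : ℕ
      c = toℕ (child s)
      y : Carrier
      y = h (toℕ (parent s)) - ω (edge s)
      x′ h′ : ℕ → Carrier
      x′ = update x c (fraction y)
      h′ = update h c (x′ c + fromℕ 2)
      miss : ∀ {A : Set} (f : ℕ → A) {a v} → v ≢ child s → update f c a (toℕ v) ≡ f (toℕ v)
      miss f v≢c = update-miss f _ (λ eq → v≢c (≡-sym (Finₚ.toℕ-injective eq)))
      old≢ : ∀ {v} → v ∈ reached g → v ≢ child s
      old≢ v∈ ≡-refl = c∉ v∈
      marks′ : Marks (update f c 1) (s ∷ g)
      marks′ v with v Finₚ.≟ child s | marks v
      ... | yes ≡-refl | _              = inj₁ (here ≡-refl , update-hit f 1 ≡-refl)
      ... | no v≢c     | inj₁ (v∈ , eq) = inj₁ (there v∈ , ≡-trans (miss f v≢c) eq)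
      ... | no v≢c     | inj₂ (v∉ , eq) = inj₂ ((λ { (here v≡c) → v≢c v≡c ; (there v∈) → v∉ v∈ }) , ≡-trans (miss f v≢c) eq)
      x′c : x′ c ≡ fraction y
      x′c = update-hit x _ ≡-refl
      h′c : h′ c ≡ x′ c + fromℕ 2
      h′c = update-hit h _ ≡-refl
      height-new : HeightOf x′ h′ (child s)
      height-new rewrite h′c | x′c = fraction-nonneg y , fraction<1 y , refl
      height-old : ∀ {v} → v ∈ reached g → HeightOf x′ h′ v
      height-old v∈ rewrite miss x {fraction y} (old≢ v∈) | miss h {x′ c + fromℕ 2} (old≢ v∈) = heights v∈
      slope-new : SlopeOf h′ s
      slope-new with floor-complement y (linear (h (toℕ (parent s)) ∷ ω (edge s) ∷ [])
        (λ h w → h :< # 3 ∷ # 0 :≤ w ∷ [] ⊢ h :- w :< # 3) (height<3 {x} {h} (heights p∈) , 0≤ω (edge s)))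
      ... | z , eq = z , sloped
        where
        sloped : h′ c + ω (edge s) ≈ h′ (toℕ (parent s)) + fromℕ z
        sloped = linear (h′ c ∷ h′ (toℕ (parent s)) ∷ h (toℕ (parent s)) ∷ ω (edge s) ∷ fromℤ (floor y) ∷ fromℕ z ∷ [])
          (λ hc hp h w f z → hc :≈ h :- w :- f :+ # 2 ∷ h :≈ hp ∷ # 2 :≈ z :+ f ∷ [] ⊢ hc :+ w :≈ hp :+ z)
          (Reals.reflexive ℝ (≡-trans h′c (≡-cong (_+ fromℕ 2) x′c)) ,
           Reals.reflexive ℝ (≡-sym (miss h (old≢ p∈))) , sym eq)
      slope-old : ∀ {s′} → s′ ∈ g → SlopeOf h s′ → SlopeOf h′ s′
      slope-old {s′} s′∈ (z , eq) = z , sloped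
        where
        sloped : h′ (toℕ (child s′)) + ω (edge s′) ≈ h′ (toℕ (parent s′)) + fromℕ z
        sloped rewrite miss h {x′ c + fromℕ 2} (old≢ (proj₂ (step-reached valid s′∈))) | miss h {x′ c + fromℕ 2} (old≢ (proj₁ (step-reached valid s′∈))) = eq

    ExploredIn : List Step → State ℝ → Set
    ExploredIn g σ = Explored g (narr σ 2) (narr σ 3) (narr σ 4) (narr σ 5) (rarr σ 1) (rarr σ 2)

    explored-frame : ∀ c {g} σ → keepsAll exploredCells c ≡ true → ExploredIn g σ → ExploredIn g (exec c σ)
    explored-frame c σ k e with frame-all exploredCells c σ k
    ... | f≡ , P≡ , C≡ , E≡ , x≡ , h≡ , _ =
      explored-resp (≡-sym f≡) (≡-sym P≡) (≡-sym C≡) (≡-sym E≡) (≡-sym x≡) (≡-sym h≡) e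

    extend-correct : ∀ {g} τ → Input τ → nvar τ 2 ≡ length g → (s : Step) → parent s ∈ reached g → child s ∉ reached g →
                     nvar τ 4 ≡ toℕ (parent s) → nvar τ 5 ≡ toℕ (child s) → nvar τ 6 ≡ toℕ (edge s) →
                     ExploredIn g τ → ExploredIn (s ∷ g) (exec extend τ)
    extend-correct {g} τ i 2≡ s p∈ c∉ 4≡ 5≡ 6≡ e =
      explored-resp (≡-cong (λ j → update (narr τ 2) j 1) (≡-sym 5≡))
        (≡-cong₂ (update (narr τ 3)) (≡-sym 2≡) (≡-sym 4≡)) (≡-cong₂ (update (narr τ 4)) (≡-sym 2≡) (≡-sym 5≡))
        (≡-cong₂ (update (narr τ 5)) (≡-sym 2≡) (≡-sym 6≡))
        (≡-cong₂ new-x (≡-sym 5≡) y≡) (≡-cong₂ (λ c y → update (rarr τ 2) c (new-x c y c + fromℕ 2)) (≡-sym 5≡) y≡)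
        (explore-step s p∈ c∉ e)
      where
      new-x : ℕ → Carrier → ℕ → Carrier
      new-x c y = update (rarr τ 1) c (fraction y)
      y≡ : rarr τ 2 (toℕ (parent s)) - ω (edge s) ≡ rarr τ 2 (nvar τ 4) - rarr τ 0 (nvar τ 6)
      y≡ = ≡-cong₂ _-_ (≡-cong (rarr τ 2) (≡-sym 4≡))
        (≡-trans (≡-sym (Input.weights i (edge s))) (≡-cong (rarr τ 0) (≡-sym 6≡)))

    Exploration-invariant : ℕ → State ℝ → Set
    Exploration-invariant r σ = Input σ × ∃ λ g → length g ≡ r × ExploredIn g σ

    round-correct : ∀ r τ → r ℕ.< m → nvar τ 2 ≡ r → Exploration-invariant r τ →
                    Exploration-invariant (suc r) (exec (set 2 (increment 2)) (exec round τ))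
    round-correct r τ r<m 2≡r (i , g , ≡-refl , e)
      with scan-finds g (Explored.valid e) r<m i (Explored.marks e)
    ... | s , p∈ , c∉ , 4≡ , 5≡ , 6≡ =
      input-kept (round ▸ set 2 (increment 2)) ≡-refl i , s ∷ g , ≡-refl ,
      explored-frame (set 2 (increment 2)) (exec round τ) ≡-refl
        (extend-correct (exec scan τ) (input-kept scan ≡-refl i) (≡-trans (frame ℕ-var 2 scan τ ≡-refl) 2≡r) s p∈ c∉ 4≡ 5≡ 6≡
          (explored-frame scan τ ≡-refl e))

    explore-correct : ∀ {σ} → Input σ → (∀ i → narr σ 2 i ≡ 0) → (∀ i → rarr σ 1 i ≡ 0#) →
                      Exploration-invariant m (exec explore σ)
    explore-correct {σ} i unmarked zeros =
      ≡-subst (λ k → Exploration-invariant k (exec explore σ)) (Input.size i)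
        (loop-rule Exploration-invariant 2 edgeCount round start ≡-refl
          (input-kept (set 2 (lit 0)) ≡-refl (input-kept (put 2 (lit 0) (lit 1) ▸ putᴿ 2 (lit 0) (cast (lit 2))) ≡-refl i) ,
           [] , ≡-refl , explored [] marks₀ tt tt tt (λ { (here ≡-refl) → height₀ }) [])
          (λ j τ j< → round-correct j τ (≡-subst (j ℕ.<_) (Input.size i) j<)))
      where
      start : State ℝ
      start = exec (put 2 (lit 0) (lit 1) ▸ putᴿ 2 (lit 0) (cast (lit 2))) σ
      marks₀ : Marks (update (narr σ 2) 0 1) []
      marks₀ v with v Finₚ.≟ root
      ... | yes ≡-refl = inj₁ (here ≡-refl , update-hit (narr σ 2) 1 (≡-sym root≡0))
      ... | no  v≢r    = inj₂ ((λ { (here v≡r) → v≢r v≡r }) , ≡-trans (update-miss (narr σ 2) 1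
                           (λ eq → v≢r (Finₚ.toℕ-injective (≡-trans (≡-sym eq) (≡-sym root≡0))))) (unmarked (toℕ v)))
      height₀ : HeightOf (rarr σ 1) (update (rarr σ 2) 0 (fromℕ 2)) root
      height₀ rewrite root≡0 | zeros 0 = ≤-refl , 0<fromℕ 0 , Reals.sym ℝ (Reals.+-identityˡ ℝ (fromℕ 2))

-- The grid of candidates

-- The programming language has no minimum.
capped : ℕ → ℕ → ℕ
capped u v = u ∸ (u ∸ v)

capped-≤ : ∀ {u v} → u ℕ.≤ v → capped u v ≡ u
capped-≤ {u} u≤v = ≡-cong (u ∸_) (ℕ.m≤n⇒m∸n≡0 u≤v)

capped-≥ : ∀ {u v} → v ℕ.≤ u → capped u v ≡ v
capped-≥ = ℕ.m∸[m∸n]≡n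

capped-bound : ∀ u v → capped u v ℕ.≤ v
capped-bound u v with ℕ.≤-total u v
... | inj₁ u≤v = ℕ.≤-trans (ℕ.m∸n≤m u (u ∸ v)) u≤v
... | inj₂ v≤u = ℕ.≤-reflexive (capped-≥ v≤u)

capped-bound′ : ∀ u v → capped u v ℕ.≤ u
capped-bound′ u v = ℕ.m∸n≤m u (u ∸ v)

capped-greatest : ∀ {i} u v → i ℕ.≤ u → i ℕ.≤ v → i ℕ.≤ capped u v
capped-greatest {i} u v i≤u i≤v with ℕ.≤-total u v
... | inj₁ u≤v = ≡-subst (i ℕ.≤_) (≡-sym (capped-≤ u≤v)) i≤u
... | inj₂ v≤u = ≡-subst (i ℕ.≤_) (≡-sym (capped-≥ v≤u)) i≤v

capped-monoˡ : ∀ {u u′} v → u ℕ.≤ u′ → capped u v ℕ.≤ capped u′ v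
capped-monoˡ {u} {u′} v u≤u′ = capped-greatest u′ v (ℕ.≤-trans (capped-bound′ u v) u≤u′) (capped-bound u v)

flat-injective : ∀ {N a a′ v v′} → a ℕ.< N → a′ ℕ.< N → v ℕ.* N ℕ.+ a ≡ v′ ℕ.* N ℕ.+ a′ → v ≡ v′ × a ≡ a′
flat-injective {N@(suc _)} {a} {a′} {v} {v′} a<N a′<N eq = quotient , remainder
  where
  remainder-of : ∀ {a} v → a ℕ.< N → (v ℕ.* N ℕ.+ a) % N ≡ a
  remainder-of {a} v a<N =
    ≡-trans (≡-cong (_% N) (ℕ.+-comm (v ℕ.* N) a)) (≡-trans ([m+kn]%n≡m%n a v N) (m<n⇒m%n≡m a<N))
  remainder : a ≡ a′
  remainder = ≡-trans (≡-sym (remainder-of v a<N)) (≡-trans (≡-cong (_% N) eq) (remainder-of v′ a′<N))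
  quotient : v ≡ v′
  quotient = ℕ.*-cancelʳ-≡ v v′ N (ℕ.+-cancelʳ-≡ a (v ℕ.* N) (v′ ℕ.* N) (≡-trans eq (≡-cong (v′ ℕ.* N ℕ.+_) (≡-sym remainder))))

-- The periodic extension x (a + n) = x a + 1 of the sorted fractions of the heights.
module Candidates (ℝ : Reals) (n : ℕ) .{{_ : NonZero n}} (x₀ : ℕ → Reals.Carrier ℝ)
                  (sorted : ∀ {a b} → a ℕ.≤ b → b ℕ.< n → Reals._≤_ ℝ (x₀ a) (x₀ b))
                  (0≤x₀ : ∀ {a} → a ℕ.< n → Reals._≤_ ℝ (Reals.0# ℝ) (x₀ a))
                  (x₀<1 : ∀ {a} → a ℕ.< n → Reals._<_ ℝ (x₀ a) (Reals.fromℕ ℝ 1)) where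
  open Reals ℝ using (Carrier; _≈_; _<_; _≤_; _+_; 0#; fromℕ; sym; trans; +-congˡ; +-congʳ; +-assoc; +-identityʳ)
  open OrderedFieldProperties ℝ

  candidate : ℕ → Carrier
  candidate a = x₀ (a % n) + fromℕ (a / n)

  -- One unit corresponds to `n` positions. Truncated subtraction stops at index 0, whose candidate
  -- is below 1 and bounds no child; the cap stops at the last index, whose candidate is at least 5
  -- and exceeds every height in question. So neither loses a feasible interval.
  lowered : ℕ → ℕ → ℕ
  lowered b κ = capped ((b ℕ.+ 2 ℕ.* n) ∸ κ ℕ.* n) (6 ℕ.* n ∸ 1)

  candidate-shift : ∀ a k → candidate (a ℕ.+ k ℕ.* n) ≈ candidate a + fromℕ k
  candidate-shift a k = trans
    (Reals.reflexive ℝ (≡-cong₂ (λ i q → x₀ i + fromℕ q) ([m+kn]%n≡m%n a k n)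
      (≡-trans (+-distrib-/-∣ʳ a (divides-refl k)) (≡-cong (a / n ℕ.+_) (m*n/n≡m k n)))))
    (trans (+-congˡ (fromℕ-+ (a / n) k)) (sym (+-assoc _ _ _)))

  candidate-base : ∀ {j} → j ℕ.< n → candidate j ≈ x₀ j
  candidate-base {j} j<n = trans
    (Reals.reflexive ℝ (≡-cong₂ (λ i q → x₀ i + fromℕ q) (m<n⇒m%n≡m j<n) (m<n⇒m/n≡0 j<n))) (+-identityʳ _)

  candidate-mono : ∀ {a b} → a ℕ.≤ b → candidate a ≤ candidate b
  candidate-mono {a} {b} a≤b with ℕ.m≤n⇒m<n∨m≡n (/-monoˡ-≤ n a≤b)
  ... | inj₁ q<q′ = linear (x₀ (a % n) ∷ x₀ (b % n) ∷ fromℕ (a / n) ∷ fromℕ (suc (a / n)) ∷ fromℕ (b / n) ∷ [])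
    (λ x y p p+1 q → x :< # 1 ∷ # 0 :≤ y ∷ # 1 :+ p :≈ p+1 ∷ p+1 :≤ q ∷ [] ⊢ x :+ p :≤ y :+ q)
    (x₀<1 (m%n<n a n) , 0≤x₀ (m%n<n b n) , sym (fromℕ-+ 1 (a / n)) , fromℕ-mono-≤ q<q′)
  ... | inj₂ q≡q′ = ≤-trans (+-monoˡ-≤ _ (sorted r≤r′ (m%n<n b n))) (≈⇒≤ (+-congˡ (fromℕ-cong q≡q′)))
    where
    r≤r′ : a % n ℕ.≤ b % n
    r≤r′ = ℕ.+-cancelʳ-≤ (b / n ℕ.* n) (a % n) (b % n)
      (≡-subst₂ ℕ._≤_ (≡-trans (m≡m%n+[m/n]*n a n) (≡-cong (λ q → a % n ℕ.+ q ℕ.* n) q≡q′)) (m≡m%n+[m/n]*n b n) a≤b)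

  module _ {m : ℕ} (G : Graph n m) (ω : Fin m → Carrier) (h : Fin n → Carrier)
           (2≤h : ∀ v → fromℕ 2 ≤ h v) (h<3 : ∀ v → h v < fromℕ 3) (ε : Carrier)
           (height-base : ∀ v → ∃ λ j → j ℕ.< n × h v ≈ x₀ j + fromℕ 2)
           (x : ℕ → Carrier) (x-candidate : ∀ {a} → a ℕ.< 6 ℕ.* n → x a ≈ candidate a) where
    open Tables ℝ G ω h 2≤h h<3 ε

    private
      N : ℕ
      N = 6 ℕ.* n
      0<n : 0 ℕ.< n
      0<n = ℕ.>-nonZero⁻¹ n
      0<N : 0 ℕ.< N
      0<N = ℕ.<-≤-trans 0<n (ℕ.m≤m+n n (5 ℕ.* n))
      last< : N ∸ 1 ℕ.< N
      last< = ℕ.∸-monoʳ-< {N} {1} {0} (s≤s z≤n) 0<N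
      x-candidate-last : x (N ∸ 1) ≈ candidate (N ∸ 1)
      x-candidate-last = x-candidate last<
      -- Heights below 5 lie in the first five periods; this is what the sixth is for.
      5n≤last : 0 ℕ.+ 5 ℕ.* n ℕ.≤ N ∸ 1
      5n≤last = ℕ.m+n≤o⇒m≤o∸n (5 ℕ.* n) (≡-subst (5 ℕ.* n ℕ.+ 1 ℕ.≤_) (ℕ.+-comm (5 ℕ.* n) n) (ℕ.+-monoʳ-≤ (5 ℕ.* n) 0<n))
      5≤last : fromℕ 5 ≤ candidate (N ∸ 1)
      5≤last = linear (x₀ 0 ∷ candidate 0 ∷ candidate (0 ℕ.+ 5 ℕ.* n) ∷ candidate (N ∸ 1) ∷ [])
        (λ x₀ c c′ l → # 0 :≤ x₀ ∷ x₀ :≈ c ∷ c :+ # 5 :≈ c′ ∷ c′ :≤ l ∷ [] ⊢ # 5 :≤ l)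
        (0≤x₀ 0<n , sym (candidate-base 0<n) , sym (candidate-shift 0 5) , candidate-mono 5n≤last)
      lowered-bound : ∀ b κ → lowered b κ ℕ.< N
      lowered-bound b κ = ℕ.≤-<-trans (capped-bound ((b ℕ.+ 2 ℕ.* n) ∸ κ ℕ.* n) (N ∸ 1)) last<
      position : ℕ → ℕ → ℕ
      position b κ = (b ℕ.+ 2 ℕ.* n) ∸ κ ℕ.* n
      x-lowered : ∀ b κ → x (lowered b κ) ≈ candidate (lowered b κ)
      x-lowered b κ = x-candidate (lowered-bound b κ)
      candidate-position : ∀ b κ → κ ℕ.* n ℕ.≤ b ℕ.+ 2 ℕ.* n → candidate (position b κ) + fromℕ κ ≈ candidate b + fromℕ 2
      candidate-position b κ p = trans (sym (candidate-shift (position b κ) κ))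
        (trans (Reals.reflexive ℝ (≡-cong candidate (ℕ.m∸n+n≡m p))) (candidate-shift b 2))
      sound : ∀ {b} κ → b ℕ.< N → x (lowered b κ) + fromℕ κ ≤ x b + fromℕ 2 ⊎ x (lowered b κ) < fromℕ 2
      sound {b} κ b<N with κ ℕ.* n ℕ.≤? b ℕ.+ 2 ℕ.* n
      ... | yes p = inj₁ (linear (x (lowered b κ) ∷ candidate (lowered b κ) ∷ candidate (position b κ) ∷ fromℕ κ ∷ x b ∷ candidate b ∷ [])
        (λ x c c′ κ xb cb → x :≈ c ∷ c :≤ c′ ∷ c′ :+ κ :≈ cb :+ # 2 ∷ cb :≈ xb ∷ [] ⊢ x :+ κ :≤ xb :+ # 2)
        (x-lowered b κ , candidate-mono (capped-bound′ (position b κ) (N ∸ 1)) , candidate-position b κ p , sym (x-candidate b<N)))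
      ... | no p = inj₂ (linear (x (lowered b κ) ∷ candidate (lowered b κ) ∷ candidate 0 ∷ x₀ 0 ∷ [])
        (λ x c c′ x₀ → x :≈ c ∷ c :≤ c′ ∷ c′ :≈ x₀ ∷ x₀ :< # 1 ∷ [] ⊢ x :< # 2)
        (x-lowered b κ ,
         candidate-mono (ℕ.≤-trans (capped-bound′ (position b κ) (N ∸ 1)) (ℕ.≤-reflexive (ℕ.m≤n⇒m∸n≡0 (ℕ.<⇒≤ (ℕ.≰⇒> p))))) ,
         candidate-base 0<n , x₀<1 0<n))
      complete : ∀ {b} κ {y} → b ℕ.< N → fromℕ 2 ≤ y → y < fromℕ 5 → y + fromℕ κ ≤ x b + fromℕ 2 → y ≤ x (lowered b κ)
      complete {b} κ {y} b<N 2≤y y<5 y≤ with κ ℕ.* n ℕ.≤? b ℕ.+ 2 ℕ.* n | ℕ.≤-total (position b κ) (N ∸ 1)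
      ... | yes p | inj₁ q = linear (y ∷ x (lowered b κ) ∷ candidate (lowered b κ) ∷ candidate (position b κ) ∷ fromℕ κ ∷ x b ∷ candidate b ∷ [])
        (λ y x c c′ κ xb cb → y :+ κ :≤ xb :+ # 2 ∷ xb :≈ cb ∷ cb :+ # 2 :≈ c′ :+ κ ∷ c′ :≈ c ∷ c :≈ x ∷ [] ⊢ y :≤ x)
        (y≤ , x-candidate b<N , sym (candidate-position b κ p) ,
         Reals.reflexive ℝ (≡-cong candidate (≡-sym (capped-≤ q))) , sym (x-lowered b κ))
      ... | yes _ | inj₂ q = linear (y ∷ x (lowered b κ) ∷ candidate (lowered b κ) ∷ candidate (N ∸ 1) ∷ [])
        (λ y x c l → y :< # 5 ∷ # 5 :≤ l ∷ l :≈ c ∷ c :≈ x ∷ [] ⊢ y :≤ x)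
        (y<5 , 5≤last , Reals.reflexive ℝ (≡-cong candidate (≡-sym (capped-≥ q))) , sym (x-lowered b κ))
      -- If `κ n` exceeds the position, then `x b + 2` is below `κ + 1`, too little for `y + κ` with
      -- `y` at least 2.
      ... | no p | _ = ⊥-elim (<-irrefl {fromℕ 0} (linear (y ∷ fromℕ κ ∷ x b ∷ candidate b ∷ candidate (b ℕ.+ 2 ℕ.* n) ∷ candidate (0 ℕ.+ κ ℕ.* n) ∷ candidate 0 ∷ x₀ 0 ∷ [])
        (λ y κ xb cb cb2 ck c x₀ → # 2 :≤ y ∷ y :+ κ :≤ xb :+ # 2 ∷ xb :≈ cb ∷ cb :+ # 2 :≈ cb2 ∷ cb2 :≤ ck ∷ ck :≈ c :+ κ ∷ c :≈ x₀ ∷ x₀ :< # 1 ∷ []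
          ⊢ # 0 :< # 0)
        (2≤y , y≤ , x-candidate b<N , sym (candidate-shift b 2) , candidate-mono (ℕ.<⇒≤ (ℕ.≰⇒> p)) , candidate-shift 0 κ ,
         candidate-base 0<n , x₀<1 0<n)))
      find : ∀ {y} → Height y → 0# ≤ y → y < fromℕ 5 → ∃ λ a → a ℕ.< N × x a ≈ y
      find {y} (w , a , b , eq) 0≤y y<5 with height-base w | a ℕ.≤? b ℕ.+ 2
      ... | j , j<n , h≈ | yes a≤b+2 = j ℕ.+ q ℕ.* n , index<N , trans (x-candidate index<N) (trans (candidate-shift j q) (trans (+-congʳ (candidate-base j<n)) (sym y≈)))
        where
        -- As `h w` is a fraction plus 2, `y` is that fraction plus `b + 2 − a`.
        q : ℕ
        q = (b ℕ.+ 2) ∸ a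
        q+a≈b+2 : fromℕ q + fromℕ a ≈ fromℕ b + fromℕ 2
        q+a≈b+2 = trans (sym (fromℕ-+ q a)) (trans (fromℕ-cong (ℕ.m∸n+n≡m a≤b+2)) (fromℕ-+ b 2))
        y≈ : y ≈ x₀ j + fromℕ q
        y≈ = linear (y ∷ fromℕ a ∷ fromℕ b ∷ fromℕ q ∷ h w ∷ x₀ j ∷ [])
          (λ y a b q h x → y :+ a :≈ h :+ b ∷ h :≈ x :+ # 2 ∷ b :+ # 2 :≈ q :+ a ∷ [] ⊢ y :≈ x :+ q) (eq , h≈ , sym q+a≈b+2)
        q<5 : q ℕ.< 5
        q<5 = fromℕ-cancel-< {q} {5} (linear (y ∷ fromℕ q ∷ x₀ j ∷ []) (λ y q x → x :+ q :≈ y ∷ y :< # 5 ∷ # 0 :≤ x ∷ [] ⊢ q :< # 5) (sym y≈ , y<5 , 0≤x₀ j<n))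
        index<N : j ℕ.+ q ℕ.* n ℕ.< N
        index<N = ℕ.+-mono-<-≤ j<n (ℕ.*-monoˡ-≤ n (ℕ.<⇒≤ q<5))
      ... | j , j<n , h≈ | no a≰b+2 = ⊥-elim (<-irrefl {fromℕ 0} (linear (y ∷ fromℕ a ∷ fromℕ b ∷ fromℕ (b ℕ.+ 3) ∷ h w ∷ x₀ j ∷ [])
        (λ y a b b+3 h x → # 0 :≤ y ∷ y :+ a :≈ h :+ b ∷ h :≈ x :+ # 2 ∷ x :< # 1 ∷ b :+ # 3 :≈ b+3 ∷ b+3 :≤ a ∷ [] ⊢ # 0 :< # 0)
        (0≤y , eq , h≈ , x₀<1 j<n , sym (fromℕ-+ b 3) ,
         fromℕ-mono-≤ (≡-subst (ℕ._≤ a) (≡-sym (ℕ.+-suc b 2)) (ℕ.≰⇒> a≰b+2)))))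

    grid : Grid N x lowered
    grid = record
      { mono             = λ a≤b b<N → ≤-trans (≈⇒≤ (x-candidate (ℕ.≤-<-trans a≤b b<N)))
                             (≤-trans (candidate-mono a≤b) (≈⇒≤ (sym (x-candidate b<N))))
      ; last             = N ∸ 1
      ; last<            = last<
      ; top              = ≤-trans 5≤last (≈⇒≤ (sym x-candidate-last))
      ; locate           = find
      ; lowered<         = lowered-bound
      ; lowered-mono     = λ κ a≤b → capped-monoˡ (N ∸ 1) (ℕ.∸-monoˡ-≤ (κ ℕ.* n) (ℕ.+-monoˡ-≤ (2 ℕ.* n) a≤b))
      ; lowered-sound    = sound
      ; lowered-complete = complete
      }

-- The sorting and initialisation programs

-- Both loops of the sort run over all indices, so their lengths depend on `n` only. The test
-- exchanges when the outer entry is smaller, which suggests decreasing order; the result is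
-- increasing, since the outer cell collects the maximum behind a sorted prefix.
sortBody sort periodBody period : Code
swapCells : Code
swapCells = setᴿ 1 (1 atᴿ var 2) ▸ putᴿ 1 (var 2) (1 atᴿ var 3) ▸ putᴿ 1 (var 3) (varᴿ 1)
sortBody  = cond ((1 atᴿ var 2) `<ᴿ (1 atᴿ var 3)) swapCells nop
sort      = loop 2 (multipleOfOrder 1) (loop 3 (multipleOfOrder 1) sortBody)
periodBody = putᴿ 1 (var 3 `+ var 0) ((1 atᴿ var 3) `+ᴿ cast (lit 1))
period    = loop 3 (multipleOfOrder 5) periodBody

rowLength : NExp
rowLength = lit 6 `* var 0

cell : Name → NExp → NExp
cell v a = var v `* rowLength `+ a

singletonBody singletons : Code
singletonBody = cond ((1 atᴿ var 3) `<ᴿ (2 atᴿ var 2)) nop (putᴿ 3 (cell 2 (var 3)) (2 atᴿ var 2))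
singletons    = loop 2 (multipleOfOrder 1) (loop 3 (multipleOfOrder 6) singletonBody)

module ArrayPrograms (ℝ : Reals) where
  open Reals ℝ using (Carrier; _≈_; _<_; _≤_; _+_; 0#; fromℕ; _<?_; sym; trans; reflexive; +-congʳ; +-comm)
  open OrderedFieldProperties ℝ
  open Execution {ℝ}
  open State

  <?-true : ∀ {x y} → ⌊ x <? y ⌋ ≡ true → x < y
  <?-true {x} {y} e with x <? y
  ... | yes p = p

  <?-false : ∀ {x y} → ⌊ x <? y ⌋ ≡ false → y ≤ x
  <?-false {x} {y} e with x <? y
  ... | no p = ≮⇒≥ p

  SortedUpTo : ℕ → (ℕ → Carrier) → Set
  SortedUpTo i x = ∀ a b → a ℕ.≤ b → b ℕ.< i → x a ≤ x b

  module _ (n : ℕ) where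

    SameValues : (x y : ℕ → Carrier) → Set
    SameValues x y = (∀ {j} → j ℕ.< n → ∃ λ k → k ℕ.< n × y k ≡ x j) × (∀ {j} → j ℕ.< n → ∃ λ k → k ℕ.< n × x k ≡ y j)

    SameValues-trans : ∀ {x y z} → SameValues x y → SameValues y z → SameValues x z
    SameValues-trans (f , g) (f′ , g′) = chain f f′ , chain g′ g
      where
      chain : ∀ {x y z : ℕ → Carrier} → (∀ {j} → j ℕ.< n → ∃ λ k → k ℕ.< n × y k ≡ x j) →
              (∀ {j} → j ℕ.< n → ∃ λ k → k ℕ.< n × z k ≡ y j) → ∀ {j} → j ℕ.< n → ∃ λ k → k ℕ.< n × z k ≡ x j
      chain f g j< with f j<
      ... | k , k< , p with g k<
      ...   | l , l< , q = l , l< , ≡-trans q p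

    swapped : (ℕ → Carrier) → ℕ → ℕ → ℕ → Carrier
    swapped x i j = update (update x i (x j)) j (x i)

    swapped-j : ∀ x i j → swapped x i j j ≡ x i
    swapped-j x i j = update-hit (update x i (x j)) {j} (x i) ≡-refl

    swapped-i : ∀ x i j → swapped x i j i ≡ x j
    swapped-i x i j with j ℕ.≟ i
    ... | yes ≡-refl = swapped-j x i j
    ... | no j≢i = ≡-trans (update-miss (update x i (x j)) {j} (x i) j≢i) (update-hit x {i} (x j) ≡-refl)

    swapped-other : ∀ x i j {k} → i ≢ k → j ≢ k → swapped x i j k ≡ x k
    swapped-other x i j i≢k j≢k = ≡-trans (update-miss (update x i (x j)) {j} (x i) j≢k) (update-miss x {i} (x j) i≢k)

    swapped-SameValues : ∀ x {i j} → i ℕ.< n → j ℕ.< n → SameValues x (swapped x i j)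
    swapped-SameValues x {i} {j} i< j< = to , from
      where
      to : ∀ {k} → k ℕ.< n → ∃ λ l → l ℕ.< n × swapped x i j l ≡ x k
      to {k} k< with i ℕ.≟ k | j ℕ.≟ k
      ... | yes ≡-refl | _          = j , j< , swapped-j x i j
      ... | no _       | yes ≡-refl = i , i< , swapped-i x i j
      ... | no p       | no q       = k , k< , swapped-other x i j p q
      from : ∀ {k} → k ℕ.< n → ∃ λ l → l ℕ.< n × x l ≡ swapped x i j k
      from {k} k< with i ℕ.≟ k | j ℕ.≟ k
      ... | yes ≡-refl | _          = j , j< , ≡-sym (swapped-i x i j)
      ... | no _       | yes ≡-refl = i , i< , ≡-sym (swapped-j x i j)
      ... | no p       | no q       = k , k< , ≡-sym (swapped-other x i j p q)

    -- Cell i carries the largest value met so far, which leaves cells 0, …, i ∸ 1 sorted throughout.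
    record Inserting (i j : ℕ) (x₀ x : ℕ → Carrier) : Set where
      constructor inserting
      field
        sorted : SortedUpTo i x
        carry  : ∀ {l} → l ℕ.< i → l ℕ.< j → x l ≤ x i
        same   : SameValues x₀ x

    -- For `j` below `i`, the carried value is at least every entry before `j` and, being smaller
    -- than `x j`, at most every entry after it up to `i`. It therefore fits into cell `j`, and
    -- `x j` becomes the new maximum to carry.
    insert-swap : ∀ {i j x₀ x} → i ℕ.< n → j ℕ.< n → x i < x j → Inserting i j x₀ x → Inserting i (suc j) x₀ (swapped x i j)
    insert-swap {i} {j} {x₀} {x} i<n j<n xi<xj (inserting sorted carry same) =
      inserting sorted′ carry′ (SameValues-trans {x₀} {x} same (swapped-SameValues x i<n j<n))
      where
      x′ : ℕ → Carrier
      x′ = swapped x i j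
      at-j : x′ j ≈ x i
      at-j = reflexive (swapped-j x i j)
      other : ∀ {k} → k ℕ.< i → j ≢ k → x′ k ≈ x k
      other k<i j≢k = reflexive (swapped-other x i j (λ { ≡-refl → ℕ.<-irrefl ≡-refl k<i }) j≢k)
      sorted′ : SortedUpTo i x′
      sorted′ a b a≤b b<i with j ℕ.≟ a | j ℕ.≟ b
      ... | yes ≡-refl | yes ≡-refl = ≤-refl
      ... | yes ≡-refl | no j≢b = ≤-resp (sym at-j) (sym (other b<i j≢b)) (≤-trans (<⇒≤ xi<xj) (sorted a b a≤b b<i))
      ... | no j≢a | yes ≡-refl = ≤-resp (sym (other (ℕ.≤-<-trans a≤b b<i) j≢a)) (sym at-j)
              (carry (ℕ.≤-<-trans a≤b b<i) (ℕ.≤∧≢⇒< a≤b (λ eq → j≢a (≡-sym eq))))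
      ... | no j≢a | no j≢b = ≤-resp (sym (other (ℕ.≤-<-trans a≤b b<i) j≢a)) (sym (other b<i j≢b)) (sorted a b a≤b b<i)
      at-i : x′ i ≈ x j
      at-i = reflexive (swapped-i x i j)
      carry′ : ∀ {l} → l ℕ.< i → l ℕ.< suc j → x′ l ≤ x′ i
      carry′ {l} l<i (s≤s l≤j) with j ℕ.≟ l
      ... | yes ≡-refl = ≤-resp (sym at-j) (sym at-i) (<⇒≤ xi<xj)
      ... | no j≢l = ≤-resp (sym (other l<i j≢l)) (sym at-i)
              (≤-trans (carry l<i (ℕ.≤∧≢⇒< l≤j (λ eq → j≢l (≡-sym eq)))) (<⇒≤ xi<xj))

    insert-skip : ∀ {i j x₀ x} → x j ≤ x i → Inserting i j x₀ x → Inserting i (suc j) x₀ x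
    insert-skip {i} {j} {x₀} {x} xj≤xi (inserting sorted carry same) = inserting sorted carry′ same
      where
      carry′ : ∀ {l} → l ℕ.< i → l ℕ.< suc j → x l ≤ x i
      carry′ {l} l<i (s≤s l≤j) with ℕ.m≤n⇒m<n∨m≡n l≤j
      ... | inj₁ l<j    = carry l<i l<j
      ... | inj₂ ≡-refl = xj≤xi

    inserted : ∀ {i x₀ x} → i ℕ.< n → Inserting i n x₀ x → SortedUpTo (suc i) x
    inserted i<n (inserting sorted carry _) a b a≤b (s≤s b≤i) with ℕ.m≤n⇒m<n∨m≡n b≤i
    ... | inj₁ b<i = sorted a b a≤b b<i
    ... | inj₂ ≡-refl with ℕ.m≤n⇒m<n∨m≡n a≤b
    ...   | inj₁ a<i    = carry a<i (ℕ.<-trans a<i i<n)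
    ...   | inj₂ ≡-refl = ≤-refl

    sort-correct : ∀ σ → nvar σ 0 ≡ n → SortedUpTo n (rarr (exec sort σ) 1) × SameValues (rarr σ 1) (rarr (exec sort σ) 1)
    sort-correct σ 0≡n = finish (loop-rule Outer 2 (multipleOfOrder 1) (loop 3 (multipleOfOrder 1) sortBody) σ ≡-refl
        (0≡n , (λ _ _ _ ()) , (λ j< → _ , j< , ≡-refl) , (λ j< → _ , j< , ≡-refl)) outer-step)
      where
      Outer : ℕ → State ℝ → Set
      Outer i τ = nvar τ 0 ≡ n × SortedUpTo i (rarr τ 1) × SameValues (rarr σ 1) (rarr τ 1)
      count≡n : ∀ {τ} → nvar τ 0 ≡ n → nvar τ 0 ℕ.+ 0 ≡ n
      count≡n eq = ≡-trans (ℕ.+-identityʳ _) eq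
      finish : Outer (nvar σ 0 ℕ.+ 0) (exec sort σ) → SortedUpTo n (rarr (exec sort σ) 1) × SameValues (rarr σ 1) (rarr (exec sort σ) 1)
      finish (_ , sorted , same) = ≡-subst (λ i → SortedUpTo i (rarr (exec sort σ) 1)) (count≡n {σ} 0≡n) sorted , same
      Inner : ℕ → ℕ → State ℝ → Set
      Inner i j τ = nvar τ 0 ≡ n × nvar τ 2 ≡ i × Inserting i j (rarr σ 1) (rarr τ 1)
      inner-step : ∀ i → i ℕ.< n → ∀ j τ → j ℕ.< n → nvar τ 3 ≡ j → Inner i j τ →
                   Inner i (suc j) (exec (set 3 (increment 3)) (exec sortBody τ))
      inner-step i i<n j τ j<n ≡-refl (τ≡n , ≡-refl , ins) =
        cond-rule (λ υ → Inner i (suc j) (exec (set 3 (increment 3)) υ)) ((1 atᴿ var 2) `<ᴿ (1 atᴿ var 3)) swapCells nop τ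
          (λ e → τ≡n , ≡-refl , insert-swap i<n j<n (<?-true e) ins)
          (λ e → τ≡n , ≡-refl , insert-skip (<?-false e) ins)
      outer-step : ∀ i τ → i ℕ.< nvar σ 0 ℕ.+ 0 → nvar τ 2 ≡ i → Outer i τ →
                   Outer (suc i) (exec (set 2 (increment 2)) (exec (loop 3 (multipleOfOrder 1) sortBody) τ))
      outer-step i τ i< 2≡i (τ≡n , sorted , same) = conclude (loop-rule (Inner i) 3 (multipleOfOrder 1) sortBody τ ≡-refl
          (τ≡n , 2≡i , inserting sorted (λ _ ()) same)
          (λ j υ j< → inner-step i i<n j υ (≡-subst (j ℕ.<_) (count≡n {τ} τ≡n) j<)))
        where
        i<n : i ℕ.< n
        i<n = ≡-subst (i ℕ.<_) (count≡n {σ} 0≡n) i<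
        conclude : Inner i (nvar τ 0 ℕ.+ 0) (exec (loop 3 (multipleOfOrder 1) sortBody) τ) → _
        conclude (υ≡n , _ , ins) = υ≡n ,
          inserted i<n (≡-subst (λ k → Inserting i k (rarr σ 1) _) (count≡n {τ} τ≡n) ins) , Inserting.same ins

    module _ .{{_ : ℕ.NonZero n}} (x₀ : ℕ → Carrier) (candidate : ℕ → Carrier)
             (candidate-base : ∀ {j} → j ℕ.< n → candidate j ≈ x₀ j)
             (candidate-next : ∀ a → candidate (a ℕ.+ n) ≈ candidate a + fromℕ 1) where

      period-correct : ∀ σ → nvar σ 0 ≡ n → (∀ {j} → j ℕ.< n → rarr σ 1 j ≡ x₀ j) →
                       ∀ {a} → a ℕ.< 6 ℕ.* n → rarr (exec period σ) 1 a ≈ candidate a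
      period-correct σ ≡-refl base {a} a<6n = proj₂ (loop-rule Filled 3 (multipleOfOrder 5) periodBody σ ≡-refl
          (≡-refl , λ j< → trans (reflexive (base j<)) (sym (candidate-base j<))) filled-step)
          (≡-subst (a ℕ.<_) (ℕ.+-comm n (5 ℕ.* n)) a<6n)
        where
        Filled : ℕ → State ℝ → Set
        Filled k τ = nvar τ 0 ≡ n × (∀ {a} → a ℕ.< k ℕ.+ n → rarr τ 1 a ≈ candidate a)
        filled-step : ∀ k τ → k ℕ.< 5 ℕ.* n → nvar τ 3 ≡ k → Filled k τ →
                      Filled (suc k) (exec (set 3 (increment 3)) (exec periodBody τ))
        filled-step k τ _ ≡-refl (τ≡n , filled) = τ≡n , go
          where
          go : ∀ {a} → a ℕ.< suc k ℕ.+ n → update (rarr τ 1) (k ℕ.+ nvar τ 0) (rarr τ 1 k + fromℕ 1) a ≈ candidate a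
          go {a} (s≤s a≤k+n) with ℕ.m≤n⇒m<n∨m≡n a≤k+n
          ... | inj₁ a<k+n = trans (reflexive (update-miss (rarr τ 1) {k ℕ.+ nvar τ 0} {a} _
                  (λ eq → ℕ.<⇒≢ a<k+n (≡-trans (≡-sym eq) (≡-cong (k ℕ.+_) τ≡n))))) (filled a<k+n)
          ... | inj₂ a≡k+n = trans (reflexive (update-hit (rarr τ 1) {k ℕ.+ nvar τ 0} {a} _ (≡-trans (≡-cong (k ℕ.+_) τ≡n) (≡-sym a≡k+n))))
                  (trans (+-congʳ (filled {k} (ℕ.m<m+n k (ℕ.>-nonZero⁻¹ n))))
                    (trans (sym (candidate-next k)) (reflexive (≡-cong candidate (≡-sym a≡k+n)))))

    rowCell : ℕ → ℕ → ℕ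
    rowCell v a = v ℕ.* (6 ℕ.* n) ℕ.+ a

    row : State ℝ → ℕ → ℕ → Carrier
    row σ v a = rarr σ 3 (rowCell v a)

    SingletonCell : (x h : ℕ → Carrier) → ℕ → ℕ → Carrier → Set
    SingletonCell x h v a y = (x a < h v × y ≡ 0#) ⊎ (h v ≤ x a × y ≡ h v)

    record Filling (p : ℕ) (x h F : ℕ → Carrier) : Set where
      constructor filling
      field
        done : ∀ {v a} → a ℕ.< 6 ℕ.* n → rowCell v a ℕ.< p → SingletonCell x h v a (F (rowCell v a))
        rest : ∀ {i} → p ℕ.≤ i → F i ≡ 0#

    filling-skip : ∀ {v a x h F} → a ℕ.< 6 ℕ.* n → x a < h v → Filling (rowCell v a) x h F → Filling (suc (rowCell v a)) x h F
    filling-skip {v} {a} {x} {h} {F} a<N x<h (filling done rest) = filling done′ (λ p → rest (ℕ.<⇒≤ p))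
      where
      done′ : ∀ {v′ a′} → a′ ℕ.< 6 ℕ.* n → rowCell v′ a′ ℕ.< suc (rowCell v a) → SingletonCell x h v′ a′ (F (rowCell v′ a′))
      done′ {v′} {a′} a′<N (s≤s p) with ℕ.m≤n⇒m<n∨m≡n p
      ... | inj₁ q = done a′<N q
      ... | inj₂ eq with flat-injective {6 ℕ.* n} {a′} {a} {v′} {v} a′<N a<N eq
      ...   | ≡-refl , ≡-refl = inj₁ (x<h , rest ℕ.≤-refl)

    filling-put : ∀ {v a x h F} → a ℕ.< 6 ℕ.* n → h v ≤ x a → Filling (rowCell v a) x h F →
                  Filling (suc (rowCell v a)) x h (update F (rowCell v a) (h v))
    filling-put {v} {a} {x} {h} {F} a<N h≤x (filling done rest) = filling done′
        (λ p → ≡-trans (update-miss F {rowCell v a} (h v) (ℕ.<⇒≢ p)) (rest (ℕ.<⇒≤ p)))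
      where
      done′ : ∀ {v′ a′} → a′ ℕ.< 6 ℕ.* n → rowCell v′ a′ ℕ.< suc (rowCell v a) →
              SingletonCell x h v′ a′ (update F (rowCell v a) (h v) (rowCell v′ a′))
      done′ {v′} {a′} a′<N (s≤s p) with ℕ.m≤n⇒m<n∨m≡n p
      ... | inj₁ q = ≡-subst (SingletonCell x h v′ a′) (≡-sym (update-miss F {rowCell v a} (h v) (λ eq → ℕ.<⇒≢ q (≡-sym eq)))) (done a′<N q)
      ... | inj₂ eq with flat-injective {6 ℕ.* n} {a′} {a} {v′} {v} a′<N a<N eq
      ...   | ≡-refl , ≡-refl = inj₂ (h≤x , update-hit F {rowCell v a} (h v) ≡-refl)

    singletons-correct : ∀ σ → nvar σ 0 ≡ n → (∀ i → rarr σ 3 i ≡ 0#) → ∀ {v a} → v ℕ.< n → a ℕ.< 6 ℕ.* n →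
                         SingletonCell (rarr σ 1) (rarr σ 2) v a (row (exec singletons σ) v a)
    singletons-correct σ ≡-refl zeros {v} {a} v<n a<N =
      Filling.done (proj₂ (loop-rule Outer 2 (multipleOfOrder 1) (loop 3 (multipleOfOrder 6) singletonBody) σ ≡-refl
        ((≡-refl , ≡-refl , ≡-refl) , filling (λ _ ()) (λ _ → zeros _)) outer-step)) a<N
        (ℕ.<-≤-trans (ℕ.+-monoʳ-< (v ℕ.* (6 ℕ.* n)) a<N)
          (≡-subst₂ ℕ._≤_ (ℕ.+-comm (6 ℕ.* n) (v ℕ.* (6 ℕ.* n))) (≡-cong (ℕ._* (6 ℕ.* n)) (≡-sym (ℕ.+-identityʳ n))) (ℕ.*-monoˡ-≤ (6 ℕ.* n) v<n)))
      where
      Fixed : State ℝ → Set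
      Fixed τ = nvar τ 0 ≡ n × rarr τ 1 ≡ rarr σ 1 × rarr τ 2 ≡ rarr σ 2
      Outer : ℕ → State ℝ → Set
      Outer i τ = Fixed τ × Filling (i ℕ.* (6 ℕ.* n)) (rarr σ 1) (rarr σ 2) (rarr τ 3)
      Inner : ℕ → ℕ → State ℝ → Set
      Inner i j τ = Fixed τ × nvar τ 2 ≡ i × Filling (rowCell i j) (rarr σ 1) (rarr σ 2) (rarr τ 3)
      inner-step : ∀ i j τ → j ℕ.< 6 ℕ.* n → nvar τ 3 ≡ j → Inner i j τ →
                   Inner i (suc j) (exec (set 3 (increment 3)) (exec singletonBody τ))
      inner-step i j τ j<N ≡-refl ((τ≡n , x≡ , h≡) , ≡-refl , f) =
        cond-rule (λ υ → Inner i (suc j) (exec (set 3 (increment 3)) υ)) ((1 atᴿ var 3) `<ᴿ (2 atᴿ var 2)) nop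
            (putᴿ 3 (cell 2 (var 3)) (2 atᴿ var 2)) τ
          (λ e → (τ≡n , x≡ , h≡) , ≡-refl , next (filling-skip j<N (<-resp (reflexive (≡-cong (λ f → f j) x≡)) (reflexive (≡-cong (λ f → f i) h≡)) (<?-true e)) f))
          (λ e → (τ≡n , x≡ , h≡) , ≡-refl , next (≡-subst (Filling (suc (rowCell i j)) (rarr σ 1) (rarr σ 2)) written
            (filling-put j<N (≤-resp (reflexive (≡-cong (λ f → f i) h≡)) (reflexive (≡-cong (λ f → f j) x≡)) (<?-false e)) f)))
        where
        next : ∀ {F} → Filling (suc (rowCell i j)) (rarr σ 1) (rarr σ 2) F → Filling (rowCell i (suc j)) (rarr σ 1) (rarr σ 2) F
        next {F} = ≡-subst (λ p → Filling p (rarr σ 1) (rarr σ 2) F) (≡-sym (ℕ.+-suc (i ℕ.* (6 ℕ.* n)) j))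
        written : update (rarr τ 3) (rowCell i j) (rarr σ 2 i) ≡ update (rarr τ 3) (i ℕ.* (6 ℕ.* nvar τ 0) ℕ.+ j) (rarr τ 2 i)
        written = ≡-cong₂ (λ k f → update (rarr τ 3) (i ℕ.* (6 ℕ.* k) ℕ.+ j) (f i)) (≡-sym τ≡n) (≡-sym h≡)
      outer-step : ∀ i τ → i ℕ.< nvar σ 0 ℕ.+ 0 → nvar τ 2 ≡ i → Outer i τ →
                   Outer (suc i) (exec (set 2 (increment 2)) (exec (loop 3 (multipleOfOrder 6) singletonBody) τ))
      outer-step i τ i< 2≡i (fx , f) = conclude (loop-rule (Inner i) 3 (multipleOfOrder 6) singletonBody τ ≡-refl
          (fx , 2≡i , ≡-subst (λ p → Filling p (rarr σ 1) (rarr σ 2) (rarr τ 3)) (≡-sym (ℕ.+-identityʳ _)) f)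
          (λ j υ j< → inner-step i j υ (≡-subst (λ k → j ℕ.< 6 ℕ.* k) (proj₁ fx) j<)))
        where
        conclude : Inner i (6 ℕ.* nvar τ 0) (exec (loop 3 (multipleOfOrder 6) singletonBody) τ) → _
        conclude (fx′ , _ , f′) = fx′ ,
          ≡-subst (λ p → Filling p (rarr σ 1) (rarr σ 2) (rarr (exec (loop 3 (multipleOfOrder 6) singletonBody) τ) 3))
            (≡-trans (≡-cong (λ k → i ℕ.* (6 ℕ.* n) ℕ.+ 6 ℕ.* k) (proj₁ fx)) (ℕ.+-comm (i ℕ.* (6 ℕ.* n)) (6 ℕ.* n))) f′

-- The merging program

cappedᴺ : NExp → NExp → NExp
cappedᴺ u v = u `∸ (u `∸ v)

loweredᴺ : NExp
loweredᴺ = cappedᴺ ((var 3 `+ lit 2 `* var 0) `∸ var 7 `* var 0) (rowLength `∸ lit 1)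

raised : RExp
raised = varᴿ 3 `+ᴿ cast (var 7) `-ᴿ cast (lit 2)

-- `varᴿ 2` holds the slope `z`; the middle test keeps the rounded weight `κ + z − 2` of the edge
-- non-negative.
improves : BExp
improves = cast (lit 0) `<ᴿ varᴿ 3 `∧ `not (cast (var 7) `+ᴿ varᴿ 2 `<ᴿ cast (lit 2)) `∧ (5 atᴿ var 3) `<ᴿ raised

-- The parent's row is copied to array 4 because `merge` overwrites it while still reading its old
-- entries.
relax liftBody lift : Code
relax    = setᴿ 3 (3 atᴿ cell 5 loweredᴺ) ▸ cond improves (putᴿ 5 (var 3) raised) nop
liftBody = putᴿ 4 (var 3) (3 atᴿ cell 4 (var 3)) ▸ putᴿ 5 (var 3) (cast (lit 0)) ▸ loop 7 (constant 5) relax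
lift     = loop 3 (multipleOfOrder 6) liftBody

fits : Name → Name → BExp
fits i j = (1 atᴿ var i) `+ᴿ (1 atᴿ var j) `<ᴿ varᴿ 0 `+ᴿ (varᴿ 1 `+ᴿ varᴿ 1)

betters : Name → Name → BExp
betters i j = fits i j `∧ varᴿ 1 `+ᴿ varᴿ 1 `<ᴿ varᴿ 0 `+ᴿ ((4 atᴿ var i) `+ᴿ (5 atᴿ var j)) `∧
  varᴿ 4 `<ᴿ (4 atᴿ var i) `∧ varᴿ 4 `<ᴿ (5 atᴿ var j)

takeLesser tryPair : Name → Name → Code
takeLesser i j = cond ((4 atᴿ var i) `<ᴿ (5 atᴿ var j)) (setᴿ 4 (4 atᴿ var i)) (setᴿ 4 (5 atᴿ var j))
tryPair i j    = cond (betters i j) (takeLesser i j) nop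

-- A turn moves one pointer: 9 goes down while the pair does not fit, otherwise entry 8 is completed
-- and 8 goes up. Each has `6 n` cells to cross, hence `12 n` turns. A partner beyond pointer 8 is
-- met later with the roles exchanged, so the partner is the smaller of both pointers and the pair
-- is tried in both orders.
tries process advance merge : Code
tries   = set 11 (cappedᴺ (var 8) (var 9)) ▸ tryPair 8 11 ▸ tryPair 11 8
process = tries ▸ putᴿ 3 (cell 4 (var 8)) (varᴿ 4) ▸ set 8 (increment 8)
advance = cond (var 8 `< rowLength) (cond (`not (fits 8 9) `∧ lit 0 `< var 9) (set 9 (var 9 `∸ lit 1)) process) nop
merge   = set 8 (lit 0) ▸ set 9 (rowLength `∸ lit 1) ▸ setᴿ 4 (cast (lit 0)) ▸ loop 10 (multipleOfOrder 12) advance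

liftCells mergeCells : Cells
liftCells  = (ℕ-var , 0) ∷ (ℕ-var , 4) ∷ (ℕ-var , 5) ∷ (ℝ-array , 3) ∷ (ℝ-var , 2) ∷ []
mergeCells = (ℕ-var , 0) ∷ (ℕ-var , 4) ∷ (ℝ-var , 0) ∷ (ℝ-var , 1) ∷ (ℝ-array , 1) ∷ (ℝ-array , 4) ∷ (ℝ-array , 5) ∷ []

∧-false : ∀ {b c} → b ∧ c ≡ false → b ≡ true → c ≡ false
∧-false e ≡-refl = e

module TablePrograms (ℝ : Reals) where
  open Reals ℝ using (Carrier; _≈_; _<_; _≤_; _+_; _-_; -_; 0#; fromℕ; _<?_; refl; sym; trans; reflexive; +-congˡ; +-comm)
  open OrderedFieldProperties ℝ
  open Execution {ℝ}
  open ArrayPrograms ℝ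
  open State

  <?-complete : ∀ {x y} → x < y → ⌊ x <? y ⌋ ≡ true
  <?-complete {x} {y} p with x <? y
  ... | yes _ = ≡-refl
  ... | no ¬p = ⊥-elim (¬p p)

  ≮?-complete : ∀ {x y} → y ≤ x → not ⌊ x <? y ⌋ ≡ true
  ≮?-complete {x} {y} p with x <? y
  ... | yes q = ⊥-elim (<⇒≱ q p)
  ... | no _  = ≡-refl

  fromℕ-cancel-≤ : ∀ {a b} → fromℕ a ≤ fromℕ b → a ℕ.≤ b
  fromℕ-cancel-≤ {a} {b} p with a ℕ.≤? b
  ... | yes a≤b = a≤b
  ... | no a≰b = ⊥-elim (<⇒≱ (fromℕ-mono-< (ℕ.≰⇒> a≰b)) p)

  lowering : ℕ → ℕ → ℕ → ℕ
  lowering n b κ = capped ((b ℕ.+ 2 ℕ.* n) ∸ κ ℕ.* n) (6 ℕ.* n ∸ 1)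

  module _ (n : ℕ) (x : ℕ → Carrier) (ε : Carrier) where
    open Specifications ℝ (6 ℕ.* n) x (lowering n) ε

    cell-take : ∀ {κ z F b y w} → κ ℕ.< 5 → w ≈ fromℕ z → 0# < F (lowering n b κ) → fromℕ 2 ≤ fromℕ κ + w →
                y < F (lowering n b κ) + fromℕ κ - fromℕ 2 → LiftedCell κ z F b y →
                LiftedCell (suc κ) z F b (F (lowering n b κ) + fromℕ κ - fromℕ 2)
    cell-take {κ} {z} {F} {b} {y} {w} κ<5 w≈z 0<f 2≤κ+w y< (liftedCell nonneg sound complete) = liftedCell
      (≤-trans nonneg (<⇒≤ y<)) (λ _ → κ , κ<5 , 0<f , 2≤κ+z , restore) complete′
      where
      y′ : Carrier
      y′ = F (lowering n b κ) + fromℕ κ - fromℕ 2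
      restore : y′ + fromℕ 2 ≈ F (lowering n b κ) + fromℕ κ
      restore = linear (F (lowering n b κ) ∷ fromℕ κ ∷ []) (λ f k → [] ⊢ f :+ k :- # 2 :+ # 2 :≈ f :+ k) tt
      2≤κ+z : 2 ℕ.≤ κ ℕ.+ z
      2≤κ+z = fromℕ-cancel-≤ {2} {κ ℕ.+ z} (≤-trans 2≤κ+w (≈⇒≤ (trans (+-congˡ w≈z) (sym (fromℕ-+ κ z)))))
      complete′ : ∀ {κ′} → κ′ ℕ.< suc κ → 0# < F (lowering n b κ′) → 2 ℕ.≤ κ′ ℕ.+ z → F (lowering n b κ′) + fromℕ κ′ ≤ y′ + fromℕ 2
      complete′ (s≤s κ′≤κ) 0<f′ 2≤ with ℕ.m≤n⇒m<n∨m≡n κ′≤κ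
      ... | inj₁ κ′<κ   = ≤-trans (complete κ′<κ 0<f′ 2≤) (+-monoˡ-≤ _ (<⇒≤ y<))
      ... | inj₂ ≡-refl = ≈⇒≤ (sym restore)

    cell-skip : ∀ {κ z F b y w} → w ≈ fromℕ z →
                (0# < F (lowering n b κ) → fromℕ 2 ≤ fromℕ κ + w → F (lowering n b κ) + fromℕ κ - fromℕ 2 ≤ y) →
                LiftedCell κ z F b y → LiftedCell (suc κ) z F b y
    cell-skip {κ} {z} {F} {b} {y} w≈z worse (liftedCell nonneg sound complete) = liftedCell nonneg sound complete′
      where
      complete′ : ∀ {κ′} → κ′ ℕ.< suc κ → 0# < F (lowering n b κ′) → 2 ℕ.≤ κ′ ℕ.+ z → F (lowering n b κ′) + fromℕ κ′ ≤ y + fromℕ 2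
      complete′ (s≤s κ′≤κ) 0<f′ 2≤ with ℕ.m≤n⇒m<n∨m≡n κ′≤κ
      ... | inj₁ κ′<κ   = complete κ′<κ 0<f′ 2≤
      ... | inj₂ ≡-refl = linear (F (lowering n b κ) ∷ fromℕ κ ∷ y ∷ [])
        (λ f k y → f :+ k :- # 2 :≤ y ∷ [] ⊢ f :+ k :≤ y :+ # 2)
        (worse 0<f′ (≤-trans (fromℕ-mono-≤ 2≤) (≈⇒≤ (trans (fromℕ-+ κ z) (+-congˡ (sym w≈z))))))

    LiftContext : (p c z : ℕ) (F : ℕ → Carrier) → State ℝ → Set
    LiftContext p c z F τ = nvar τ 0 ≡ n × nvar τ 4 ≡ p × nvar τ 5 ≡ c × rarr τ 3 ≡ F × rvar τ 2 ≈ fromℕ z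

    liftContext-kept : ∀ {p c z F} code τ →
      keepsAll liftCells code ≡ true →
      LiftContext p c z F τ → LiftContext p c z F (exec code τ)
    liftContext-kept code τ e (0≡ , 4≡ , 5≡ , 3≡ , 2≈)
      with frame-all liftCells code τ e
    ... | f₀ , f₄ , f₅ , f₃ , f₂ , _ = ≡-trans f₀ 0≡ , ≡-trans f₄ 4≡ , ≡-trans f₅ 5≡ , ≡-trans f₃ 3≡ , trans (reflexive f₂) 2≈

    child-row : (ℕ → Carrier) → ℕ → ℕ → Carrier
    child-row F c a = F (rowCell n c a)

    relax-step : ∀ {p c z F b} κ τ → κ ℕ.< 5 → nvar τ 7 ≡ κ → nvar τ 3 ≡ b → LiftContext p c z F τ →
                 LiftedCell κ z (child-row F c) b (rarr τ 5 b) →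
                 LiftedCell (suc κ) z (child-row F c) b (rarr (exec relax τ) 5 b)
    relax-step {z = z} κ τ κ<5 ≡-refl ≡-refl (≡-refl , _ , ≡-refl , ≡-refl , w≈z) lc =
      cond-rule (λ υ → LiftedCell (suc κ) z (child-row (rarr τ 3) (nvar τ 5)) b (rarr υ 5 b)) improves (putᴿ 5 (var 3) raised) nop
        (exec (setᴿ 3 (3 atᴿ cell 5 loweredᴺ)) τ)
        (λ e → let e₁ , e₂ = ∧-true {⌊ 0# <? f ⌋} e
                   e₃ , e₄ = ∧-true {not ⌊ fromℕ κ + rvar τ 2 <? fromℕ 2 ⌋} e₂ in
          ≡-subst (LiftedCell (suc κ) z (child-row (rarr τ 3) (nvar τ 5)) b) (≡-sym (update-hit (rarr τ 5) {b} _ ≡-refl))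
            (cell-take {z = z} κ<5 w≈z (<?-true e₁) (<?-false (not-true e₃)) (<?-true e₄) lc))
        (λ e → cell-skip {z = z} w≈z (λ 0<f 2≤ → <?-false (∧-false (∧-false {⌊ 0# <? f ⌋} e (<?-complete 0<f)) (≮?-complete 2≤))) lc)
      where
      b : ℕ
      b = nvar τ 3
      f : Carrier
      f = rarr τ 3 (rowCell (nvar τ 0) (nvar τ 5) (lowering (nvar τ 0) b κ))

    lift-cell : ∀ {p c z F b} τ → b ℕ.< 6 ℕ.* n → nvar τ 3 ≡ b → LiftContext p c z F τ →
                let τ′ = exec liftBody τ in
                rarr τ′ 4 ≡ update (rarr τ 4) b (F (rowCell n p b)) × (∀ {b′} → b ≢ b′ → rarr τ′ 5 b′ ≡ rarr τ 5 b′) ×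
                LiftedCell 5 z (child-row F c) b (rarr τ′ 5 b)
    lift-cell {p} {c} {z} {F} {b} τ b<N 3≡ ctx = proj₁ (proj₂ (proj₂ done)) , proj₁ (proj₂ (proj₂ (proj₂ done))) , proj₂ (proj₂ (proj₂ (proj₂ done)))
      where
      start : State ℝ
      start = exec (putᴿ 4 (var 3) (3 atᴿ cell 4 (var 3)) ▸ putᴿ 5 (var 3) (cast (lit 0))) τ
      Inner : ℕ → State ℝ → Set
      Inner κ υ = nvar υ 3 ≡ b × LiftContext p c z F υ × rarr υ 4 ≡ update (rarr τ 4) b (F (rowCell n p b)) ×
        (∀ {b′} → b ≢ b′ → rarr υ 5 b′ ≡ rarr τ 5 b′) × LiftedCell κ z (child-row F c) b (rarr υ 5 b)
      copied : nvar τ 3 ≡ b → LiftContext p c z F τ → rarr start 4 ≡ update (rarr τ 4) b (F (rowCell n p b))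
      copied ≡-refl (≡-refl , ≡-refl , _ , ≡-refl , _) = ≡-refl
      cleared : ∀ {b′} → nvar τ 3 ≡ b → b ≢ b′ → rarr start 5 b′ ≡ rarr τ 5 b′
      cleared ≡-refl b≢b′ = update-miss (rarr τ 5) {nvar τ 3} _ b≢b′
      zero-cell : nvar τ 3 ≡ b → rarr start 5 b ≡ 0#
      zero-cell ≡-refl = update-hit (rarr τ 5) {nvar τ 3} _ ≡-refl
      initial : ∀ {y} → y ≡ 0# → LiftedCell 0 z (child-row F c) b y
      initial ≡-refl = liftedCell ≤-refl (λ p → ⊥-elim (<-irrefl p)) (λ ())
      done : Inner 5 (exec liftBody τ)
      done = loop-rule Inner 7 (constant 5) relax start ≡-refl
        (3≡ , liftContext-kept {z = z} {F = F} (putᴿ 4 (var 3) (3 atᴿ cell 4 (var 3)) ▸ putᴿ 5 (var 3) (cast (lit 0)) ▸ set 7 (lit 0)) τ ≡-refl ctx ,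
         copied 3≡ ctx , (λ b≢b′ → cleared 3≡ b≢b′) , initial (zero-cell 3≡))
        (λ { κ υ κ<5 7≡ (3≡υ , ctxυ , 4≡ , others , lc) →
             ≡-trans (frame ℕ-var 3 (relax ▸ set 7 (increment 7)) υ ≡-refl) 3≡υ ,
             liftContext-kept {z = z} {F = F} (relax ▸ set 7 (increment 7)) υ ≡-refl ctxυ ,
             ≡-trans (frame ℝ-array 4 (relax ▸ set 7 (increment 7)) υ ≡-refl) 4≡ ,
             (λ {b′} b≢b′ → ≡-trans (relax-other υ 3≡υ b≢b′) (others b≢b′)) ,
             relax-step {z = z} κ υ κ<5 7≡ 3≡υ ctxυ lc })
        where
        relax-other : ∀ {b′} υ → nvar υ 3 ≡ b → b ≢ b′ → rarr (exec relax υ) 5 b′ ≡ rarr υ 5 b′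
        relax-other {b′} υ ≡-refl b≢b′ = cond-rule (λ υ′ → rarr υ′ 5 b′ ≡ rarr υ 5 b′) improves (putᴿ 5 (var 3) raised) nop
          (exec (setᴿ 3 (3 atᴿ cell 5 loweredᴺ)) υ)
          (λ _ → update-miss (rarr υ 5) {nvar υ 3} _ b≢b′) (λ _ → ≡-refl)

    lift-correct : ∀ {p c z F} τ → LiftContext p c z F τ → let τ′ = exec lift τ in
                   (∀ {b} → b ℕ.< 6 ℕ.* n → rarr τ′ 4 b ≡ F (rowCell n p b)) × IsLifted z (child-row F c) (rarr τ′ 5)
    lift-correct {p} {c} {z} {F} τ ctx = finish (loop-rule Outer 3 (multipleOfOrder 6) liftBody τ ≡-refl
        (liftContext-kept {z = z} {F = F} (set 3 (lit 0)) τ ≡-refl ctx , (λ ()) , (λ ()))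
        (λ b υ b< 3≡ (ctxυ , K≡ , lifted) → outer-step b υ (≡-subst (λ k → b ℕ.< 6 ℕ.* k) (proj₁ ctx) b<) 3≡ ctxυ K≡ lifted))
      where
      Outer : ℕ → State ℝ → Set
      Outer k υ = LiftContext p c z F υ × (∀ {b} → b ℕ.< k → rarr υ 4 b ≡ F (rowCell n p b)) ×
        (∀ {b} → b ℕ.< k → LiftedCell 5 z (child-row F c) b (rarr υ 5 b))
      finish : Outer (6 ℕ.* nvar τ 0) (exec lift τ) →
        (∀ {b} → b ℕ.< 6 ℕ.* n → rarr (exec lift τ) 4 b ≡ F (rowCell n p b)) × IsLifted z (child-row F c) (rarr (exec lift τ) 5)
      finish (_ , K≡ , lifted) = (λ b< → K≡ (resize b<)) , (λ b< → lifted (resize b<))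
        where
        resize : ∀ {b} → b ℕ.< 6 ℕ.* n → b ℕ.< 6 ℕ.* nvar τ 0
        resize {b} = ≡-subst (λ k → b ℕ.< 6 ℕ.* k) (≡-sym (proj₁ ctx))
      outer-step : ∀ b υ → b ℕ.< 6 ℕ.* n → nvar υ 3 ≡ b → LiftContext p c z F υ →
        (∀ {b′} → b′ ℕ.< b → rarr υ 4 b′ ≡ F (rowCell n p b′)) →
        (∀ {b′} → b′ ℕ.< b → LiftedCell 5 z (child-row F c) b′ (rarr υ 5 b′)) →
        Outer (suc b) (exec (set 3 (increment 3)) (exec liftBody υ))
      outer-step b υ b<N 3≡ ctxυ K≡ lifted with lift-cell {z = z} υ b<N 3≡ ctxυ
      ... | 4≡ , others , lc = liftContext-kept {z = z} {F = F} (liftBody ▸ set 3 (increment 3)) υ ≡-refl ctxυ , K≡′ , lifted′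
        where
        K≡′ : ∀ {b′} → b′ ℕ.< suc b → rarr (exec liftBody υ) 4 b′ ≡ F (rowCell n p b′)
        K≡′ {b′} (s≤s b′≤b) with ℕ.m≤n⇒m<n∨m≡n b′≤b
        ... | inj₂ ≡-refl = ≡-trans (≡-cong (λ f → f b) 4≡) (update-hit (rarr υ 4) {b} _ ≡-refl)
        ... | inj₁ b′<b = ≡-trans (≡-cong (λ f → f b′) 4≡)
                (≡-trans (update-miss (rarr υ 4) {b} _ (λ eq → ℕ.<⇒≢ b′<b (≡-sym eq))) (K≡ b′<b))
        lifted′ : ∀ {b′} → b′ ℕ.< suc b → LiftedCell 5 z (child-row F c) b′ (rarr (exec liftBody υ) 5 b′)
        lifted′ {b′} (s≤s b′≤b) with ℕ.m≤n⇒m<n∨m≡n b′≤b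
        ... | inj₂ ≡-refl = lc
        ... | inj₁ b′<b = ≡-subst (LiftedCell 5 z (child-row F c) b′) (≡-sym (others (λ eq → ℕ.<⇒≢ b′<b (≡-sym eq)))) (lifted b′<b)

    record Offered (r : Carrier) (K H : ℕ → Carrier) (i j : ℕ) (y y′ : Carrier) : Set where
      constructor offered
      field
        larger : y ≤ y′
        origin : y′ ≡ y ⊎ (Compatible r K H i j × y′ ≤ K i × y′ ≤ H j)
        atLeast : Compatible r K H i j → ∀ {L} → L ≤ K i → L ≤ H j → L ≤ y′

    tryPair-correct : ∀ {r K H} u w τ → rvar τ 0 ≡ ε → rvar τ 1 ≡ r → rarr τ 1 ≡ x → rarr τ 4 ≡ K → rarr τ 5 ≡ H →
                      Offered r K H (nvar τ u) (nvar τ w) (rvar τ 4) (rvar (exec (tryPair u w) τ) 4)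
    tryPair-correct u w τ ≡-refl ≡-refl ≡-refl ≡-refl ≡-refl =
      cond-rule (λ υ → Offered r K H i j y (rvar υ 4)) (betters u w) (takeLesser u w) nop τ
        (λ e → let e₁ , e′ = ∧-true {⌊ rarr τ 1 i + rarr τ 1 j <? rvar τ 0 + (r + r) ⌋} e
                   e₂ , e″ = ∧-true {⌊ r + r <? rvar τ 0 + (K i + H j) ⌋} e′
                   e₃ , e₄ = ∧-true {⌊ y <? K i ⌋} e″ in
          cond-rule (λ υ → Offered r K H i j y (rvar υ 4)) ((4 atᴿ var u) `<ᴿ (5 atᴿ var w))
              (setᴿ 4 (4 atᴿ var u)) (setᴿ 4 (5 atᴿ var w)) τ
            (λ q → offered (<⇒≤ (<?-true e₃)) (inj₂ ((<?-true e₁ , <?-true e₂) , ≤-refl , <⇒≤ (<?-true q))) (λ _ p _ → p))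
            (λ q → offered (<⇒≤ (<?-true e₄)) (inj₂ ((<?-true e₁ , <?-true e₂) , <?-false q , ≤-refl)) (λ _ _ p → p)))
        (λ e → offered ≤-refl (inj₁ ≡-refl) (λ (c₁ , c₂) {L} p q →
          declined (∧-false {⌊ r + r <? rvar τ 0 + (K i + H j) ⌋}
            (∧-false {⌊ rarr τ 1 i + rarr τ 1 j <? rvar τ 0 + (r + r) ⌋} e (<?-complete c₁)) (<?-complete c₂)) p q))
      where
      i j : ℕ
      i = nvar τ u
      j = nvar τ w
      r y : Carrier
      r = rvar τ 1
      y = rvar τ 4
      K H : ℕ → Carrier
      K = rarr τ 4
      H = rarr τ 5
      declined : ⌊ y <? K i ⌋ ∧ ⌊ y <? H j ⌋ ≡ false → ∀ {L} → L ≤ K i → L ≤ H j → L ≤ y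
      declined e p q with y <? K i
      ... | no ¬a = ≤-trans p (≮⇒≥ ¬a)
      ... | yes _ = ≤-trans q (<?-false e)

    module _ {r : Carrier} {K H : ℕ → Carrier}
             (x-mono : ∀ {a b} → a ℕ.≤ b → b ℕ.< 6 ℕ.* n → x a ≤ x b)
             (K-mono : ∀ {a b} → a ℕ.≤ b → b ℕ.< 6 ℕ.* n → K a ≤ K b)
             (H-mono : ∀ {a b} → a ℕ.≤ b → b ℕ.< 6 ℕ.* n → H a ≤ H b) where

      private
        N : ℕ
        N = 6 ℕ.* n

      Exhausted : ℕ → ℕ → Set
      Exhausted a s = ∀ {j} → s ℕ.< j → j ℕ.< N → ε + (r + r) ≤ x a + x j

      -- Only pairs containing `a` are new. A compatible partner `j ≤ a` is at most `b = min a s`,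
      -- since everything above `s` has been ruled out. Replacing `j` by `b` respects the upper
      -- condition and, by monotonicity of `K` and `H`, improves the lower condition and the
      -- minimum. So the pairs (a, b) and (b, a) stand for all new ones.
      best-step : ∀ {a s y y₁ y₂} → a ℕ.< N → s ℕ.< N → Exhausted a s → x a + x s < ε + (r + r) ⊎ s ≡ 0 →
                  IsBest r K H a y → Offered r K H a (capped a s) y y₁ → Offered r K H (capped a s) a y₁ y₂ →
                  IsBest r K H (suc a) y₂
      best-step {a} {s} {y} {y₁} {y₂} a<N s<N exhausted close (isBest nonneg sound complete)
                (offered y≤y₁ origin₁ least₁) (offered y₁≤y₂ origin₂ least₂) =
        isBest (≤-trans nonneg (≤-trans y≤y₁ y₁≤y₂)) sound′ complete′
        where
        b : ℕ
        b = capped a s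
        b<1+a : b ℕ.< suc a
        b<1+a = s≤s (capped-bound′ a s)
        Source : Carrier → Set
        Source y = ∃₂ λ i j → i ℕ.< suc a × j ℕ.< suc a × Compatible r K H i j × y ≤ K i × y ≤ H j
        old : 0# < y → Source y
        old p = let i , j , i< , j< , rest = sound p in i , j , ℕ.m<n⇒m<1+n i< , ℕ.m<n⇒m<1+n j< , rest
        inherit : ∀ {u v} → v ≡ u → (0# < u → Source u) → 0# < v → Source v
        inherit ≡-refl f = f
        source₁ : 0# < y₁ → Source y₁
        source₁ p = [ (λ eq → inherit eq old p) , (λ (c , k , h) → a , b , ℕ.≤-refl , b<1+a , c , k , h) ]′ origin₁
        sound′ : 0# < y₂ → Source y₂
        sound′ p = [ (λ eq → inherit eq source₁ p) , (λ (c , k , h) → b , a , b<1+a , ℕ.≤-refl , c , k , h) ]′ origin₂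
        below-pointer : ∀ {j} → j ℕ.≤ a → x a + x j < ε + (r + r) → j ℕ.≤ b
        below-pointer {j} j≤a fit = capped-greatest a s j≤a (ℕ.≮⇒≥ (λ s<j → <⇒≱ fit (exhausted s<j (ℕ.≤-<-trans j≤a a<N))))
        fits-pointer : ∀ {j} → j ℕ.≤ b → x a + x j < ε + (r + r) → x a + x b < ε + (r + r)
        fits-pointer {j} j≤b fit =
          [ (λ p → ≤-<-trans (+-monoʳ-≤ (x a) (x-mono (capped-bound a s) s<N)) p)
          -- A pointer stuck at 0 may fail to fit, but then `j` and `b` are both 0, and the assumed
          -- pair is the one being tried.
          , (λ s≡0 → ≡-subst (λ k → x a + x k < ε + (r + r))
              (≡-trans (ℕ.n≤0⇒n≡0 (ℕ.≤-trans j≤b (b≤0 s≡0))) (≡-sym (ℕ.n≤0⇒n≡0 (b≤0 s≡0)))) fit) ]′ close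
          where
          b≤0 : s ≡ 0 → b ℕ.≤ 0
          b≤0 s≡0 = ≡-subst (b ℕ.≤_) s≡0 (capped-bound a s)
        b<N : b ℕ.< N
        b<N = ℕ.≤-<-trans (capped-bound′ a s) a<N
        with-left : ∀ {j L} → j ℕ.≤ a → Compatible r K H a j → L ≤ K a → L ≤ H j → L ≤ y₁
        with-left j≤a (fit , low) p q = least₁
          (fits-pointer j≤b fit , <-≤-trans low (+-monoʳ-≤ ε (+-monoʳ-≤ (K a) H≤H))) p (≤-trans q H≤H)
          where
          j≤b = below-pointer j≤a fit
          H≤H = H-mono j≤b b<N
        with-right : ∀ {i L} → i ℕ.≤ a → Compatible r K H i a → L ≤ K i → L ≤ H a → L ≤ y₂
        with-right {i} i≤a (fit , low) p q = least₂
          (<-resp (+-comm _ _) refl (fits-pointer i≤b fit′) , <-≤-trans low (+-monoʳ-≤ ε (+-monoˡ-≤ (H a) K≤K))) (≤-trans p K≤K) q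
          where
          fit′ : x a + x i < ε + (r + r)
          fit′ = <-resp (+-comm _ _) refl fit
          i≤b = below-pointer i≤a fit′
          K≤K = K-mono i≤b b<N
        complete′ : ∀ {i j L} → i ℕ.< suc a → j ℕ.< suc a → Compatible r K H i j → 0# < K i → 0# < H j → L ≤ K i → L ≤ H j → L ≤ y₂
        complete′ (s≤s i≤a) (s≤s j≤a) c 0<K 0<H p q with ℕ.m≤n⇒m<n∨m≡n i≤a | ℕ.m≤n⇒m<n∨m≡n j≤a
        ... | inj₁ i<a | inj₁ j<a = ≤-trans (complete i<a j<a c 0<K 0<H p q) (≤-trans y≤y₁ y₁≤y₂)
        ... | inj₂ ≡-refl | _ = ≤-trans (with-left j≤a c p q) y₁≤y₂
        ... | inj₁ i<a | inj₂ ≡-refl = with-right i≤a c p q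

      module _ (p : ℕ) (F₀ : ℕ → Carrier) where

        MergeContext : State ℝ → Set
        MergeContext τ = nvar τ 0 ≡ n × nvar τ 4 ≡ p × rvar τ 0 ≡ ε × rvar τ 1 ≡ r × rarr τ 1 ≡ x × rarr τ 4 ≡ K × rarr τ 5 ≡ H

        mergeContext-kept : ∀ code τ → keepsAll mergeCells code ≡ true → MergeContext τ → MergeContext (exec code τ)
        mergeContext-kept code τ e (a , b , c , d , f , g , h)
          with frame-all mergeCells code τ e
        ... | a′ , b′ , c′ , d′ , f′ , g′ , h′ , _ =
          ≡-trans a′ a , ≡-trans b′ b , ≡-trans c′ c , ≡-trans d′ d , ≡-trans f′ f , ≡-trans g′ g , ≡-trans h′ h

        -- `progress` counts moves: until `a` has reached `N`, the turns made are `a` steps up and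
        -- `N − 1 − s` steps down. After `2 N` turns this would put `a` beyond `N`.
        record Pointers (k a s : ℕ) : Set where
          constructor pointers
          field
            s<N       : s ℕ.< N
            a≤N       : a ℕ.≤ N
            progress  : a ≡ N ⊎ a ℕ.+ N ≡ k ℕ.+ suc s
            exhausted : a ℕ.< N → Exhausted a s

        record Rows (a : ℕ) (F : ℕ → Carrier) : Set where
          constructor rows
          field
            merged : ∀ {A} → A ℕ.< a → IsBest r K H (suc A) (F (rowCell n p A))
            others : ∀ {v A} → v ≢ p → A ℕ.< N → F (rowCell n v A) ≡ F₀ (rowCell n v A)

        rows-put : ∀ {a F y} → a ℕ.< N → IsBest r K H (suc a) y → Rows a F → Rows (suc a) (update F (rowCell n p a) y)
        rows-put {a} {F} {y} a<N best (rows merged others) = rows merged′ others′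
          where
          merged′ : ∀ {A} → A ℕ.< suc a → IsBest r K H (suc A) (update F (rowCell n p a) y (rowCell n p A))
          merged′ {A} (s≤s A≤a) with ℕ.m≤n⇒m<n∨m≡n A≤a
          ... | inj₂ ≡-refl = ≡-subst (IsBest r K H (suc a)) (≡-sym (update-hit F {rowCell n p a} y ≡-refl)) best
          ... | inj₁ A<a = ≡-subst (IsBest r K H (suc A)) (≡-sym (update-miss F {rowCell n p a} y
                  (λ eq → ℕ.<⇒≢ A<a (≡-sym (ℕ.+-cancelˡ-≡ (p ℕ.* N) a A eq))))) (merged A<a)
          others′ : ∀ {v A} → v ≢ p → A ℕ.< N → update F (rowCell n p a) y (rowCell n v A) ≡ F₀ (rowCell n v A)
          others′ {v} {A} v≢p A<N = ≡-trans (update-miss F {rowCell n p a} y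
            (λ eq → v≢p (≡-sym (proj₁ (flat-injective {N} {a} {A} {p} {v} a<N A<N eq))))) (others v≢p A<N)

        Merging : ℕ → State ℝ → Set
        Merging k τ = MergeContext τ × Pointers k (nvar τ 8) (nvar τ 9) × IsBest r K H (nvar τ 8) (rvar τ 4) × Rows (nvar τ 8) (rarr τ 3)

        retreat : ∀ {k a s} → a ℕ.< N → ε + (r + r) ≤ x a + x s → 0 ℕ.< s → Pointers k a s → Pointers (suc k) a (s ∸ 1)
        retreat {k} {a} {suc s} a<N far _ (pointers s<N a≤N progress exhausted) =
          pointers (ℕ.<-trans ℕ.≤-refl s<N) a≤N
            ([ inj₁ , (λ eq → inj₂ (≡-trans eq (ℕ.+-suc k (suc s)))) ]′ progress) exhausted′
          where
          exhausted′ : a ℕ.< N → Exhausted a s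
          exhausted′ _ {j} s<j j<N with ℕ.m≤n⇒m<n∨m≡n s<j
          ... | inj₁ 1+s<j  = exhausted a<N 1+s<j j<N
          ... | inj₂ ≡-refl = far

        forward : ∀ {k a s} → a ℕ.< N → Pointers k a s → Pointers (suc k) (a ℕ.+ 1) s
        forward {k} {a} {s} a<N (pointers s<N a≤N progress exhausted) = ≡-subst (λ a′ → Pointers (suc k) a′ s) (ℕ.+-comm 1 a)
          (pointers s<N a<N ([ (λ eq → ⊥-elim (ℕ.<-irrefl eq a<N)) , (λ eq → inj₂ (≡-cong suc eq)) ]′ progress)
            -- Candidates increase, so a partner too large for `a` is too large for `a + 1`.
            (λ 1+a<N s<j j<N → ≤-trans (exhausted a<N s<j j<N) (+-monoˡ-≤ _ (x-mono (ℕ.n≤1+n a) 1+a<N))))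

        process-correct : ∀ {k} τ → nvar τ 8 ℕ.< N → x (nvar τ 8) + x (nvar τ 9) < ε + (r + r) ⊎ nvar τ 9 ≡ 0 →
                          Merging k τ → Merging (suc k) (exec process τ)
        process-correct {k} τ a<N close (ctx , ptr , best , rws) =
          mergeContext-kept process τ ≡-refl ctx ,
          ≡-subst₂ (Pointers (suc k)) (≡-sym 8≡) (≡-sym (frame ℕ-var 9 process τ ≡-refl)) (forward a<N ptr) ,
          ≡-subst (λ a → IsBest r K H a (rvar υ 4)) (≡-trans (ℕ.+-comm 1 (nvar τ 8)) (≡-sym 8≡)) best′ ,
          ≡-subst₂ Rows (≡-trans (ℕ.+-comm 1 (nvar τ 8)) (≡-sym 8≡)) (≡-sym written) (rows-put a<N best′ rws)
          where
          open Pointers ptr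
          τ₁ τ₂ υ : State ℝ
          τ₁ = exec (set 11 (cappedᴺ (var 8) (var 9))) τ
          τ₂ = exec (tryPair 8 11) τ₁
          υ  = exec tries τ
          8≡ : nvar (exec process τ) 8 ≡ nvar τ 8 ℕ.+ 1
          8≡ = ≡-cong (ℕ._+ 1) (frame ℕ-var 8 tries τ ≡-refl)
          offer : ∀ u w σ → MergeContext σ → Offered r K H (nvar σ u) (nvar σ w) (rvar σ 4) (rvar (exec (tryPair u w) σ) 4)
          offer u w σ (_ , _ , c , d , f , g , h) = tryPair-correct u w σ c d f g h
          first : Offered r K H (nvar τ 8) (capped (nvar τ 8) (nvar τ 9)) (rvar τ 4) (rvar τ₂ 4)
          first = offer 8 11 τ₁ (mergeContext-kept (set 11 (cappedᴺ (var 8) (var 9))) τ ≡-refl ctx)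
          second : Offered r K H (capped (nvar τ 8) (nvar τ 9)) (nvar τ 8) (rvar τ₂ 4) (rvar υ 4)
          second = ≡-subst₂ (λ i j → Offered r K H i j (rvar τ₂ 4) (rvar υ 4))
            (frame ℕ-var 11 (tryPair 8 11) τ₁ ≡-refl) (frame ℕ-var 8 (tryPair 8 11) τ₁ ≡-refl)
            (offer 11 8 τ₂ (mergeContext-kept (tryPair 8 11) τ₁ ≡-refl
              (mergeContext-kept (set 11 (cappedᴺ (var 8) (var 9))) τ ≡-refl ctx)))
          best′ : IsBest r K H (suc (nvar τ 8)) (rvar υ 4)
          best′ = best-step a<N s<N (exhausted a<N) close best first second
          written : rarr (exec process τ) 3 ≡ update (rarr τ 3) (rowCell n p (nvar τ 8)) (rvar υ 4)
          written = ≡-cong₂ (λ F i → update F i (rvar υ 4)) (frame ℝ-array 3 tries τ ≡-refl) index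
            where
            index : nvar υ 4 ℕ.* (6 ℕ.* nvar υ 0) ℕ.+ nvar υ 8 ≡ rowCell n p (nvar τ 8)
            index = ≡-cong₂ ℕ._+_ (≡-cong₂ (λ v k → v ℕ.* (6 ℕ.* k))
                (≡-trans (frame ℕ-var 4 tries τ ≡-refl) (proj₁ (proj₂ ctx))) (≡-trans (frame ℕ-var 0 tries τ ≡-refl) (proj₁ ctx)))
              (frame ℕ-var 8 tries τ ≡-refl)

        advance-correct : ∀ k τ → Merging k τ → Merging (suc k) (exec advance τ)
        advance-correct k τ (ctx , ptr , best , rws) =
          cond-rule (Merging (suc k)) (var 8 `< rowLength) (cond (`not (fits 8 9) `∧ lit 0 `< var 9) (set 9 (var 9 `∸ lit 1)) process) nop τ
            (λ e → let a<N = below e in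
              cond-rule (Merging (suc k)) (`not (fits 8 9) `∧ lit 0 `< var 9) (set 9 (var 9 `∸ lit 1)) process τ
                (λ e → let e₁ , e₂ = ∧-true {not ⌊ rarr τ 1 (nvar τ 8) + rarr τ 1 (nvar τ 9) <? rvar τ 0 + (rvar τ 1 + rvar τ 1) ⌋} e in
                  ctx , retreat a<N (far ctx (not-true e₁)) (ℕ.<ᵇ⇒< 0 (nvar τ 9) (≡true⇒T e₂)) ptr , best , rws)
                (λ e → process-correct τ a<N (near ctx e) (ctx , ptr , best , rws)))
            (λ e → ctx , finished (λ a<N → above e a<N) , best , rws)
          where
          below : (nvar τ 8 <ᵇ 6 ℕ.* nvar τ 0) ≡ true → nvar τ 8 ℕ.< N
          below e = ≡-subst (λ i → nvar τ 8 ℕ.< 6 ℕ.* i) (proj₁ ctx) (ℕ.<ᵇ⇒< (nvar τ 8) (6 ℕ.* nvar τ 0) (≡true⇒T e))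
          above : (nvar τ 8 <ᵇ 6 ℕ.* nvar τ 0) ≡ false → nvar τ 8 ℕ.< N → ⊥
          above e a<N with ≡-trans (≡-sym e) (<ᵇ-true (≡-subst (λ i → nvar τ 8 ℕ.< 6 ℕ.* i) (≡-sym (proj₁ ctx)) a<N))
          ... | ()
          finished : (nvar τ 8 ℕ.< N → ⊥) → Pointers (suc k) (nvar τ 8) (nvar τ 9)
          finished ¬a<N = pointers (Pointers.s<N ptr) (Pointers.a≤N ptr)
            (inj₁ (ℕ.≤-antisym (Pointers.a≤N ptr) (ℕ.≮⇒≥ ¬a<N))) (Pointers.exhausted ptr)
          far : MergeContext τ → ⌊ rarr τ 1 (nvar τ 8) + rarr τ 1 (nvar τ 9) <? rvar τ 0 + (rvar τ 1 + rvar τ 1) ⌋ ≡ false →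
                ε + (r + r) ≤ x (nvar τ 8) + x (nvar τ 9)
          far (_ , _ , ≡-refl , ≡-refl , ≡-refl , _) e = <?-false e
          near : MergeContext τ → not ⌊ rarr τ 1 (nvar τ 8) + rarr τ 1 (nvar τ 9) <? rvar τ 0 + (rvar τ 1 + rvar τ 1) ⌋ ∧ (0 <ᵇ nvar τ 9) ≡ false →
                 x (nvar τ 8) + x (nvar τ 9) < ε + (r + r) ⊎ nvar τ 9 ≡ 0
          near (_ , _ , ≡-refl , ≡-refl , ≡-refl , _) e with rarr τ 1 (nvar τ 8) + rarr τ 1 (nvar τ 9) <? rvar τ 0 + (rvar τ 1 + rvar τ 1)
          ... | yes q = inj₁ q
          ... | no _  = inj₂ (zero-if (nvar τ 9) e)
            where
            zero-if : ∀ s → (0 <ᵇ s) ≡ false → s ≡ 0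
            zero-if zero    _ = ≡-refl
            zero-if (suc s) ()

        merge-correct : ∀ τ → 0 ℕ.< N → MergeContext τ → rarr τ 3 ≡ F₀ →
                        IsMerged r K H (λ A → rarr (exec merge τ) 3 (rowCell n p A)) ×
                        (∀ {v A} → v ≢ p → A ℕ.< N → rarr (exec merge τ) 3 (rowCell n v A) ≡ F₀ (rowCell n v A))
        merge-correct τ 0<N ctx 3≡ = finish (loop-rule Merging 10 (multipleOfOrder 12) advance start ≡-refl
            (mergeContext-kept prologue τ ≡-refl ctx , initial (proj₁ ctx) , isBest ≤-refl (λ p → ⊥-elim (<-irrefl p)) (λ ()) ,
             rows (λ ()) (λ _ _ → ≡-cong (λ f → f _) 3≡))
            (λ k υ _ _ m → kept k υ (advance-correct k υ m)))
          where
          prologue : Code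
          prologue = set 8 (lit 0) ▸ set 9 (rowLength `∸ lit 1) ▸ setᴿ 4 (cast (lit 0)) ▸ set 10 (lit 0)
          start : State ℝ
          start = exec (set 8 (lit 0) ▸ set 9 (rowLength `∸ lit 1) ▸ setᴿ 4 (cast (lit 0))) τ
          kept : ∀ k υ → Merging (suc k) (exec advance υ) → Merging (suc k) (exec (set 10 (increment 10)) (exec advance υ))
          kept k υ (c , rest) = mergeContext-kept (set 10 (increment 10)) (exec advance υ) ≡-refl c , rest
          last+1 : suc (N ∸ 1) ≡ N
          last+1 = ℕ.m+[n∸m]≡n 0<N
          initial : nvar τ 0 ≡ n → Pointers 0 0 (6 ℕ.* nvar τ 0 ∸ 1)
          initial eq = ≡-subst (λ k → Pointers 0 0 (6 ℕ.* k ∸ 1)) (≡-sym eq)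
            (pointers (ℕ.≤-reflexive last+1) z≤n (inj₂ (≡-sym last+1))
              (λ _ {j} l<j j<N → ⊥-elim (ℕ.<⇒≱ j<N (≡-subst (ℕ._≤ j) last+1 l<j))))
          finish : Merging (12 ℕ.* nvar τ 0) (exec merge τ) →
                   IsMerged r K H (λ A → rarr (exec merge τ) 3 (rowCell n p A)) ×
                   (∀ {v A} → v ≢ p → A ℕ.< N → rarr (exec merge τ) 3 (rowCell n v A) ≡ F₀ (rowCell n v A))
          finish (_ , ptr , _ , rws) =
            (λ {A} A<N → Rows.merged rws (≡-subst (A ℕ.<_) (≡-sym (a≡N (Pointers.progress ptr))) A<N)) , Rows.others rws
            where
            a : ℕ
            a = nvar (exec merge τ) 8
            a≡N : a ≡ N ⊎ a ℕ.+ N ≡ 12 ℕ.* nvar τ 0 ℕ.+ suc (nvar (exec merge τ) 9) → a ≡ N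
            a≡N (inj₁ eq) = eq
            a≡N (inj₂ eq) = ⊥-elim (ℕ.<⇒≱ (ℕ.+-cancelʳ-< N N a (≡-subst (N ℕ.+ N ℕ.<_) (≡-sym (≡-trans eq
                (≡-trans (≡-cong (λ k → 12 ℕ.* k ℕ.+ suc (nvar (exec merge τ) 9)) (proj₁ ctx)) (≡-cong (ℕ._+ suc (nvar (exec merge τ) 9)) (ℕ.*-distribʳ-+ n 6 6)))))
                (ℕ.m<m+n (N ℕ.+ N) (s≤s z≤n)))) (Pointers.a≤N ptr))

-- The algorithm

-- Steps were recorded by round, and the newest one left is undone next.
undone : NExp
undone = var 1 `∸ lit 1 `∸ var 2

-- The root is vertex 0, so its row starts at cell 0 and its last entry is cell `6 n − 1`. A
-- tolerance that is not positive admits no rounding at all, hence the separate test on `varᴿ 0`.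
prepare contract contractAll tables answer algorithm : Code
prepare     = set 4 (3 at undone) ▸ set 5 (4 at undone) ▸ set 6 (5 at undone) ▸ setᴿ 1 (2 atᴿ var 4) ▸
              setᴿ 2 ((2 atᴿ var 5) `-ᴿ varᴿ 1 `+ᴿ (0 atᴿ var 6))
contract    = prepare ▸ lift ▸ merge
contractAll = loop 2 edgeCount contract
tables      = explore ▸ sort ▸ period ▸ singletons ▸ contractAll
answer      = cond (varᴿ 0 `<ᴿ cast (lit 2))
                (cond (cast (lit 0) `<ᴿ varᴿ 0 `∧ cast (lit 0) `<ᴿ (3 atᴿ (rowLength `∸ lit 1))) (set 0 (lit 1)) (set 0 (lit 0)))
                (set 0 (lit 1))
algorithm   = tables ▸ answer

-- Roundings of the graph and feasibility of its spanning tree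

module SpanningTrees (ℝ : Reals) {n m : ℕ} {G : Graph n m} (root : Fin n) (ω : Fin m → Reals.Carrier ℝ)
                     (h : Fin n → Reals.Carrier ℝ) (ε : Reals.Carrier ℝ) where
  open Reals ℝ using (Carrier; _<_; _+_; _-_; -_; 0#; ∣_∣; _<?_; refl; sym)
  open OrderedFieldProperties ℝ
  open Exploration {G = G} root
  open GraftedTrees ℝ G ω h
  open Forests ℝ {G = G} root ω h

  -- This builds the rooted spanning tree without the program: `rigid` needs it when the tolerance
  -- is at least 2, where no claim is made about the tables.
  plant-all : ∀ {g T} → Valid g → All (λ s → ∃ (Slope s)) g → Spans g T → ∃ λ T′ → Spans [] T′
  plant-all {T = T} [] _ F = T , F
  plant-all v@(_ ∷ valid) ((z , slope) ∷ slopes) F = plant-all valid slopes (spans-plant v F z slope)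

  module _ {T : Forest} (F : Spans [] T) where

    proper-root : Proper (T root)
    proper-root = Spans.proper F (here ≡-refl)

    spanning-vertices : ∀ u → Vertex (T root) u
    spanning-vertices u with Spans.covers F u
    ... | _ , here ≡-refl , p = p

    spanning-edges : ∀ e → Edge (T root) e
    spanning-edges e with Spans.accounts F e
    ... | inj₂ (_ , here ≡-refl , p) = p

  within⇒∣∣< : ∀ {a b} → a < b + ε → b < a + ε → ∣ a - b ∣ < ε
  within⇒∣∣< {a} {b} p q with a - b <? 0#
  ... | yes _ = linear (a ∷ b ∷ (a - b) ∷ (- (a - b)) ∷ ε ∷ [])
    (λ a b d -d ε → b :< a :+ ε ∷ a :- b :≈ d ∷ d :+ -d :≈ # 0 ∷ [] ⊢ -d :< ε) (q , refl , Reals.-‿inverseʳ ℝ (a - b))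
  ... | no _  = linear (a ∷ b ∷ ε ∷ []) (λ a b ε → a :< b :+ ε ∷ [] ⊢ a :- b :< ε) p

  ∣∣<⇒within : ∀ {a b} → ∣ a - b ∣ < ε → a < b + ε × b < a + ε
  ∣∣<⇒within {a} {b} p with a - b <? 0#
  ... | yes q =
    linear (a ∷ b ∷ (- (a - b)) ∷ ε ∷ []) (λ a b -d ε → -d :< ε ∷ a :- b :< # 0 ∷ a :- b :< # 0 ∷ # 0 :≈ a :- b :+ -d ∷ [] ⊢ a :< b :+ ε)
      (p , q , q , sym (Reals.-‿inverseʳ ℝ (a - b))) ,
    linear (a ∷ b ∷ (- (a - b)) ∷ ε ∷ []) (λ a b -d ε → -d :< ε ∷ # 0 :≈ a :- b :+ -d ∷ [] ⊢ b :< a :+ ε)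
      (p , sym (Reals.-‿inverseʳ ℝ (a - b)))
  ... | no ¬q =
    linear (a ∷ b ∷ ε ∷ []) (λ a b ε → a :- b :< ε ∷ [] ⊢ a :< b :+ ε) p ,
    linear (a ∷ b ∷ ε ∷ []) (λ a b ε → a :- b :< ε ∷ # 0 :≤ a :- b ∷ # 0 :≤ a :- b ∷ [] ⊢ b :< a :+ ε) (p , ≮⇒≥ ¬q , ≮⇒≥ ¬q)

  feasible-rounding : 0# < ε → ∀ {T ω̃ L U} → Spans [] T → Feasible ε ω̃ (T root) L U → IsRounding ℝ G ω ε ω̃
  feasible-rounding 0<ε {ω̃ = ω̃} F f π simple =
    let p , q = proj₁ (feasible-sound ε ω̃ 0<ε (proper-root F) f π (spanning-vertices F _) (All.universal (spanning-edges F) _) simple)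
    in within⇒∣∣< p q

  rounding-feasible : ∀ {T ω̃} → Spans [] T → IsRounding ℝ G ω ε ω̃ → ∃₂ λ L U → Feasible ε ω̃ (T root) L U
  rounding-feasible {T} {ω̃} F rounding =
    let L , U , f , _ = extremes ε ω̃ (λ π simple → ∣∣<⇒within (rounding π simple)) (T root) (proper-root F) in L , U , f

  -- The path with a single vertex has error 0.
  rounding⇒0<ε : ∀ {ω̃} → IsRounding ℝ G ω ε ω̃ → 0# < ε
  rounding⇒0<ε rounding = linear (ε ∷ []) (λ ε → # 0 :< # 0 :+ ε ∷ [] ⊢ # 0 :< ε)
    (proj₁ (∣∣<⇒within (rounding (stop {u = root}) ([] ∷ []))))

-- Contraction of the explored tree into the table of its root

module Contraction (ℝ : Reals) {n m : ℕ} (G : Graph n m) (tree : IsTree G) (ω : Fin m → Reals.Carrier ℝ)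
                   (0≤ω : ∀ e → Reals._≤_ ℝ (Reals.0# ℝ) (ω e)) (ε : Reals.Carrier ℝ)
                   (root : Fin n) (root≡0 : toℕ root ≡ 0) (elevation : ℕ → Reals.Carrier ℝ)
                   (2≤h : ∀ (v : Fin n) → Reals._≤_ ℝ (Reals.fromℕ ℝ 2) (elevation (toℕ v)))
                   (h<3 : ∀ (v : Fin n) → Reals._<_ ℝ (elevation (toℕ v)) (Reals.fromℕ ℝ 3))
                   (x : ℕ → Reals.Carrier ℝ)
                   (the-grid : Tables.Grid ℝ G ω (λ v → elevation (toℕ v)) 2≤h h<3 ε (6 ℕ.* n) x (TablePrograms.lowering ℝ n)) where
  open Reals ℝ using (Carrier; _≈_; _<_; _≤_; _+_; _-_; -_; 0#; fromℕ; trans; reflexive; +-comm)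
  open OrderedFieldProperties ℝ
  open Execution {ℝ}
  open ArrayPrograms ℝ
  open TablePrograms ℝ
  open Programs ℝ G ω ε
  open State
  open Exploration {G = G} root
  open Exploring tree root root≡0 0≤ω

  h : Fin n → Carrier
  h v = elevation (toℕ v)

  open GraftedTrees ℝ G ω h
  open Forests ℝ {G = G} root ω h
  open Tables ℝ G ω h 2≤h h<3 ε

  N : ℕ
  N = 6 ℕ.* n

  0<N : 0 ℕ.< N
  0<N = ℕ.≤-<-trans z≤n (Grid.last< the-grid)

  table-resp : ∀ {v F K} {t : Tree v} → (∀ {a} → a ℕ.< N → F a ≡ K a) → IsTable the-grid t F → IsTable the-grid t K
  table-resp {K = K} F≡K tb = record
    { nonneg   = λ a<N → ≡-subst (0# ≤_) (F≡K a<N) (IsTable.nonneg tb a<N)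
    ; sound    = λ {a} a<N → ≡-subst (λ y → 0# < y → ∃ λ ω̃ → Feasible ε ω̃ _ y (x a)) (F≡K a<N) (IsTable.sound tb a<N)
    ; complete = λ a<N f → ≡-subst (_ ≤_) (F≡K a<N) (IsTable.complete tb a<N f)
    }

  module _ (0<ε : 0# < ε) (ε<2 : ε < fromℕ 2) where

    Tabulated : List Step → Forest → State ℝ → Set
    Tabulated g T τ = ∀ {v} → v ∈ reached g → IsTable the-grid (T v) (row n τ (toℕ v))

    -- `g` lists the steps not undone yet. Vertices outside `reached g` have been absorbed into the
    -- trees of their parents, and their rows are no longer described.
    record Contracting (g : List Step) (T : Forest) (τ : State ℝ) : Set where
      constructor contracting
      field
        isInput    : Input τ
        candidates : rarr τ 1 ≡ x
        elevations : rarr τ 2 ≡ elevation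
        valid      : Valid g
        parents    : Recorded (λ s → toℕ (parent s)) (narr τ 3) g
        children   : Recorded (λ s → toℕ (child s)) (narr τ 4) g
        edges′     : Recorded (λ s → toℕ (edge s)) (narr τ 5) g
        slopes     : All (SlopeOf elevation) g
        spans      : Spans g T
        tabulated  : Tabulated g T τ

    contracting-set : ∀ {g T} a σ → Contracting g T σ → Contracting g T (exec (set 2 a) σ)
    contracting-set a σ C = contracting (input-kept (set 2 a) ≡-refl isInput) candidates elevations valid parents children edges′ slopes spans tabulated
      where open Contracting C

    module _ {s : Step} {g : List Step} {T : Forest} (valid : Valid (s ∷ g)) (spans : Spans (s ∷ g) T) (z : ℕ) (slope : Slope s z) where

      module _ (τ : State ℝ) (isInput : Input τ) (candidates : rarr τ 1 ≡ x) (tabulated : Tabulated (s ∷ g) T τ)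
               (p≡ : nvar τ 4 ≡ toℕ (parent s)) (c≡ : nvar τ 5 ≡ toℕ (child s)) (r≡ : rvar τ 1 ≡ h (parent s))
               (w≈ : rvar τ 2 ≈ fromℕ z) where

        private
          p c : ℕ
          p = toℕ (parent s)
          c = toℕ (child s)
          p∈ : parent s ∈ reached (s ∷ g)
          p∈ = proj₁ (step-reached valid (here ≡-refl))
          tableᶜ : IsTable the-grid (T (child s)) (row n τ c)
          tableᶜ = tabulated (here ≡-refl)
          K H : ℕ → Carrier
          K = rarr (exec lift τ) 4
          H = rarr (exec lift τ) 5
          Lifted : Set
          Lifted = (∀ {b} → b ℕ.< N → K b ≡ row n τ p b) × Specifications.IsLifted ℝ N x (lowering n) ε z (row n τ c) H
          lifted : Lifted
          lifted = lift-correct n x ε {p} {c} {z} {rarr τ 3} τ (Input.order isInput , p≡ , c≡ , ≡-refl , w≈)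
          tableᴷ : IsTable the-grid (T (parent s)) K
          tableᴷ = table-resp (λ a<N → ≡-sym (proj₁ lifted a<N)) (tabulated p∈)
          F′ : ℕ → ℕ → Carrier
          F′ = row n (exec merge (exec lift τ))
          Merged : Set
          Merged = Specifications.IsMerged ℝ N x (lowering n) ε (h (parent s)) K H (F′ p) ×
                   (∀ {v A} → v ≢ p → A ℕ.< N → F′ v A ≡ row n τ v A)
          merged : Merged
          merged = merge-correct n x ε {h (parent s)} {K} {H} (Grid.mono the-grid) (table-mono the-grid tableᴷ)
            (lifted-mono the-grid {z = z} tableᶜ (proj₂ lifted)) p (rarr τ 3) (exec lift τ) 0<N
            (≡-trans (frame ℕ-var 0 lift τ ≡-refl) (Input.order isInput) , ≡-trans (frame ℕ-var 4 lift τ ≡-refl) p≡ ,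
             ≡-trans (frame ℝ-var 0 lift τ ≡-refl) (Input.bound isInput) , ≡-trans (frame ℝ-var 1 lift τ ≡-refl) r≡ ,
             ≡-trans (frame ℝ-array 1 lift τ ≡-refl) candidates , ≡-refl , ≡-refl)
            (frame ℝ-array 3 lift τ ≡-refl)
          unreached : Valid (s ∷ g) → ∀ {v} → v ∈ reached g → v ≢ child s
          unreached ((_ , c∉) ∷ _) v∈ ≡-refl = c∉ v∈
          was-reached : Valid (s ∷ g) → parent s ∈ reached g
          was-reached ((p∈ , _) ∷ _) = p∈
          disjoint : ∀ {u} → Vertex (T (parent s)) u → Vertex (T (child s)) u → ⊥
          disjoint = Spans.disjoint spans p∈ (here ≡-refl) (unreached valid (was-reached valid))
          planted : IsTable the-grid (graft (T (parent s)) (edge s) (joins s) z slope (T (child s))) (F′ p)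
          planted = graft-table the-grid 0<ε ε<2 (joins s) slope disjoint tableᴷ tableᶜ (proj₂ lifted) (proj₁ merged)

        contract-tabulated : Tabulated g (plant T s z slope) (exec merge (exec lift τ))
        contract-tabulated {v} v∈ = cases (v Finₚ.≟ parent s)
          where
          cases : Dec (v ≡ parent s) → IsTable the-grid (plant T s z slope v) (F′ (toℕ v))
          cases (yes ≡-refl) = ≡-subst (λ t → IsTable the-grid t (F′ p)) (≡-sym (plant-parent T s z slope)) planted
          cases (no v≢p) = ≡-subst (λ t → IsTable the-grid t (F′ (toℕ v))) (≡-sym (plant-other T s z slope v≢p))
            (table-resp (λ a<N → ≡-sym (proj₂ merged (λ eq → v≢p (Finₚ.toℕ-injective eq)) a<N)) (tabulated (there v∈)))

    contract-correct : ∀ {s g T} τ → Contracting (s ∷ g) T τ → nvar τ 1 ∸ 1 ∸ nvar τ 2 ≡ length g →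
                       ∃ λ T′ → Contracting g T′ (exec contract τ)
    contract-correct {s} {g} {T} τ (contracting isInput candidates elevations valid@(_ ∷ valid′) parents children edges′ ((z , slope) ∷ slopes) spans tabulated) index =
      plant T s z slope , contracting (input-kept contract ≡-refl isInput)
        (≡-trans (frame ℝ-array 1 contract τ ≡-refl) candidates)
        (≡-trans (frame ℝ-array 2 contract τ ≡-refl) elevations)
        valid′
        (≡-subst (λ f → Recorded (λ s → toℕ (parent s)) f g) (≡-sym (frame ℕ-array 3 contract τ ≡-refl)) (proj₂ parents))
        (≡-subst (λ f → Recorded (λ s → toℕ (child s)) f g) (≡-sym (frame ℕ-array 4 contract τ ≡-refl)) (proj₂ children))
        (≡-subst (λ f → Recorded (λ s → toℕ (edge s)) f g) (≡-sym (frame ℕ-array 5 contract τ ≡-refl)) (proj₂ edges′))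
        slopes (spans-plant valid spans z slope)
        (contract-tabulated valid spans z slope (exec prepare τ) (input-kept prepare ≡-refl isInput) candidates tabulated p≡ c≡ r≡ w≈)
      where
      p≡ : narr τ 3 (nvar τ 1 ∸ 1 ∸ nvar τ 2) ≡ toℕ (parent s)
      p≡ = ≡-trans (≡-cong (narr τ 3) index) (proj₁ parents)
      c≡ : narr τ 4 (nvar τ 1 ∸ 1 ∸ nvar τ 2) ≡ toℕ (child s)
      c≡ = ≡-trans (≡-cong (narr τ 4) index) (proj₁ children)
      e≡ : narr τ 5 (nvar τ 1 ∸ 1 ∸ nvar τ 2) ≡ toℕ (edge s)
      e≡ = ≡-trans (≡-cong (narr τ 5) index) (proj₁ edges′)
      r≡ : rarr τ 2 (narr τ 3 (nvar τ 1 ∸ 1 ∸ nvar τ 2)) ≡ h (parent s)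
      r≡ = ≡-cong₂ (λ f i → f i) elevations p≡
      w≡ : rvar (exec prepare τ) 2 ≡ h (child s) - h (parent s) + ω (edge s)
      w≡ = ≡-cong₂ _+_ (≡-cong₂ _-_ (≡-cong₂ (λ f i → f i) elevations c≡) r≡)
             (≡-trans (≡-cong (rarr τ 0) e≡) (Input.weights isInput (edge s)))
      w≈ : rvar (exec prepare τ) 2 ≈ fromℕ z
      w≈ = trans (reflexive w≡) (linear (h (child s) ∷ h (parent s) ∷ ω (edge s) ∷ fromℕ z ∷ [])
        (λ hc hp w z → hc :+ w :≈ hp :+ z ∷ [] ⊢ hc :- hp :+ w :≈ z) slope)

    Contraction-invariant : ℕ → State ℝ → Set
    Contraction-invariant j τ = ∃₂ λ g T → length g ℕ.+ j ≡ m × Contracting g T τ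

    contract-step : ∀ j τ → j ℕ.< m → nvar τ 2 ≡ j → Contraction-invariant j τ →
                    Contraction-invariant (suc j) (exec (set 2 (increment 2)) (exec contract τ))
    contract-step j τ j<m 2≡j ([] , T , eq , C) = ⊥-elim (ℕ.<-irrefl eq j<m)
    contract-step j τ j<m 2≡j (s ∷ g , T , eq , C) =
      let T′ , C′ = contract-correct τ C index in
      g , T′ , ≡-trans (ℕ.+-suc (length g) j) eq , contracting-set (increment 2) (exec contract τ) C′
      where
      index : nvar τ 1 ∸ 1 ∸ nvar τ 2 ≡ length g
      index = ≡-trans (≡-cong₂ (λ a b → a ∸ 1 ∸ b) (≡-trans (Input.size (Contracting.isInput C)) (≡-sym eq)) 2≡j)
                (ℕ.m+n∸n≡m (length g) j)

    contractAll-correct : ∀ {g} σ → length g ≡ m → Contracting g single σ → ∃ λ T → Contracting [] T (exec contractAll σ)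
    contractAll-correct {g} σ length≡m C = finish (≡-subst (λ k → Contraction-invariant k (exec contractAll σ)) (Input.size isInput)
      (loop-rule Contraction-invariant 2 edgeCount contract σ ≡-refl
        (g , single , ≡-trans (ℕ.+-identityʳ _) length≡m , reset)
        (λ j τ j< → contract-step j τ (≡-subst (j ℕ.<_) (Input.size isInput) j<))))
      where
      open Contracting C using (isInput)
      reset : Contracting g single (exec (set 2 (lit 0)) σ)
      reset = contracting-set (lit 0) σ C
      finish : Contraction-invariant m (exec contractAll σ) → ∃ λ T → Contracting [] T (exec contractAll σ)
      finish ([] , T , _ , C) = T , C
      finish (s ∷ g , T , eq , _) = ⊥-elim (ℕ.m+1+n≢m m (≡-trans (ℕ.+-suc m (length g)) (≡-trans (≡-cong suc (ℕ.+-comm m (length g))) eq)))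

Decided : (ℝ : Reals) {n m : ℕ} → Graph n m → (Fin m → Reals.Carrier ℝ) → Reals.Carrier ℝ → State ℝ → Set
Decided ℝ G ω ε σ = (output σ ≡ 1 × AdmitsRounding ℝ G ω ε) ⊎ (output σ ≡ 0 × ¬ AdmitsRounding ℝ G ω ε)

-- Correctness of the verdict

module Decision (ℝ : Reals) {n m : ℕ} (G : Graph n m) (tree : IsTree G) (ω : Fin m → Reals.Carrier ℝ)
                (0≤ω : ∀ e → Reals._≤_ ℝ (Reals.0# ℝ) (ω e)) (ε : Reals.Carrier ℝ)
                (root : Fin n) (root≡0 : toℕ root ≡ 0) where
  open Reals ℝ using (Carrier; _≈_; _<_; _≤_; _+_; 0#; fromℕ; _<?_; trans; reflexive)
  open OrderedFieldProperties ℝ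
  open Execution {ℝ}
  open ArrayPrograms ℝ
  open TablePrograms ℝ
  open Programs ℝ G ω ε
  open State
  open Exploration {G = G} root
  open Exploring tree root root≡0 0≤ω

  module AfterExploration .{{_ : ℕ.NonZero n}} (σ₁ : State ℝ) (input₁ : Input σ₁) (no-rows : ∀ i → rarr σ₁ 3 i ≡ 0#)
                          (g : List Step) (length≡m : length g ≡ m) (exploration : ExploredIn g σ₁) where
    private
      module E = Explored exploration

    σ₂ σ₃ σ₄ σ₅ : State ℝ
    σ₂ = exec sort σ₁
    σ₃ = exec period σ₂
    σ₄ = exec singletons σ₃
    σ₅ = exec contractAll σ₄

    all-reached : ∀ v → v ∈ reached g
    all-reached = closed-reached tree (complete-closed tree E.valid (ℕ.≤-reflexive (≡-sym length≡m)))

    h : Fin n → Carrier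
    h v = rarr σ₁ 2 (toℕ v)

    2≤h : ∀ v → fromℕ 2 ≤ h v
    2≤h v = height≥2 {rarr σ₁ 1} {rarr σ₁ 2} (E.heights (all-reached v))

    h<3 : ∀ v → h v < fromℕ 3
    h<3 v = height<3 {rarr σ₁ 1} {rarr σ₁ 2} (E.heights (all-reached v))

    sort-spec : SortedUpTo n (rarr σ₂ 1) × SameValues n (rarr σ₁ 1) (rarr σ₂ 1)
    sort-spec = sort-correct n σ₁ (Input.order input₁)

    fractions : ∀ {a} → a ℕ.< n → ∃ λ v → rarr σ₁ 1 (toℕ v) ≡ rarr σ₂ 1 a
    fractions a<n with proj₂ (proj₂ sort-spec) a<n
    ... | k , k<n , eq = fromℕ< k<n , ≡-trans (≡-cong (rarr σ₁ 1) (Finₚ.toℕ-fromℕ< k<n)) eq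

    0≤x₀ : ∀ {a} → a ℕ.< n → 0# ≤ rarr σ₂ 1 a
    0≤x₀ a<n with fractions a<n
    ... | v , eq = ≡-subst (0# ≤_) eq (proj₁ (E.heights (all-reached v)))

    x₀<1 : ∀ {a} → a ℕ.< n → rarr σ₂ 1 a < fromℕ 1
    x₀<1 a<n with fractions a<n
    ... | v , eq = ≡-subst (_< fromℕ 1) eq (proj₁ (proj₂ (E.heights (all-reached v))))

    height-base : ∀ v → ∃ λ j → j ℕ.< n × h v ≈ rarr σ₂ 1 j + fromℕ 2
    height-base v with proj₁ (proj₂ sort-spec) (Finₚ.toℕ<n v)
    ... | j , j<n , eq = j , j<n , trans (proj₂ (proj₂ (E.heights (all-reached v)))) (reflexive (≡-cong (_+ fromℕ 2) (≡-sym eq)))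

    open Candidates ℝ n (rarr σ₂ 1) (λ {a} {b} → proj₁ sort-spec a b) 0≤x₀ x₀<1

    x : ℕ → Carrier
    x = rarr σ₃ 1

    input₂ : Input σ₂
    input₂ = input-kept sort ≡-refl input₁

    x-candidate : ∀ {a} → a ℕ.< 6 ℕ.* n → x a ≈ candidate a
    x-candidate = period-correct n (rarr σ₂ 1) candidate candidate-base
      (λ a → trans (reflexive (≡-cong (λ k → candidate (a ℕ.+ k)) (≡-sym (ℕ.+-identityʳ n)))) (candidate-shift a 1))
      σ₂ (Input.order input₂) (λ _ → ≡-refl)

    open GraftedTrees ℝ G ω h
    open Forests ℝ {G = G} root ω h
    open Tables ℝ G ω h 2≤h h<3 ε
    open SpanningTrees ℝ {G = G} root ω h ε

    N : ℕ
    N = 6 ℕ.* n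

    the-grid : Grid N x lowered
    the-grid = grid G ω h 2≤h h<3 ε height-base x x-candidate

    open Contraction ℝ G tree ω 0≤ω ε root root≡0 (rarr σ₁ 2) 2≤h h<3 x the-grid
      using (Contracting; contracting; contractAll-correct)

    spans-start : Spans g single
    spans-start = spans-single all-reached (all-used tree E.valid all-reached)

    input₃ : Input σ₃
    input₃ = input-kept period ≡-refl input₂

    contracting-start : (0<ε : 0# < ε) (ε<2 : ε < fromℕ 2) → Contracting 0<ε ε<2 g single σ₄
    contracting-start _ _ = contracting (input-kept singletons ≡-refl input₃)
      (frame ℝ-array 1 singletons σ₃ ≡-refl)
      (frame ℝ-array 2 (sort ▸ period ▸ singletons) σ₁ ≡-refl)
      E.valid
      (≡-subst (λ f → Recorded (λ s → toℕ (parent s)) f g) (≡-sym (frame ℕ-array 3 (sort ▸ period ▸ singletons) σ₁ ≡-refl)) E.parents)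
      (≡-subst (λ f → Recorded (λ s → toℕ (child s)) f g) (≡-sym (frame ℕ-array 4 (sort ▸ period ▸ singletons) σ₁ ≡-refl)) E.children)
      (≡-subst (λ f → Recorded (λ s → toℕ (edge s)) f g) (≡-sym (frame ℕ-array 5 (sort ▸ period ▸ singletons) σ₁ ≡-refl)) E.edges′)
      E.slopes spans-start
      (λ {v} _ → single-table the-grid (λ {a} a<N →
        ≡-subst (λ f → SingletonCell n x f (toℕ v) a (row n σ₄ (toℕ v) a)) (frame ℝ-array 2 (sort ▸ period) σ₁ ≡-refl)
          (singletons-correct n σ₃ (Input.order input₃)
            (λ i → ≡-trans (≡-cong (λ f → f i) (frame ℝ-array 3 (sort ▸ period) σ₁ ≡-refl)) (no-rows i)) (Finₚ.toℕ<n v) a<N)))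

    contracted : (0<ε : 0# < ε) (ε<2 : ε < fromℕ 2) → ∃ λ T → Contracting 0<ε ε<2 [] T σ₅
    contracted 0<ε ε<2 = contractAll-correct 0<ε ε<2 σ₄ length≡m (contracting-start 0<ε ε<2)

    input₅ : Input σ₅
    input₅ = input-kept (sort ▸ period ▸ singletons ▸ contractAll) ≡-refl input₁

    decided : Decided ℝ G ω ε (exec answer σ₅)

    decided = cond-rule (Decided ℝ G ω ε) (varᴿ 0 `<ᴿ cast (lit 2)) inner (set 0 (lit 1)) σ₅
      (λ e → small (≡-subst (_< fromℕ 2) (Input.bound input₅) (<?-true e)))
      (λ e → inj₁ (≡-refl , large (≡-subst (fromℕ 2 ≤_) (Input.bound input₅) (<?-false e)) (plant-all E.valid E.slopes spans-start)))
      where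
      test : BExp
      test = cast (lit 0) `<ᴿ varᴿ 0 `∧ cast (lit 0) `<ᴿ (3 atᴿ (rowLength `∸ lit 1))
      inner : Code
      inner = cond test (set 0 (lit 1)) (set 0 (lit 0))
      large : fromℕ 2 ≤ ε → (∃ λ T → Spans [] T) → AdmitsRounding ℝ G ω ε
      large 2≤ε (T , F) =
        let ω̃ , _ , _ , f , _ = rigid 2≤ε (T root) (proper-root F)
        in ω̃ , feasible-rounding (linear (ε ∷ []) (λ ε → # 2 :≤ ε ∷ [] ⊢ # 0 :< ε) 2≤ε) F f
      last-cell : row n σ₅ (toℕ root) (N ∸ 1) ≡ rarr σ₅ 3 (6 ℕ.* nvar σ₅ 0 ∸ 1)
      last-cell = ≡-cong (rarr σ₅ 3) (≡-cong₂ (λ v k → v ℕ.* N ℕ.+ (6 ℕ.* k ∸ 1)) root≡0 (≡-sym (Input.order input₅)))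
      module _ (0<ε : 0# < ε) (ε<2 : ε < fromℕ 2) {T : Forest} (C : Contracting 0<ε ε<2 [] T σ₅) where
        root-table : IsTable the-grid (T root) (row n σ₅ (toℕ root))
        root-table = Contracting.tabulated C (here ≡-refl)
        admits : 0# < rarr σ₅ 3 (6 ℕ.* nvar σ₅ 0 ∸ 1) → AdmitsRounding ℝ G ω ε
        admits 0<F =
          let ω̃ , f = IsTable.sound root-table (Grid.last< the-grid) (≡-subst (0# <_) (≡-sym last-cell) 0<F)
          in ω̃ , feasible-rounding 0<ε (Contracting.spans C) f
        refuse : rarr σ₅ 3 (6 ℕ.* nvar σ₅ 0 ∸ 1) ≤ 0# → ¬ AdmitsRounding ℝ G ω ε
        refuse F≤0 (ω̃ , rounding) =
          let _ , _ , f = rounding-feasible (Contracting.spans C) rounding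
          in <⇒≱ (≡-subst (0# <_) last-cell (table-decides the-grid 0<ε ε<2 root-table f)) F≤0
      small : ε < fromℕ 2 → Decided ℝ G ω ε (exec inner σ₅)
      small ε<2 = cond-rule (Decided ℝ G ω ε) test (set 0 (lit 1)) (set 0 (lit 0)) σ₅
        (λ e → inj₁ (≡-refl , accept (∧-true {⌊ 0# <? rvar σ₅ 0 ⌋} e)))
        (λ e → inj₂ (≡-refl , reject e))
        where
        accept : ⌊ 0# <? rvar σ₅ 0 ⌋ ≡ true × ⌊ 0# <? rarr σ₅ 3 (6 ℕ.* nvar σ₅ 0 ∸ 1) ⌋ ≡ true → AdmitsRounding ℝ G ω ε
        accept (e₁ , e₂) = admits 0<ε ε<2 (proj₂ (contracted 0<ε ε<2)) (<?-true e₂)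
          where
          0<ε : 0# < ε
          0<ε = ≡-subst (0# <_) (Input.bound input₅) (<?-true e₁)
        reject : ⌊ 0# <? rvar σ₅ 0 ⌋ ∧ ⌊ 0# <? rarr σ₅ 3 (6 ℕ.* nvar σ₅ 0 ∸ 1) ⌋ ≡ false → ¬ AdmitsRounding ℝ G ω ε
        -- The rounding to be refuted supplies `0 < ε` itself, so the test that failed must be the
        -- one on the table.
        reject e (ω̃ , rounding) = refuse 0<ε ε<2 (proj₂ (contracted 0<ε ε<2))
          (<?-false (∧-false e (<?-complete (≡-subst (0# <_) (≡-sym (Input.bound input₅)) 0<ε)))) (ω̃ , rounding)
          where
          0<ε : 0# < ε
          0<ε = rounding⇒0<ε rounding

module Correctness (ℝ : Reals) {n m : ℕ} (G : Graph n m) (tree : IsTree G) (ω : Fin m → Reals.Carrier ℝ)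
                   (0≤ω : ∀ e → Reals._≤_ ℝ (Reals.0# ℝ) (ω e)) (ε : Reals.Carrier ℝ) where
  open Execution {ℝ}
  open Programs ℝ G ω ε

  private
    root : Fin n
    root = fromℕ< (IsTree.nonEmpty tree)
    root≡0 : toℕ root ≡ 0
    root≡0 = Finₚ.toℕ-fromℕ< (IsTree.nonEmpty tree)
    instance
      n≢0 : ℕ.NonZero n
      n≢0 = ℕ.>-nonZero (IsTree.nonEmpty tree)
    σ₀ : State ℝ
    σ₀ = input {ℝ} G ω ε

  open Exploration {G = G} root
  open Exploring tree root root≡0 0≤ω
  open Decision ℝ G tree ω 0≤ω ε root root≡0

  explored-all : Exploration-invariant m (exec explore σ₀)
  explored-all = explore-correct input-initial (λ _ → ≡-refl) (λ _ → ≡-refl)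

  decided : Decided ℝ G ω ε (exec algorithm σ₀)
  decided = conclude explored-all
    where
    conclude : Exploration-invariant m (exec explore σ₀) → Decided ℝ G ω ε (exec algorithm σ₀)
    conclude (i , g , length≡m , e) = AfterExploration.decided (exec explore σ₀) i
      (λ j → ≡-cong (λ f → f j) (frame ℝ-array 3 explore σ₀ ≡-refl)) g length≡m e

  -- `degree algorithm` evaluates to 2. Loops over the edges are charged with `n` turns, and `m ≤ n`
  -- is taken from the correctness proof: the exploration makes `m` steps and reaches `m + 1`
  -- distinct vertices.
  running-time : Runs algorithm σ₀ (factor algorithm ℕ.* n ℕ.^ 2)
  running-time = Cost.run n m (size≤order explored-all) algorithm σ₀ ≡-refl (≡-refl , ≡-refl)
    where
    size≤order : Exploration-invariant m (exec explore σ₀) → m ℕ.≤ n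
    size≤order (_ , g , length≡m , e) = ≡-subst (ℕ._≤ n) length≡m (ℕ.<⇒≤ (reached-bound (Explored.valid e)))

theorem2 : (ℝ : Reals) →
    ∃ λ (P : Program) →
    ∃ λ (c : ℕ) →
    ∀ (n m : ℕ) (T : Graph n m) → IsTree T →
    (ω : Fin m → Reals.Carrier ℝ) → (∀ e → Reals._≤_ ℝ (Reals.0# ℝ) (ω e)) →
    (ε : Reals.Carrier ℝ) →
    ∃₂ λ (t : ℕ) (σ : State ℝ) →
    (⟨ P , input {ℝ} T ω ε ⟩⇓⟨ t , σ ⟩) ×
    (t ≤ᴺ c * n ^ 2) ×
    ((output σ ≡ 1 × AdmitsRounding ℝ T ω ε) ⊎ (output σ ≡ 0 × ¬ AdmitsRounding ℝ T ω ε))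
theorem2 ℝ = compile algorithm , factor algorithm , λ n m T tree ω 0≤ω ε →
  let open Correctness ℝ T tree ω 0≤ω ε
      t , run , t≤ = running-time
  in t , _ , run , t≤ , decided
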